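{- For all nonnegative integers $r_1,r_2$ and every positive integer $n\ge r_1+r_2+2$, \begin{align*} &\frac{1}{r_1!\,r_2!}\sum_{\substack{i+j+k=2n\\ i,j,k\ge1}}\frac{B_iB_jB_k}{i!\,j!\,k!}\prod_{a=1}^{r_1}(i-a)\prod_{b=1}^{r_2}(j-b)\\ &=\mathop{\mathrm{Cyc}}_{r_1,r_2}\left(\frac{(-1)^{r_1+r_2}B_{r_1+1}B_{2n-r_1-1}}{(r_1+1)!\,(2n-r_1-1)!}+\frac{\delta_{r_1,0}}{2}\binom{2n-3}{r_2}\frac{B_{2n-2}}{(2n-2)!}\right)\\ &\quad+\left(\binom{2n}{r_1+r_2+2}+\mathop{\mathrm{Cyc}}_{r_1,r_2}(-1)^{r_2}\binom{2n}{r_1+1}+(-1)^{r_1+r_2}\right)\frac{B_{2n}}{(2n)!}\\ &\quad+\mathop{\mathrm{Cyc}}_{r_1,r_2}(-1)^{r_1}\sum_{k=r_1+1}^{r_1+r_2+1}\binom{k-1}{r_1}\binom{2n-k-1}{r_2+r_1+1-k}\frac{B_k}{k!}\frac{B_{2n-k}}{(2n-k)!}\\ &\quad+\mathop{\mathrm{Cyc}}_{r_1,r_2}(-1)^{r_2}\sum_{k=1}^{r_1+1}\binom{2n-1-k}{r_1+1-k}\frac{B_k}{k!}\frac{B_{2n-k}}{(2n-k)!}\\ &\quad+\sum_{k=1}^{r_2}(-1)^k\binom{2n-1-k}{r_1+r_2+2-k}\frac{B_k}{k!}\frac{B_{2n-k}}{(2n-k)!}\\ &\quad-\sum_{k=0}^{r_2}\sum_{j=r_2+2}^{r_1+r_2+1}(-1)^{r_2}\binom{j-1-k}{r_2+1-k}\binom{2n-1-j}{r_1+r_2+2-j}\frac{B_kB_{j-k}B_{2n-j}}{k!\,(j-k)!\,(2n-j)!}\\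 &\quad+\sum_{k=0}^{r_2}\sum_{j=r_1+1+k}^{r_1+r_2+1}(-1)^{r_1+k}\binom{j-1-k}{r_1}\binom{2n-1-j}{r_1+r_2+2-j}\frac{B_kB_{j-k}B_{2n-j}}{k!\,(j-k)!\,(2n-j)!}. \end{align*}
   Context: The Bernoulli numbers $B_j$ are defined by $\frac{t}{e^t-1}=\sum_{j\ge0}B_j\frac{t^j}{j!}$ (so $B_0=1$, $B_1=-1/2$). $\delta$ is the Kronecker delta. For any expression $f(r_1,r_2)$, $\mathop{\mathrm{Cyc}}_{r_1,r_2} f(r_1,r_2)=f(r_1,r_2)+f(r_2,r_1)$ (roles of $r_1,r_2$ interchanged everywhere, including in $\delta_{r_1,0}$, signs and summation limits). Binomial coefficients $\binom{a}{b}$ vanish for $b<0$ or $b>a$; empty sums are $0$ and empty products are $1$. -}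

module Defs where

open import Data.Nat as ℕ using (ℕ; zero; suc; _∸_; _!)
open import Data.Nat.Properties using (_!≢0)
open import Data.Nat.Combinatorics using (_C_)
open import Data.Integer using (+_)
open import Data.Rational using (ℚ; 0ℚ; 1ℚ; _+_; _*_; _-_; -_; _/_)
open import Data.List using (List; []; _∷_; _++_)

nat : ℕ → ℚ
nat n = + n / 1

sgn : ℕ → ℚ
sgn zero    = 1ℚ
sgn (suc k) = - sgn k

δ0 : ℕ → ℚ
δ0 zero    = 1ℚ
δ0 (suc _) = 0ℚ

-- binomial coefficient (ℕ, vanishes for b > a) as a rational
binom : ℕ → ℕ → ℚ
binom a b = nat (a C b)

invFact : ℕ → ℚ
invFact n = (+ 1 / (n !)) {{n !≢0}}

sumFrom : ℕ → ℕ → (ℕ → ℚ) → ℚ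
sumFrom a zero    f = 0ℚ
sumFrom a (suc l) f = f a + sumFrom (suc a) l f

-- Σ_{k=a}^{b} f k  (empty, i.e. 0, when b < a)
Σ[_⋯_] : ℕ → ℕ → (ℕ → ℚ) → ℚ
Σ[ a ⋯ b ] f = sumFrom a (suc b ∸ a) f

prodFrom : ℕ → ℕ → (ℕ → ℚ) → ℚ
prodFrom a zero    f = 1ℚ
prodFrom a (suc l) f = f a * prodFrom (suc a) l f

-- Π_{k=a}^{b} f k  (empty, i.e. 1, when b < a)
Π[_⋯_] : ℕ → ℕ → (ℕ → ℚ) → ℚ
Π[ a ⋯ b ] f = prodFrom a (suc b ∸ a) f

-- Bernoulli numbers, t/(e^t-1) = Σ B_j t^j/j!.
-- Comparing coefficients of t^{m+1} in t = (e^t - 1)·Σ B_j t^j/j! gives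
-- B_0 = 1 and Σ_{k=0}^{m} C(m+1,k) B_k = 0 for m ≥ 1, i.e.
-- B_m = -1/(m+1) Σ_{k=0}^{m-1} C(m+1,k) B_k.

weighted : ℕ → ℕ → List ℚ → ℚ
weighted N start []       = 0ℚ
weighted N start (x ∷ xs) = binom N start * x + weighted N (suc start) xs

bernoulliList : ℕ → List ℚ
bernoulliList zero    = 1ℚ ∷ []
bernoulliList (suc m) =
  bernoulliList m ++ ((- (+ 1 / suc (suc m))) * weighted (suc (suc m)) 0 (bernoulliList m) ∷ [])

nth : List ℚ → ℕ → ℚ
nth []       _       = 0ℚ
nth (x ∷ xs) zero    = x
nth (x ∷ xs) (suc k) = nth xs k

B : ℕ → ℚ
B n = nth (bernoulliList n) n

fallProd : ℕ → ℕ → ℚ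
fallProd i r = Π[ 1 ⋯ r ] (λ a → nat i - nat a)

-- LHS: 1/(r1! r2!) Σ_{i+j+k=2n, i,j,k≥1} B_iB_jB_k/(i!j!k!) Π(i-a) Π(j-b)
-- parametrised by i ∈ [1, 2n-2], j ∈ [1, 2n-1-i], k = 2n-i-j (≥ 1).
lhs : ℕ → ℕ → ℕ → ℚ
lhs r₁ r₂ n =
  invFact r₁ * invFact r₂ *
  Σ[ 1 ⋯ 2 ℕ.* n ∸ 2 ] (λ i → Σ[ 1 ⋯ 2 ℕ.* n ∸ 1 ∸ i ] (λ j →
    let k = 2 ℕ.* n ∸ i ∸ j in
    B i * B j * B k * invFact i * invFact j * invFact k
      * fallProd i r₁ * fallProd j r₂))

Cyc : (ℕ → ℕ → ℚ) → ℕ → ℕ → ℚ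
Cyc f r₁ r₂ = f r₁ r₂ + f r₂ r₁

b : ℕ → ℚ
b k = B k * invFact k

rhs : ℕ → ℕ → ℕ → ℚ
rhs r₁ r₂ n =
    Cyc (λ s₁ s₂ →
          sgn (s₁ ℕ.+ s₂) * B (s₁ ℕ.+ 1) * B (N ∸ s₁ ∸ 1)
            * invFact (s₁ ℕ.+ 1) * invFact (N ∸ s₁ ∸ 1)
        + (δ0 s₁ * (+ 1 / 2)) * binom (N ∸ 3) s₂ * (B (N ∸ 2) * invFact (N ∸ 2)))
        r₁ r₂
  + (binom N (r₁ ℕ.+ r₂ ℕ.+ 2)
      + Cyc (λ s₁ s₂ → sgn s₂ * binom N (s₁ ℕ.+ 1)) r₁ r₂
      + sgn (r₁ ℕ.+ r₂)) * (B N * invFact N)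
  + Cyc (λ s₁ s₂ → sgn s₁ *
        Σ[ s₁ ℕ.+ 1 ⋯ s₁ ℕ.+ s₂ ℕ.+ 1 ] (λ k →
          binom (k ∸ 1) s₁ * binom (N ∸ k ∸ 1) (s₂ ℕ.+ s₁ ℕ.+ 1 ∸ k)
            * b k * b (N ∸ k))) r₁ r₂
  + Cyc (λ s₁ s₂ → sgn s₂ *
        Σ[ 1 ⋯ s₁ ℕ.+ 1 ] (λ k →
          binom (N ∸ 1 ∸ k) (s₁ ℕ.+ 1 ∸ k) * b k * b (N ∸ k))) r₁ r₂
  + Σ[ 1 ⋯ r₂ ] (λ k →
      sgn k * binom (N ∸ 1 ∸ k) (r₁ ℕ.+ r₂ ℕ.+ 2 ∸ k) * b k * b (N ∸ k))
  - Σ[ 0 ⋯ r₂ ] (λ k → Σ[ r₂ ℕ.+ 2 ⋯ r₁ ℕ.+ r₂ ℕ.+ 1 ] (λ j →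
      sgn r₂ * binom (j ∸ 1 ∸ k) (r₂ ℕ.+ 1 ∸ k)
        * binom (N ∸ 1 ∸ j) (r₁ ℕ.+ r₂ ℕ.+ 2 ∸ j)
        * b k * b (j ∸ k) * b (N ∸ j)))
  + Σ[ 0 ⋯ r₂ ] (λ k → Σ[ r₁ ℕ.+ 1 ℕ.+ k ⋯ r₁ ℕ.+ r₂ ℕ.+ 1 ] (λ j →
      sgn (r₁ ℕ.+ k) * binom (j ∸ 1 ∸ k) r₁
        * binom (N ∸ 1 ∸ j) (r₁ ℕ.+ r₂ ℕ.+ 2 ∸ j)
        * b k * b (j ∸ k) * b (N ∸ j)))
  where
  N : ℕ
  N = 2 ℕ.* n

{-# OPTIONS --safe #-}

-- Put F = t / (e^t - 1) = Σ b_k t^k, G = F / t and G_r = G^(r) / r!.  The left-hand side is the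
-- coefficient of t^(2n) in the product of three such derivatives, with the polar parts removed.
-- From e^(t+ε) = e^t e^ε one gets
--   G(ε) (G(t+ε) - G(t)) = - (1 + G(t)) G(t+ε),
-- which expresses G G_r linearly through the G_j with Bernoulli coefficients.  Applying d/dt to
-- G_r G_s gives (r+1) G_(r+1) G_s + (s+1) G_r G_(s+1), and the expected linear expression for
-- G_r G_s obeys the same recursion, so G_r G_s, and then G G_r G_s, become linear in the G_j.
-- What is left is F(-t) = F(t) + t, which kills products b_k b_(2n-1-k).
--
-- To stay within power series, G_r is replaced by A_r = t^(r+1) G_r, and the Taylor variable ε
-- by t ε; thus the ε-series c(tε) stands for multiplication by c(ε).
module Submission where

open import Defs
open import Algebra.Bundles using (CommutativeRing)
import Algebra.Properties.Ring as RingProperties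
import Algebra.Solver.Ring as RingSolver
open import Algebra.Solver.Ring.AlmostCommutativeRing using (fromCommutativeRing; _-Raw-AlmostCommutative⟶_)
open import Algebra.Structures using (IsCommutativeRing)
import Data.Integer.Base as ℤ
import Data.Integer.Properties as ℤ
open import Data.List.Base using ([]; _∷_; _++_; length)
open import Data.List.Properties using (length-++)
open import Data.Maybe.Base using (Maybe; just; nothing)
open import Data.Nat using (ℕ; zero; suc; _∸_; _!; _≤_; _<_; s≤s; z≤n)
import Data.Nat as ℕ
open import Data.Nat.Combinatorics using (_C_; nCk+nC[k+1]≡[n+1]C[k+1]; k>n⇒nCk≡0; nCn≡1; nCk≡nC[n∸k])
import Data.Nat.Properties as ℕ
open import Data.Product.Base using (_,_)
open import Data.Rational using (ℚ; 0ℚ; 1ℚ; _/_; toℚᵘ)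
import Data.Rational as ℚ
import Data.Rational.Properties as ℚ
open import Data.Rational.Solver using (module +-*-Solver)
open import Data.Rational.Unnormalised using (mkℚᵘ; *≡*)
import Data.Rational.Unnormalised as ℚᵘ
import Data.Rational.Unnormalised.Properties as ℚᵘ
open import Data.Sum.Base using (inj₁; inj₂)
open import Function.Base using (_∘_; id)
open import Level using (0ℓ)
open import Relation.Binary.Definitions using (Tri; tri<; tri≈; tri>)
open import Relation.Binary.PropositionalEquality using (_≡_; _≢_)
import Relation.Binary.PropositionalEquality as ≡
import Relation.Binary.Reasoning.Setoid as SetoidReasoning
open import Relation.Binary.Structures using (IsEquivalence)
open import Relation.Nullary.Decidable.Core using (yes; no)
open import Relation.Nullary.Negation.Core using (contradiction)

-- Formal power series offer no `G` evaluated at `t + ε`, so the addition formula is not obtained by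
-- substitution. Its defect is shown to satisfy a homogeneous linear differential equation in `t`
-- and `ε`, which determines the coefficient of `ε^(r+1)` from that of `ε^r`.
--
-- Comparing coefficients of `ε` gives sums that stop one term early, because the last term occurs
-- twice and cancels; hence the two families `S` and `S′`.
--
-- The right-hand side is not visibly symmetric in `r₁` and `r₂`, although the left-hand side is.
-- Let `m = r₁ + r₂ + 1` and let `L c` be the coefficient of `t^(2n)` in `S′ c m`. Up to simpler
-- terms, the single sum and the first double sum together are `(-1)^r₂ L (β A_r₂)`, and the second
-- double sum is `(-1)^r₁ L (β A_r₁)`: two evaluations of the same kind of quantity.
--
-- The discrepancies that remain are sums of multiples of `b_k b_(2n-1-k)`. Parity leaves only
-- `k = 1`, and `b_1 = -1/2` is the origin of the factor `1/2` in the Kronecker delta terms.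

module RationalArithmetic where
  open import Data.Rational using (_+_; _*_)
  open ≡ using (refl; sym; trans; cong; cong₂)
  open +-*-Solver using (solve; _:=_; _:*_; :-_)

  toℚᵘ-/ : ∀ p d → toℚᵘ (p / suc d) ℚᵘ.≃ mkℚᵘ p d
  toℚᵘ-/ p d = ℚ.toℚᵘ-fromℚᵘ (mkℚᵘ p d)

  nat-+ : ∀ m n → nat (m ℕ.+ n) ≡ nat m + nat n
  nat-+ m n = ℚ.toℚᵘ-injective (begin
    toℚᵘ (nat (m ℕ.+ n))              ≈⟨ toℚᵘ-/ (ℤ.+ (m ℕ.+ n)) 0 ⟩
    mkℚᵘ (ℤ.+ (m ℕ.+ n)) 0              ≈⟨ *≡* (cong (ℤ._* ℤ.+ 1) (cong₂ ℤ._+_ (ℤ.*-identityʳ (ℤ.+ m)) (ℤ.*-identityʳ (ℤ.+ n)))) ⟨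
    mkℚᵘ (ℤ.+ m) 0 ℚᵘ.+ mkℚᵘ (ℤ.+ n) 0    ≈⟨ ℚᵘ.+-cong (toℚᵘ-/ (ℤ.+ m) 0) (toℚᵘ-/ (ℤ.+ n) 0) ⟨
    toℚᵘ (nat m) ℚᵘ.+ toℚᵘ (nat n)    ≈⟨ ℚ.toℚᵘ-homo-+ (nat m) (nat n) ⟨
    toℚᵘ (nat m + nat n)              ∎)
    where open ℚᵘ.≃-Reasoning

  nat-* : ∀ m n → nat (m ℕ.* n) ≡ nat m * nat n
  nat-* m n = ℚ.toℚᵘ-injective (begin
    toℚᵘ (nat (m ℕ.* n))              ≈⟨ toℚᵘ-/ (ℤ.+ (m ℕ.* n)) 0 ⟩
    mkℚᵘ (ℤ.+ (m ℕ.* n)) 0              ≈⟨ *≡* (cong (ℤ._* ℤ.+ 1) (ℤ.pos-* m n)) ⟩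
    mkℚᵘ (ℤ.+ m) 0 ℚᵘ.* mkℚᵘ (ℤ.+ n) 0    ≈⟨ ℚᵘ.*-cong (toℚᵘ-/ (ℤ.+ m) 0) (toℚᵘ-/ (ℤ.+ n) 0) ⟨
    toℚᵘ (nat m) ℚᵘ.* toℚᵘ (nat n)    ≈⟨ ℚ.toℚᵘ-homo-* (nat m) (nat n) ⟨
    toℚᵘ (nat m * nat n)              ∎)
    where open ℚᵘ.≃-Reasoning

  nat-suc : ∀ n → nat (suc n) ≡ 1ℚ + nat n
  nat-suc n = nat-+ 1 n

  nat-*-1/ : ∀ d .{{_ : ℕ.NonZero d}} → nat d * (ℤ.+ 1 / d) ≡ 1ℚ
  nat-*-1/ (suc d) = ℚ.toℚᵘ-injective (begin
    toℚᵘ (nat (suc d) * (ℤ.+ 1 / suc d))          ≈⟨ ℚ.toℚᵘ-homo-* (nat (suc d)) (ℤ.+ 1 / suc d) ⟩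
    toℚᵘ (nat (suc d)) ℚᵘ.* toℚᵘ (ℤ.+ 1 / suc d)  ≈⟨ ℚᵘ.*-cong (toℚᵘ-/ (ℤ.+ suc d) 0) (toℚᵘ-/ (ℤ.+ 1) d) ⟩
    mkℚᵘ (ℤ.+ suc d) 0 ℚᵘ.* mkℚᵘ (ℤ.+ 1) d          ≈⟨ *≡* (trans (ℤ.*-identityʳ (ℤ.+ suc d ℤ.* ℤ.+ 1))
                                                      (trans (ℤ.*-comm (ℤ.+ suc d) (ℤ.+ 1)) (cong (λ x → ℤ.+ 1 ℤ.* ℤ.+ suc x) (sym (ℕ.+-identityʳ d))))) ⟩
    ℚᵘ.1ℚᵘ                                      ∎)
    where open ℚᵘ.≃-Reasoning

  recip : ℕ → ℚ
  recip n = ℤ.+ 1 / suc n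

  recip-inverse : ∀ n → recip n * nat (suc n) ≡ 1ℚ
  recip-inverse n = trans (ℚ.*-comm (recip n) (nat (suc n))) (nat-*-1/ (suc n))

  nat-suc-cancel : ∀ n {p q} → nat (suc n) * p ≡ nat (suc n) * q → p ≡ q
  nat-suc-cancel n {p} {q} e = begin
    p                             ≡⟨ back p ⟨
    recip n * (nat (suc n) * p)   ≡⟨ cong (recip n *_) e ⟩
    recip n * (nat (suc n) * q)   ≡⟨ back q ⟩
    q                             ∎
    where
    open ≡.≡-Reasoning
    back : ∀ x → recip n * (nat (suc n) * x) ≡ x
    back x = trans (sym (ℚ.*-assoc (recip n) (nat (suc n)) x))
                   (trans (cong (_* x) (recip-inverse n)) (ℚ.*-identityˡ x))

  nat-!-invFact : ∀ n → nat (n !) * invFact n ≡ 1ℚ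
  nat-!-invFact n = nat-*-1/ (n !) {{n ℕ.!≢0}}

  invFact-suc : ∀ n → nat (suc n) * invFact (suc n) ≡ invFact n
  invFact-suc n = begin
    s * invFact (suc n)
      ≡⟨ ℚ.*-identityˡ _ ⟨
    1ℚ * (s * invFact (suc n))
      ≡⟨ cong (_* (s * invFact (suc n))) (trans (sym (nat-!-invFact n)) (ℚ.*-comm (nat (n !)) (invFact n))) ⟩
    invFact n * nat (n !) * (s * invFact (suc n))
      ≡⟨ solve 4 (λ i f s j → i :* f :* (s :* j) := i :* (s :* f :* j)) refl (invFact n) (nat (n !)) s (invFact (suc n)) ⟩
    invFact n * (s * nat (n !) * invFact (suc n))
      ≡⟨ cong (λ x → invFact n * (x * invFact (suc n))) (nat-* (suc n) (n !)) ⟨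
    invFact n * (nat (suc n !) * invFact (suc n))
      ≡⟨ cong (invFact n *_) (nat-!-invFact (suc n)) ⟩
    invFact n * 1ℚ
      ≡⟨ ℚ.*-identityʳ _ ⟩
    invFact n ∎
    where
    open ≡.≡-Reasoning
    s = nat (suc n)

  sgn-square : ∀ r → sgn r * sgn r ≡ 1ℚ
  sgn-square zero    = refl
  sgn-square (suc r) = trans
    (solve 1 (λ x → (:- x) :* (:- x) := x :* x) refl (sgn r)) (sgn-square r)

  nat-*-δ0 : ∀ r → nat r * δ0 r ≡ 0ℚ
  nat-*-δ0 zero    = refl
  nat-*-δ0 (suc r) = ℚ.*-zeroʳ (nat (suc r))

open RationalArithmetic

-- Rings over ℚ: one interface for ℚ, ℚ[[t]] and ℚ[[t]][[ε]].

record ℚ-Algebra : Set₁ where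
  field
    commutativeRing : CommutativeRing 0ℓ 0ℓ
  open CommutativeRing commutativeRing public
  field
    ι      : ℚ → Carrier
    ι-+    : ∀ p q → ι (p ℚ.+ q) ≈ ι p + ι q
    ι-*    : ∀ p q → ι (p ℚ.* q) ≈ ι p * ι q
    ι-neg  : ∀ p → ι (ℚ.- p) ≈ - ι p
    ι-0    : ι 0ℚ ≈ 0#
    ι-1    : ι 1ℚ ≈ 1#

  open RingProperties ring public
    using (-0#≈0#; -‿distribˡ-*; -‿distribʳ-*; x+x≈x⇒x≈0; +-inverseˡ-unique; x≈y⇒x∙y⁻¹≈ε; x∙y⁻¹≈ε⇒x≈y)

  private
    ι≟ : ∀ p q → Maybe (ι p ≈ ι q)
    ι≟ p q with p ℚ.≟ q
    ... | yes ≡.refl = just refl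
    ... | no _       = nothing

    ι-morphism : ℚ.+-*-rawRing -Raw-AlmostCommutative⟶ fromCommutativeRing commutativeRing
    ι-morphism = record
      { ⟦_⟧ = ι ; +-homo = ι-+ ; *-homo = ι-* ; -‿homo = ι-neg ; 0-homo = ι-0 ; 1-homo = ι-1 }

  module Solver = RingSolver ℚ.+-*-rawRing (fromCommutativeRing commutativeRing) ι-morphism ι≟

  module Reasoning = SetoidReasoning setoid

  private
    *-vanish : ∀ c {x y} → x ≈ y → c * (x - y) ≈ 0#
    *-vanish c x≈y = trans (*-congˡ (x≈y⇒x∙y⁻¹≈ε x≈y)) (zeroʳ c)

  -- A certificate for an equation: the difference of its sides is displayed as a multiple of the
  -- difference of a known equation. The display itself is an identity of polynomials, free of
  -- hypotheses.
  combine₁ : ∀ {x y} c {u v} → x - y ≈ c * (u - v) → u ≈ v → x ≈ y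
  combine₁ c e p = x∙y⁻¹≈ε⇒x≈y _ _ (trans e (*-vanish c p))

  combine₂ : ∀ {x y} c {u v} d {s t} →
             x - y ≈ c * (u - v) + d * (s - t) → u ≈ v → s ≈ t → x ≈ y
  combine₂ c d e p q =
    x∙y⁻¹≈ε⇒x≈y _ _ (trans e (trans (+-cong (*-vanish c p) (*-vanish d q)) (+-identityˡ 0#)))

ℚ-algebra : ℚ-Algebra
ℚ-algebra = record
  { commutativeRing = ℚ.+-*-commutativeRing
  ; ι = id ; ι-+ = λ _ _ → ≡.refl ; ι-* = λ _ _ → ≡.refl ; ι-neg = λ _ → ≡.refl
  ; ι-0 = ≡.refl ; ι-1 = ≡.refl }

-- Formal power series over such a ring.

module PowerSeries (K : ℚ-Algebra) where
  open ℚ-Algebra K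
  open Solver using (solve; _:=_; _:+_; _:*_)

  Series : Set
  Series = ℕ → Carrier

  infix 4 _≋_
  -- Wrapping the pointwise equality in a record keeps `f` and `g` inferable from the type of a
  -- proof.
  record _≋_ (f g : Series) : Set where
    constructor mk
    field at : ∀ n → f n ≈ g n
  open _≋_ public

  infixl 6 _⊕_
  infixl 7 _⊛_ _•_
  infix  8 ⊖_

  _⊕_ : Series → Series → Series
  (f ⊕ g) n = f n + g n

  ⊖_ : Series → Series
  (⊖ f) n = - f n

  _•_ : Carrier → Series → Series
  (a • f) n = a * f n

  -- The Cauchy product in the form `f g = f_0 g + t (tail f) g`, so that the ring laws follow by
  -- induction on the index.
  _⊛_ : Series → Series → Series
  (f ⊛ g) zero    = f 0 * g 0
  (f ⊛ g) (suc n) = f 0 * g (suc n) + ((f ∘ suc) ⊛ g) n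

  𝟎 : Series
  𝟎 _ = 0#

  const : Carrier → Series
  const a zero    = a
  const a (suc _) = 0#

  shift : ℕ → Series → Series
  shift zero    f n       = f n
  shift (suc k) f zero    = 0#
  shift (suc k) f (suc n) = shift k f n

  X : Series
  X = shift 1 (const 1#)

  ⊛-cong-at : ∀ {f f′ g g′} → (∀ n → f n ≈ f′ n) → (∀ n → g n ≈ g′ n) →
              ∀ n → (f ⊛ g) n ≈ (f′ ⊛ g′) n
  ⊛-cong-at p q zero    = *-cong (p 0) (q 0)
  ⊛-cong-at p q (suc n) = +-cong (*-cong (p 0) (q (suc n))) (⊛-cong-at (p ∘ suc) q n)

  -- The mirror image of the defining recursion: the last term is split off instead of the first.
  -- Commutativity results from the two together.
  ⊛-suc : ∀ f g n → (f ⊛ g) (suc n) ≈ (f ⊛ (g ∘ suc)) n + f (suc n) * g 0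
  ⊛-suc f g zero    = refl
  ⊛-suc f g (suc n) = begin
    f 0 * g (2 ℕ.+ n) + ((f ∘ suc) ⊛ g) (suc n)
      ≈⟨ +-congˡ (⊛-suc (f ∘ suc) g n) ⟩
    f 0 * g (2 ℕ.+ n) + (((f ∘ suc) ⊛ (g ∘ suc)) n + f (2 ℕ.+ n) * g 0)
      ≈⟨ +-assoc _ _ _ ⟨
    f 0 * g (2 ℕ.+ n) + ((f ∘ suc) ⊛ (g ∘ suc)) n + f (2 ℕ.+ n) * g 0 ∎
    where open Reasoning

  ⊛-comm-at : ∀ f g n → (f ⊛ g) n ≈ (g ⊛ f) n
  ⊛-comm-at f g zero    = *-comm _ _
  ⊛-comm-at f g (suc n) = begin
    f 0 * g (suc n) + ((f ∘ suc) ⊛ g) n ≈⟨ +-cong (*-comm _ _) (⊛-comm-at (f ∘ suc) g n) ⟩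
    g (suc n) * f 0 + (g ⊛ (f ∘ suc)) n ≈⟨ +-comm _ _ ⟩
    (g ⊛ (f ∘ suc)) n + g (suc n) * f 0 ≈⟨ ⊛-suc g f n ⟨
    (g ⊛ f) (suc n)                     ∎
    where open Reasoning

  ⊛-distribʳ-at : ∀ h f g n → ((f ⊕ g) ⊛ h) n ≈ (f ⊛ h) n + (g ⊛ h) n
  ⊛-distribʳ-at h f g zero    = distribʳ _ _ _
  ⊛-distribʳ-at h f g (suc n) =
    trans (+-congˡ (⊛-distribʳ-at h (f ∘ suc) (g ∘ suc) n))
          (solve 5 (λ a b c x y → (a :+ b) :* c :+ (x :+ y) := (a :* c :+ x) :+ (b :* c :+ y)) refl
             (f 0) (g 0) (h (suc n)) _ _)

  •-⊛-at : ∀ a f g n → ((a • f) ⊛ g) n ≈ a * (f ⊛ g) n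
  •-⊛-at a f g zero    = *-assoc _ _ _
  •-⊛-at a f g (suc n) =
    trans (+-cong (*-assoc _ _ _) (•-⊛-at a (f ∘ suc) g n)) (sym (distribˡ _ _ _))

  ⊛-assoc-at : ∀ f g h n → ((f ⊛ g) ⊛ h) n ≈ (f ⊛ (g ⊛ h)) n
  ⊛-assoc-at f g h zero    = *-assoc _ _ _
  ⊛-assoc-at f g h (suc n) = begin
    f 0 * g 0 * h (suc n) + ((f 0 • (g ∘ suc) ⊕ (f ∘ suc) ⊛ g) ⊛ h) n
      ≈⟨ +-congˡ (⊛-distribʳ-at h (f 0 • (g ∘ suc)) ((f ∘ suc) ⊛ g) n) ⟩
    f 0 * g 0 * h (suc n) + (((f 0 • (g ∘ suc)) ⊛ h) n + (((f ∘ suc) ⊛ g) ⊛ h) n)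
      ≈⟨ +-congˡ (+-cong (•-⊛-at (f 0) (g ∘ suc) h n) (⊛-assoc-at (f ∘ suc) g h n)) ⟩
    f 0 * g 0 * h (suc n) + (f 0 * ((g ∘ suc) ⊛ h) n + ((f ∘ suc) ⊛ (g ⊛ h)) n)
      ≈⟨ solve 5 (λ a b c x y → a :* b :* c :+ (a :* x :+ y) := a :* (b :* c :+ x) :+ y) refl
           (f 0) (g 0) (h (suc n)) _ _ ⟩
    f 0 * (g ⊛ h) (suc n) + ((f ∘ suc) ⊛ (g ⊛ h)) n ∎
    where open Reasoning

  𝟎-⊛-at : ∀ f n → (𝟎 ⊛ f) n ≈ 0#
  𝟎-⊛-at f zero    = zeroˡ _
  𝟎-⊛-at f (suc n) = trans (+-cong (zeroˡ _) (𝟎-⊛-at f n)) (+-identityˡ _)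

  const-⊛-at : ∀ a f n → (const a ⊛ f) n ≈ a * f n
  const-⊛-at a f zero    = refl
  const-⊛-at a f (suc n) = trans (+-congˡ (𝟎-⊛-at f n)) (+-identityʳ _)

  shift-⊛-at : ∀ k f g n → (shift k f ⊛ g) n ≈ shift k (f ⊛ g) n
  shift-⊛-at zero    f g n       = refl
  shift-⊛-at (suc k) f g zero    = zeroˡ _
  shift-⊛-at (suc k) f g (suc n) =
    trans (+-cong (zeroˡ _) (shift-⊛-at k f g n)) (+-identityˡ _)

  isEquivalence′ : IsEquivalence _≋_
  isEquivalence′ = record
    { refl = mk λ _ → refl ; sym = λ p → mk λ n → sym (at p n)
    ; trans = λ p q → mk λ n → trans (at p n) (at q n) }

  isCommutativeRing′ : IsCommutativeRing _≋_ _⊕_ _⊛_ ⊖_ 𝟎 (const 1#)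
  isCommutativeRing′ = record
    { isRing = record
      { +-isAbelianGroup = record
        { isGroup = record
          { isMonoid = record
            { isSemigroup = record
              { isMagma = record
                { isEquivalence = isEquivalence′
                ; ∙-cong = λ p q → mk λ n → +-cong (at p n) (at q n) }
              ; assoc = λ f g h → mk λ n → +-assoc _ _ _ }
            ; identity = (λ f → mk λ n → +-identityˡ _) , (λ f → mk λ n → +-identityʳ _) }
          ; inverse = (λ f → mk λ n → -‿inverseˡ _) , (λ f → mk λ n → -‿inverseʳ _)
          ; ⁻¹-cong = λ p → mk λ n → -‿cong (at p n) }
        ; comm = λ f g → mk λ n → +-comm _ _ }
      ; *-cong = λ p q → mk (⊛-cong-at (at p) (at q))
      ; *-assoc = λ f g h → mk (⊛-assoc-at f g h)
      ; *-identity = (λ f → mk (identityˡ′ f))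
                   , (λ f → mk λ n → trans (⊛-comm-at f _ n) (identityˡ′ f n))
      ; distrib = (λ h f g → mk λ n → trans (⊛-comm-at h _ n) (trans (⊛-distribʳ-at h f g n)
                                  (+-cong (⊛-comm-at f h n) (⊛-comm-at g h n))))
                , (λ h f g → mk (⊛-distribʳ-at h f g)) }
    ; *-comm = λ f g → mk (⊛-comm-at f g) }
    where
    identityˡ′ : ∀ f n → (const 1# ⊛ f) n ≈ f n
    identityˡ′ f n = trans (const-⊛-at 1# f n) (*-identityˡ _)

  const-cong : ∀ {a c} → a ≈ c → const a ≋ const c
  const-cong p = mk λ { zero → p ; (suc _) → refl }

  const-𝟎 : const 0# ≋ 𝟎
  const-𝟎 = mk λ { zero → refl ; (suc _) → refl }

  const-+ : ∀ a c → const (a + c) ≋ const a ⊕ const c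
  const-+ a c = mk λ { zero → refl ; (suc _) → sym (+-identityˡ _) }

  const-* : ∀ a c → const (a * c) ≋ const a ⊛ const c
  const-* a c = mk λ { zero → refl ; (suc n) → sym (trans (const-⊛-at a (const c) (suc n)) (zeroʳ _)) }

  const-neg : ∀ a → const (- a) ≋ ⊖ const a
  const-neg a = mk λ { zero → refl ; (suc _) → sym -0#≈0# }

  seriesAlgebra : ℚ-Algebra
  seriesAlgebra = record
    { commutativeRing = record { isCommutativeRing = isCommutativeRing′ }
    ; ι = λ p → const (ι p)
    ; ι-+ = λ p q → E.trans (const-cong (ι-+ p q)) (const-+ _ _)
    ; ι-* = λ p q → E.trans (const-cong (ι-* p q)) (const-* _ _)
    ; ι-neg = λ p → E.trans (const-cong (ι-neg p)) (const-neg _)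
    ; ι-0 = E.trans (const-cong ι-0) const-𝟎
    ; ι-1 = const-cong ι-1 }
    where module E = IsEquivalence isEquivalence′

-- Derivations and the Euler operator.

record Derivation (Q : ℚ-Algebra) : Set where
  open ℚ-Algebra Q
  field
    D      : Carrier → Carrier
    D-cong : ∀ {x y} → x ≈ y → D x ≈ D y
    D-+    : ∀ x y → D (x + y) ≈ D x + D y
    D-*    : ∀ x y → D (x * y) ≈ D x * y + x * D y

  D-0 : D 0# ≈ 0#
  D-0 = x+x≈x⇒x≈0 _ (trans (sym (D-+ 0# 0#)) (D-cong (+-identityˡ 0#)))

  D-neg : ∀ x → D (- x) ≈ - D x
  D-neg x = +-inverseˡ-unique _ _ (trans (sym (D-+ (- x) x)) (trans (D-cong (-‿inverseˡ x)) D-0))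

  D-1 : D 1# ≈ 0#
  D-1 = x+x≈x⇒x≈0 _ (begin
    D 1# + D 1#           ≈⟨ +-cong (*-identityʳ _) (*-identityˡ _) ⟨
    D 1# * 1# + 1# * D 1# ≈⟨ D-* 1# 1# ⟨
    D (1# * 1#)           ≈⟨ D-cong (*-identityˡ 1#) ⟩
    D 1#                  ∎)
    where open Reasoning

module _ (Q : ℚ-Algebra) where
  open ℚ-Algebra Q

  ι-nat-suc : ∀ n → ι (nat (suc n)) ≈ ι 1ℚ + ι (nat n)
  ι-nat-suc n = trans (reflexive (≡.cong ι (nat-suc n))) (ι-+ 1ℚ (nat n))

  ι-nat-suc-cancel : ∀ n {x} → ι (nat (suc n)) * x ≈ 0# → x ≈ 0#
  ι-nat-suc-cancel n {x} e = begin
    x                                   ≈⟨ *-identityˡ x ⟨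
    1# * x                              ≈⟨ *-congʳ ι-1 ⟨
    ι 1ℚ * x                            ≈⟨ *-congʳ (reflexive (≡.cong ι (recip-inverse n))) ⟨
    ι (recip n ℚ.* nat (suc n)) * x     ≈⟨ *-congʳ (ι-* _ _) ⟩
    ι (recip n) * ι (nat (suc n)) * x   ≈⟨ *-assoc _ _ _ ⟩
    ι (recip n) * (ι (nat (suc n)) * x) ≈⟨ *-congˡ e ⟩
    ι (recip n) * 0#                    ≈⟨ zeroʳ _ ⟩
    0#                                  ∎
    where open Reasoning

module SeriesDerivations (K : ℚ-Algebra) where
  open ℚ-Algebra K
  open PowerSeries K
  open Solver using (solve; _:=_; _:+_; _:*_; con)

  -- The operator `t d/dt`, preferred to `d/dt` because it keeps degrees.
  θ : Series → Series
  θ f n = ι (nat n) * f n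

  θ-⊛-at : ∀ f g n → θ (f ⊛ g) n ≈ (θ f ⊛ g) n + (f ⊛ θ g) n
  θ-⊛-at f g zero    = solve 2 (λ x y → con 0ℚ :* (x :* y) := con 0ℚ :* x :* y :+ x :* (con 0ℚ :* y))
                         refl (f 0) (g 0)
  θ-⊛-at f g (suc n) = begin
    s * (f 0 * g (suc n) + h)
      ≈⟨ *-congʳ (ι-nat-suc K n) ⟩
    (ι 1ℚ + ι (nat n)) * (f 0 * g (suc n) + h)
      ≈⟨ solve 4 (λ m x y h → (con 1ℚ :+ m) :* (x :* y :+ h) :=
                   con 0ℚ :* x :* y :+ (m :* h :+ h) :+ x :* ((con 1ℚ :+ m) :* y)) refl
           (ι (nat n)) (f 0) (g (suc n)) h ⟩
    ι 0ℚ * f 0 * g (suc n) + (ι (nat n) * h + h) + f 0 * ((ι 1ℚ + ι (nat n)) * g (suc n))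
      ≈⟨ +-cong (+-congˡ (+-congʳ (θ-⊛-at f′ g n))) (*-congˡ (*-congʳ (sym (ι-nat-suc K n)))) ⟩
    ι 0ℚ * f 0 * g (suc n) + ((θ f′ ⊛ g) n + (f′ ⊛ θ g) n + h) + f 0 * (s * g (suc n))
      ≈⟨ solve 5 (λ a p q h e → a :+ (p :+ q :+ h) :+ e := a :+ (p :+ h) :+ (e :+ q)) refl
           (ι 0ℚ * f 0 * g (suc n)) ((θ f′ ⊛ g) n) ((f′ ⊛ θ g) n) h (f 0 * (s * g (suc n))) ⟩
    ι 0ℚ * f 0 * g (suc n) + ((θ f′ ⊛ g) n + h) + (f ⊛ θ g) (suc n)
      ≈⟨ +-congʳ (+-congˡ (⊛-distribʳ-at g (θ f′) f′ n)) ⟨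
    ι 0ℚ * f 0 * g (suc n) + ((θ f′ ⊕ f′) ⊛ g) n + (f ⊛ θ g) (suc n)
      ≈⟨ +-congʳ (+-congˡ (⊛-cong-at θ-suc (λ _ → refl) n)) ⟩
    (θ f ⊛ g) (suc n) + (f ⊛ θ g) (suc n) ∎
    where
    open Reasoning
    f′ = f ∘ suc
    s = ι (nat (suc n))
    h = (f′ ⊛ g) n
    θ-suc : ∀ k → (θ f′ ⊕ f′) k ≈ θ f (suc k)
    θ-suc k = trans (solve 2 (λ m x → m :* x :+ x := (con 1ℚ :+ m) :* x) refl (ι (nat k)) (f′ k))
                    (*-congʳ (sym (ι-nat-suc K k)))

  θ-X : θ X ≋ X
  θ-X = mk λ { zero → zeroʳ _ ; (suc zero) → trans (*-congʳ ι-1) (*-identityˡ _) ; (suc (suc n)) → zeroʳ _ }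

  θ-ι : ∀ p → θ (const (ι p)) ≋ 𝟎
  θ-ι p = mk λ { zero → trans (*-congʳ ι-0) (zeroˡ _) ; (suc n) → zeroʳ _ }

  euler : Derivation seriesAlgebra
  euler = record
    { D = θ
    ; D-cong = λ p → mk λ n → *-congˡ (at p n)
    ; D-+ = λ f g → mk λ n → distribˡ _ _ _
    ; D-* = λ f g → mk (θ-⊛-at f g) }

  coefficientwise : Derivation K → Derivation seriesAlgebra
  coefficientwise d = record
    { D = D ∘_
    ; D-cong = λ p → mk λ n → D-cong (at p n)
    ; D-+ = λ f g → mk λ n → D-+ _ _
    ; D-* = λ f g → mk (D-⊛ f g) }
    where
    open Derivation d
    D-⊛ : ∀ f g n → D ((f ⊛ g) n) ≈ ((D ∘ f) ⊛ g) n + (f ⊛ (D ∘ g)) n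
    D-⊛ f g zero    = D-* _ _
    D-⊛ f g (suc n) = trans (D-+ _ _) (trans (+-cong (D-* _ _) (D-⊛ (f ∘ suc) g n))
      (solve 4 (λ a b c d → (a :+ b) :+ (c :+ d) := (a :+ c) :+ (b :+ d)) refl _ _ _ _))

  shift-cong : ∀ k {f g} → f ≋ g → shift k f ≋ shift k g
  shift-cong k p = mk (go k)
    where
    go : ∀ k n → shift k _ n ≈ shift k _ n
    go zero    n       = at p n
    go (suc k) zero    = refl
    go (suc k) (suc n) = go k n

  X-⊛ : ∀ f → X ⊛ f ≋ shift 1 f
  X-⊛ f = mk λ { zero → zeroˡ _
               ; (suc n) → trans (+-cong (zeroˡ _) (trans (const-⊛-at 1# f n) (*-identityˡ _))) (+-identityˡ _) }

  shift-⊕-at : ∀ k f g n → shift k (f ⊕ g) n ≈ shift k f n + shift k g n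
  shift-⊕-at zero    f g n       = refl
  shift-⊕-at (suc k) f g zero    = sym (+-identityˡ _)
  shift-⊕-at (suc k) f g (suc n) = shift-⊕-at k f g n

  shift-⊖-at : ∀ k f n → shift k (⊖ f) n ≈ - shift k f n
  shift-⊖-at zero    f n       = refl
  shift-⊖-at (suc k) f zero    = sym -0#≈0#
  shift-⊖-at (suc k) f (suc n) = shift-⊖-at k f n

  shift-𝟎-at : ∀ k n → shift k 𝟎 n ≈ 0#
  shift-𝟎-at zero    n       = refl
  shift-𝟎-at (suc k) zero    = refl
  shift-𝟎-at (suc k) (suc n) = shift-𝟎-at k n

  -- A monomial lives in degree `k` alone, so a factor depending on the degree may be evaluated
  -- there.
  shift-const-scale : ∀ (u : ℕ → Carrier) k a n →
                      u n * shift k (const a) n ≈ shift k (const (u k * a)) n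
  shift-const-scale u zero    a zero    = refl
  shift-const-scale u zero    a (suc n) = zeroʳ _
  shift-const-scale u (suc k) a zero    = zeroʳ _
  shift-const-scale u (suc k) a (suc n) = shift-const-scale (u ∘ suc) k a n

  shift-scale-at : ∀ k a f n → shift k (a • f) n ≈ a * shift k f n
  shift-scale-at zero    a f n       = refl
  shift-scale-at (suc k) a f zero    = sym (zeroʳ _)
  shift-scale-at (suc k) a f (suc n) = shift-scale-at k a f n

  monomial-⊛-at : ∀ k a f n → (shift k (const a) ⊛ f) n ≈ a * shift k f n
  monomial-⊛-at k a f n = trans (shift-⊛-at k (const a) f n)
    (trans (at (shift-cong k (mk (const-⊛-at a f))) n) (shift-scale-at k a f n))

-- The functional equation F(-t) = F(t) + t.

module _ (Q : ℚ-Algebra) (∂ : Derivation Q) where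
  open ℚ-Algebra Q
  open Derivation ∂
  open Solver using (solve; _:=_; _:+_; _:*_; _:-_; :-_; con)

  -- Meant for `τ = t`, `e = (e^t - 1) / t` and `e⁻ = (1 - e^(-t)) / t`. Then `1 + τ e` is `e^t`,
  -- and the defect is `e - e⁻ e^t`. The equation `θ z = - z` has only the zero solution, since `θ`
  -- multiplies `t^n` by `n ≥ 0`.
  exp-defect-ode : ∀ {τ e e⁻} → D τ ≈ τ → D e ≈ ι 1ℚ + τ * e - e →
    D e⁻ ≈ ι 1ℚ - τ * e⁻ - e⁻ →
    D (e - (e⁻ + τ * e * e⁻)) ≈ - (e - (e⁻ + τ * e * e⁻))
  exp-defect-ode {τ} {e} {e⁻} Dτ De De⁻ = begin
    D (e - (e⁻ + τ * e * e⁻))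
      ≈⟨ trans (D-+ _ _) (+-cong De (trans (D-neg _) (-‿cong (trans (D-+ _ _) (+-cong De⁻
           (trans (D-* _ _) (+-cong (*-congʳ (trans (D-* _ _) (+-cong (*-congʳ Dτ) (*-congˡ De)))) (*-congˡ De⁻)))))))) ⟩
    ι 1ℚ + τ * e - e - (ι 1ℚ - τ * e⁻ - e⁻
      + ((τ * e + τ * (ι 1ℚ + τ * e - e)) * e⁻ + τ * e * (ι 1ℚ - τ * e⁻ - e⁻)))
      ≈⟨ solve 3 (λ τ e f → con 1ℚ :+ τ :* e :- e :- (con 1ℚ :- τ :* f :- f
           :+ ((τ :* e :+ τ :* (con 1ℚ :+ τ :* e :- e)) :* f :+ τ :* e :* (con 1ℚ :- τ :* f :- f)))
           := :- (e :- (f :+ τ :* e :* f))) refl τ e e⁻ ⟩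
    - (e - (e⁻ + τ * e * e⁻)) ∎
    where open Reasoning

  -- Multiplying the last hypothesis by `β β⁻` cancels `e` and `e⁻` and leaves the claim; here `β`
  -- and `β⁻` stand for `F(t)` and `F(-t)`.
  inverse-reflect : ∀ {τ e e⁻ β β⁻} → β * e ≈ ι 1ℚ → β⁻ * e⁻ ≈ ι 1ℚ →
    e ≈ e⁻ + τ * e * e⁻ → β⁻ ≈ β + τ
  inverse-reflect {τ} {e} {e⁻} {β} {β⁻} βe βe⁻ e≈ = begin
    β⁻
      ≈⟨ solve 1 (λ x → x := x :* con 1ℚ) refl β⁻ ⟩
    β⁻ * ι 1ℚ
      ≈⟨ *-congˡ (trans (*-congˡ (sym e≈)) βe) ⟨
    β⁻ * (β * (e⁻ + τ * e * e⁻))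
      ≈⟨ solve 5 (λ τ e f β γ → γ :* (β :* (f :+ τ :* e :* f)) := γ :* f :* (β :+ τ :* (β :* e))) refl τ e e⁻ β β⁻ ⟩
    β⁻ * e⁻ * (β + τ * (β * e))
      ≈⟨ *-cong βe⁻ (+-congˡ (*-congˡ βe)) ⟩
    ι 1ℚ * (β + τ * ι 1ℚ)
      ≈⟨ solve 2 (λ β τ → con 1ℚ :* (β :+ τ :* con 1ℚ) := β :+ τ) refl β τ ⟩
    β + τ ∎
    where open Reasoning

module Reflection (K : ℚ-Algebra) where
  open ℚ-Algebra K
  open PowerSeries K
  open SeriesDerivations K
  private
    module R = ℚ-Algebra seriesAlgebra
  open Solver using (solve; _:=_; _:+_; _:*_; _:-_; :-_; con)

  reflect : Series → Series
  reflect f n = ι (sgn n) * f n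

  reflect-cong : ∀ {f g} → f ≋ g → reflect f ≋ reflect g
  reflect-cong p = mk λ n → *-congˡ (at p n)

  reflect-⊛ : ∀ f g → reflect (f ⊛ g) ≋ reflect f ⊛ reflect g
  reflect-⊛ f g = mk (go f)
    where
    open Reasoning
    go : ∀ f n → ι (sgn n) * (f ⊛ g) n ≈ (reflect f ⊛ reflect g) n
    go f zero    = solve 2 (λ x y → con 1ℚ :* (x :* y) := con 1ℚ :* x :* (con 1ℚ :* y)) refl (f 0) (g 0)
    go f (suc n) = begin
      s * (f 0 * g (suc n) + h)
        ≈⟨ solve 4 (λ s x y h → s :* (x :* y :+ h) := con 1ℚ :* x :* (s :* y) :+ s :* h) refl s (f 0) (g (suc n)) h ⟩
      ι 1ℚ * f 0 * (s * g (suc n)) + s * h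
        ≈⟨ +-congˡ (begin
             s * h                                                  ≈⟨ *-congʳ (neg n) ⟩
             - ι 1ℚ * ι (sgn n) * h                                 ≈⟨ *-assoc _ _ _ ⟩
             - ι 1ℚ * (ι (sgn n) * h)                               ≈⟨ *-congˡ (go (f ∘ suc) n) ⟩
             - ι 1ℚ * (reflect (f ∘ suc) ⊛ reflect g) n             ≈⟨ •-⊛-at (- ι 1ℚ) (reflect (f ∘ suc)) (reflect g) n ⟨
             ((- ι 1ℚ • reflect (f ∘ suc)) ⊛ reflect g) n           ≈⟨ ⊛-cong-at (λ k → trans (sym (*-assoc _ _ _)) (*-congʳ (sym (neg k)))) (λ _ → refl) n ⟩
             ((reflect f ∘ suc) ⊛ reflect g) n                      ∎) ⟩
      (reflect f ⊛ reflect g) (suc n) ∎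
      where
      s = ι (sgn (suc n))
      h = ((f ∘ suc) ⊛ g) n
      neg : ∀ k → ι (sgn (suc k)) ≈ - ι 1ℚ * ι (sgn k)
      neg k = trans (ι-neg (sgn k)) (solve 1 (λ x → :- x := (:- con 1ℚ) :* x) refl (ι (sgn k)))

  θ-reflect : ∀ f → θ (reflect f) ≋ reflect (θ f)
  θ-reflect f = mk λ n → solve 3 (λ x y z → x :* (y :* z) := y :* (x :* z)) refl (ι (nat n)) (ι (sgn n)) (f n)

  reflect-X : reflect X ≋ ⊖ X
  reflect-X = mk λ { zero → trans (zeroʳ _) (sym -0#≈0#)
                   ; (suc zero) → trans (*-congʳ (trans (ι-neg 1ℚ) (-‿cong ι-1))) (trans (sym (-‿distribˡ-* _ _)) (-‿cong (*-identityˡ _)))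
                   ; (suc (suc n)) → trans (zeroʳ _) (sym -0#≈0#) }

  reflect-ι1 : reflect (R.ι 1ℚ) ≋ R.ι 1ℚ
  reflect-ι1 = mk λ { zero → solve 0 (con 1ℚ :* con 1ℚ := con 1ℚ) refl ; (suc n) → zeroʳ _ }

  -- F(-t) = F(t) + t for F = t / (e^t - 1).
  reflect-inverse : ∀ {b e} → b ⊛ e ≋ R.ι 1ℚ → θ e ≋ R.ι 1ℚ ⊕ X ⊛ e ⊕ ⊖ e → reflect b ≋ b ⊕ X
  reflect-inverse {b} {e} b-e θ-e = inverse-reflect seriesAlgebra euler b-e
      (R.trans (R.sym (reflect-⊛ b e)) (R.trans (reflect-cong b-e) reflect-ι1))
      (R.x∙y⁻¹≈ε⇒x≈y _ _ (mk z≈0))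
    where
    e⁻ = reflect e
    z = e ⊕ ⊖ (e⁻ ⊕ X ⊛ e ⊛ e⁻)
    reflect-⊕ : ∀ f g → reflect (f ⊕ g) ≋ reflect f ⊕ reflect g
    reflect-⊕ f g = mk λ n → distribˡ _ _ _
    reflect-⊖ : ∀ f → reflect (⊖ f) ≋ ⊖ reflect f
    reflect-⊖ f = mk λ n → sym (-‿distribʳ-* _ _)
    θ-e⁻ : θ e⁻ ≋ R.ι 1ℚ ⊕ ⊖ (X ⊛ e⁻) ⊕ ⊖ e⁻
    θ-e⁻ = R.trans (θ-reflect e) (R.trans (reflect-cong θ-e) (R.trans (reflect-⊕ _ _) (R.+-cong
      (R.trans (reflect-⊕ _ _) (R.+-cong reflect-ι1
        (R.trans (reflect-⊛ X e) (R.trans (R.*-congʳ {e⁻} reflect-X) (R.sym (R.-‿distribˡ-* X e⁻))))))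
      (reflect-⊖ e))))
    z≈0 : ∀ n → z n ≈ 0#
    z≈0 n = ι-nat-suc-cancel K n (trans (*-congʳ (ι-nat-suc K n))
      (trans (solve 2 (λ m z → (con 1ℚ :+ m) :* z := m :* z :+ z) refl (ι (nat n)) (z n))
        (trans (+-congʳ (at (exp-defect-ode seriesAlgebra euler θ-X θ-e θ-e⁻) n)) (-‿inverseˡ (z n)))))

-- Differential equations for F and for the addition formula.

module _ (Q : ℚ-Algebra) where
  open ℚ-Algebra Q
  open Solver using (solve; _:=_; _:+_; _:*_; _:-_; :-_; con)

  -- To be used with `d₁ = ε d/dε`, `d₂ = t d/dt` and `e = ε`. This combination kills `t (1 + ε)`,
  -- hence formally every function of `t + tε`, and sends `t` to `- ε t`; so it acts on
  -- `t G(t + tε)` as multiplication by `- ε`.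
  twist : Derivation Q → Derivation Q → Carrier → Derivation Q
  twist d₁ d₂ e = record
    { D = λ x → d₁.D x + e * (d₁.D x - d₂.D x)
    ; D-cong = λ p → +-cong (d₁.D-cong p) (*-congˡ (+-cong (d₁.D-cong p) (-‿cong (d₂.D-cong p))))
    ; D-+ = λ x y → trans
        (+-cong (d₁.D-+ x y) (*-congˡ (+-cong (d₁.D-+ x y) (-‿cong (d₂.D-+ x y)))))
        (solve 5 (λ e a b c d → (a :+ b) :+ e :* ((a :+ b) :- (c :+ d)) :=
                    (a :+ e :* (a :- c)) :+ (b :+ e :* (b :- d))) refl
           e (d₁.D x) (d₁.D y) (d₂.D x) (d₂.D y))
    ; D-* = λ x y → trans
        (+-cong (d₁.D-* x y) (*-congˡ (+-cong (d₁.D-* x y) (-‿cong (d₂.D-* x y)))))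
        (solve 7 (λ e x y a b c d →
            (a :* y :+ x :* b) :+ e :* ((a :* y :+ x :* b) :- (c :* y :+ x :* d)) :=
            (a :+ e :* (a :- c)) :* y :+ x :* (b :+ e :* (b :- d))) refl
           e x y (d₁.D x) (d₁.D y) (d₂.D x) (d₂.D y))
    }
    where
    module d₁ = Derivation d₁
    module d₂ = Derivation d₂

  module _ (∂ : Derivation Q) where
    open Derivation ∂

    -- The Riccati equation of `F`: differentiate `β e = 1`, insert the equation for `e`, and
    -- eliminate `e` by multiplying with `β`.
    inverse-ode : ∀ {τ β e} → β * e ≈ ι 1ℚ → D e ≈ ι 1ℚ + τ * e - e →
                  D β ≈ β - β * β - τ * β
    inverse-ode {τ} {β} {e} βe De = combine₂ β (τ * β - β + D β) (solve 5
        (λ δ τ β e δe → δ :- (β :- β :* β :- τ :* β) :=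
           β :* ((δ :* e :+ β :* (con 1ℚ :+ τ :* e :- e)) :- con 0ℚ)
           :+ (τ :* β :- β :+ δ) :* (con 1ℚ :- β :* e)) refl (D β) τ β e (D e))
        (begin
          D β * e + β * (ι 1ℚ + τ * e - e) ≈⟨ +-congˡ (*-congˡ De) ⟨
          D β * e + β * D e                ≈⟨ D-* β e ⟨
          D (β * e)                        ≈⟨ D-cong (trans βe ι-1) ⟩
          D 1#                             ≈⟨ D-1 ⟩
          0#                               ≈⟨ ι-0 ⟨
          ι 0ℚ                             ∎)
        (sym βe)
      where open Reasoning

    -- For a = Σ A_r ε^r, β = F(t), τ = t and e = (e^(tε) - 1) / (tε), the addition formula for G
    -- says that the defect is zero; being homogeneous linear, its ODE forces this.
    defect : (ε τ β e a : Carrier) → Carrier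
    defect ε τ β e a = a - β + ε * (τ + β) * (e * a)

    -- Once the Riccati equation replaces `β′`, all derivatives are polynomials in the five
    -- quantities and the defect factors out. The factor `ε` on the right makes each `ε`-coefficient
    -- depend on earlier ones only.
    defect-ode : ∀ {ε τ β β′ e a} →
      D ε ≈ ε + ε * ε → D τ ≈ - (ε * τ) → D β ≈ - (ε * β′) → β′ ≈ β - β * β - τ * β →
      D e ≈ ι 1ℚ + ε * τ * e - e → D a ≈ - (ε * a) →
      D (defect ε τ β e a) ≈ ε * (τ + β - ι 1ℚ) * defect ε τ β e a
    defect-ode {ε} {τ} {β} {β′} {e} {a} Dε Dτ Dβ β′≈ De Da = begin
      D (a - β + ε * (τ + β) * (e * a))
        ≈⟨ D-+ _ _ ⟩
      D (a - β) + D (ε * (τ + β) * (e * a))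
        ≈⟨ +-cong (trans (D-+ _ _) (+-cong Da (trans (D-neg β) (-‿cong Dβ′))))
             (trans (D-* _ _) (+-cong
               (*-congʳ (trans (D-* _ _) (+-cong (*-congʳ Dε) (*-congˡ (trans (D-+ _ _) (+-cong Dτ Dβ′))))))
               (*-congˡ (trans (D-* _ _) (+-cong (*-congʳ De) (*-congˡ Da)))))) ⟩
      - (ε * a) - - (ε * (β - β * β - τ * β))
        + (((ε + ε * ε) * (τ + β) + ε * (- (ε * τ) + - (ε * (β - β * β - τ * β)))) * (e * a)
           + ε * (τ + β) * ((ι 1ℚ + ε * τ * e - e) * a + e * - (ε * a)))
        ≈⟨ solve 5 (λ ε τ β e a →
             :- (ε :* a) :- :- (ε :* (β :- β :* β :- τ :* β))
               :+ (((ε :+ ε :* ε) :* (τ :+ β) :+ ε :* (:- (ε :* τ) :+ :- (ε :* (β :- β :* β :- τ :* β)))) :* (e :* a)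
                  :+ ε :* (τ :+ β) :* ((con 1ℚ :+ ε :* τ :* e :- e) :* a :+ e :* :- (ε :* a)))
             := ε :* (τ :+ β :- con 1ℚ) :* (a :- β :+ ε :* (τ :+ β) :* (e :* a))) refl ε τ β e a ⟩
      ε * (τ + β - ι 1ℚ) * defect ε τ β e a ∎
      where
      open Reasoning
      Dβ′ : D β ≈ - (ε * (β - β * β - τ * β))
      Dβ′ = trans Dβ (-‿cong (*-congˡ β′≈))

-- Algebra of the addition formula and of the product recursion.

module _ (Q : ℚ-Algebra) where
  open ℚ-Algebra Q
  open Solver using (solve; _:=_; _:+_; _:*_; _:-_; :-_; con)

  -- Here `b̂` is `F(tε)`, the inverse of `e`; multiplying by it moves `e` out of the product and
  -- restores the shape with `G(ε)` as a factor.
  defect-zero : ∀ {ε τ β e a} b̂ → b̂ * e ≈ ι 1ℚ → a - β + ε * (τ + β) * (e * a) ≈ 0# →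
                b̂ * a ≈ b̂ * β - ε * (τ + β) * a
  defect-zero {ε} {τ} {β} {e} {a} b̂ b̂e d≈0 = combine₂ b̂ (ε * (τ + β) * a)
    (solve 6 (λ ε τ β e a b → b :* a :- (b :* β :- ε :* (τ :+ β) :* a) :=
        b :* ((a :- β :+ ε :* (τ :+ β) :* (e :* a)) :- con 0ℚ)
        :+ ε :* (τ :+ β) :* a :* (con 1ℚ :- b :* e)) refl ε τ β e a b̂)
    (trans d≈0 (sym ι-0)) (sym b̂e)

  -- The formula solved for the product with `β`, after multiplication by `c`. The factor `ε` stays,
  -- and is removed later by comparing coefficients one degree higher.
  multiply-defect : ∀ {ε τ β b̂ a} c → b̂ * a ≈ b̂ * β - ε * (τ + β) * a →
    ε * (β * (c * a)) ≈ c * b̂ * β - c * b̂ * a - ε * (τ * (c * a))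
  multiply-defect {ε} {τ} {β} {b̂} {a} c p = combine₁ (- c)
    (solve 6 (λ ε τ β b a c → ε :* (β :* (c :* a)) :- (c :* b :* β :- c :* b :* a :- ε :* (τ :* (c :* a)))
        := (:- c) :* ((b :* β :- ε :* (τ :+ β) :* a) :- b :* a)) refl ε τ β b̂ a c) (sym p)

  -- Meant for u = u(r,s), u′ = u(r+1,s), u″ = u(r,s+1), with ρ = r and σ = s.
  module Contiguity (∂ : Derivation Q) (ρ σ : Carrier) where
    open Derivation ∂

    -- The relation obeyed by `A_r A_s`: Leibniz rule and `θ A_r = (r + 1) (A_(r+1) + A_r)`.
    Contiguous : (u u′ u″ : Carrier) → Set
    Contiguous u u′ u″ = D u ≈ (ρ + σ + ι (nat 2)) * u + (ρ + ι 1ℚ) * u′ + (σ + ι 1ℚ) * u″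

    contiguous-+ : ∀ {u u′ u″ v v′ v″} → Contiguous u u′ u″ → Contiguous v v′ v″ →
                   Contiguous (u + v) (u′ + v′) (u″ + v″)
    contiguous-+ {u} {u′} {u″} {v} {v′} {v″} p q = trans (D-+ u v) (trans (+-cong p q)
      (solve 9 (λ k l m u u′ u″ v v′ v″ →
         (k :* u :+ l :* u′ :+ m :* u″) :+ (k :* v :+ l :* v′ :+ m :* v″) :=
         k :* (u :+ v) :+ l :* (u′ :+ v′) :+ m :* (u″ :+ v″)) refl _ _ _ u u′ u″ v v′ v″))

    contiguous-neg : ∀ {u u′ u″} → Contiguous u u′ u″ → Contiguous (- u) (- u′) (- u″)
    contiguous-neg {u} {u′} {u″} p = trans (D-neg u) (trans (-‿cong p)
      (solve 6 (λ k l m u u′ u″ →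
         :- (k :* u :+ l :* u′ :+ m :* u″) := k :* (:- u) :+ l :* (:- u′) :+ m :* (:- u″))
         refl _ _ _ u u′ u″))

    -- The induction step for a family of zeros: vanishing at `(r, s)` and `(r + 1, s)` passes to
    -- `(r, s + 1)`, up to the factor `s + 1`.
    contiguous-zero : ∀ {u u′ u″} → Contiguous u u′ u″ → u ≈ 0# → u′ ≈ 0# →
                      (σ + ι 1ℚ) * u″ ≈ 0#
    contiguous-zero {u} {u′} {u″} p u≈0 u′≈0 = begin
      (σ + ι 1ℚ) * u″                       ≈⟨ +-identityˡ _ ⟨
      0# + (σ + ι 1ℚ) * u″                  ≈⟨ +-congʳ (+-identityˡ 0#) ⟨
      0# + 0# + (σ + ι 1ℚ) * u″             ≈⟨ +-congʳ (+-cong (trans (*-congˡ u≈0) (zeroʳ _)) (trans (*-congˡ u′≈0) (zeroʳ _))) ⟨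
      (ρ + σ + ι (nat 2)) * u + (ρ + ι 1ℚ) * u′ + (σ + ι 1ℚ) * u″ ≈⟨ p ⟨
      D u                                   ≈⟨ trans (D-cong u≈0) D-0 ⟩
      0#                                    ∎
      where open Reasoning

    contiguous-product : ∀ {a a⁺ c c⁺} →
      D a ≈ (ρ + ι 1ℚ) * (a⁺ + a) → D c ≈ (σ + ι 1ℚ) * (c⁺ + c) →
      Contiguous (a * c) (a⁺ * c) (a * c⁺)
    contiguous-product {a} {a⁺} {c} {c⁺} Da Dc = trans (D-* a c)
      (trans (+-cong (*-congʳ Da) (*-congˡ Dc))
        (solve 6 (λ ρ σ a a⁺ c c⁺ →
           (ρ :+ con 1ℚ) :* (a⁺ :+ a) :* c :+ a :* ((σ :+ con 1ℚ) :* (c⁺ :+ c)) :=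
           (ρ :+ σ :+ con (nat 2)) :* (a :* c) :+ (ρ :+ con 1ℚ) :* (a⁺ :* c) :+ (σ :+ con 1ℚ) :* (a :* c⁺))
           refl ρ σ a a⁺ c c⁺))

    contiguous-diagonal : ∀ {a a⁺} → D a ≈ (ρ + σ + ι (nat 2)) * (a⁺ + a) → Contiguous a a⁺ a⁺
    contiguous-diagonal {a} {a⁺} Da = trans Da
      (solve 4 (λ ρ σ a a⁺ → (ρ :+ σ :+ con (nat 2)) :* (a⁺ :+ a) :=
           (ρ :+ σ :+ con (nat 2)) :* a :+ (ρ :+ con 1ℚ) :* a⁺ :+ (σ :+ con 1ℚ) :* a⁺)
           refl ρ σ a a⁺)

    -- For the family `δ_(r,0) t A_s`. Its value at `r + 1` is zero, and `ρ δ = 0` removes `r` from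
    -- the coefficient of `u`.
    contiguous-leftδ : ∀ {δ x c c⁺} → D δ ≈ 0# → ρ * δ ≈ 0# → D x ≈ x →
      D c ≈ (σ + ι 1ℚ) * (c⁺ + c) → Contiguous (δ * (x * c)) (ι 0ℚ * (x * c)) (δ * (x * c⁺))
    contiguous-leftδ {δ} {x} {c} {c⁺} Dδ ρδ Dx Dc = begin
      D (δ * (x * c))
        ≈⟨ trans (D-* _ _) (+-cong (*-congʳ Dδ) (*-congˡ (trans (D-* x c) (+-cong (*-congʳ Dx) (*-congˡ Dc))))) ⟩
      0# * (x * c) + δ * (x * c + x * ((σ + ι 1ℚ) * (c⁺ + c)))
        ≈⟨ trans (+-congʳ (zeroˡ _)) (+-identityˡ _) ⟩
      δ * (x * c + x * ((σ + ι 1ℚ) * (c⁺ + c)))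
        ≈⟨ combine₁ (x * c) (solve 6 (λ ρ σ δ x c c⁺ →
             δ :* (x :* c :+ x :* ((σ :+ con 1ℚ) :* (c⁺ :+ c)))
             :- ((ρ :+ σ :+ con (nat 2)) :* (δ :* (x :* c)) :+ (ρ :+ con 1ℚ) :* (con 0ℚ :* (x :* c))
                 :+ (σ :+ con 1ℚ) :* (δ :* (x :* c⁺)))
             := x :* c :* (con 0ℚ :- ρ :* δ)) refl ρ σ δ x c c⁺) (trans ι-0 (sym ρδ)) ⟩
      (ρ + σ + ι (nat 2)) * (δ * (x * c)) + (ρ + ι 1ℚ) * (ι 0ℚ * (x * c)) + (σ + ι 1ℚ) * (δ * (x * c⁺)) ∎
      where open Reasoning

    -- For the family `(-1)^r S (A_r) m` with `m = r + s + 1`: `f⁺` and `g⁺` are `S (A_r)` and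
    -- `S (A_(r+1))` at `m + 1`. Subtraction reduces the coefficient of `f⁺` to `s + 1`, and the
    -- alternating sign corrects that of `g⁺`.
    contiguous-left : ∀ {p p⁻ f f⁺ g⁺} → p⁻ ≈ - p → D p ≈ 0# →
      D f ≈ (ρ + σ + ι (nat 2)) * (f⁺ + f) - (ρ + ι 1ℚ) * (g⁺ + f⁺) →
      Contiguous (p * f) (p⁻ * g⁺) (p * f⁺)
    contiguous-left {p} {p⁻} {f} {f⁺} {g⁺} p⁻≈ Dp Df = begin
      D (p * f)
        ≈⟨ trans (D-* _ _) (+-cong (*-congʳ Dp) (*-congˡ Df)) ⟩
      0# * f + p * ((ρ + σ + ι (nat 2)) * (f⁺ + f) - (ρ + ι 1ℚ) * (g⁺ + f⁺))
        ≈⟨ trans (+-congʳ (zeroˡ _)) (+-identityˡ _) ⟩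
      p * ((ρ + σ + ι (nat 2)) * (f⁺ + f) - (ρ + ι 1ℚ) * (g⁺ + f⁺))
        ≈⟨ solve 6 (λ ρ σ p f f⁺ g⁺ →
             p :* ((ρ :+ σ :+ con (nat 2)) :* (f⁺ :+ f) :- (ρ :+ con 1ℚ) :* (g⁺ :+ f⁺)) :=
             (ρ :+ σ :+ con (nat 2)) :* (p :* f) :+ (ρ :+ con 1ℚ) :* ((:- p) :* g⁺) :+ (σ :+ con 1ℚ) :* (p :* f⁺))
             refl ρ σ p f f⁺ g⁺ ⟩
      (ρ + σ + ι (nat 2)) * (p * f) + (ρ + ι 1ℚ) * (- p * g⁺) + (σ + ι 1ℚ) * (p * f⁺)
        ≈⟨ +-congʳ (+-congˡ (*-congˡ (*-congʳ p⁻≈))) ⟨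
      (ρ + σ + ι (nat 2)) * (p * f) + (ρ + ι 1ℚ) * (p⁻ * g⁺) + (σ + ι 1ℚ) * (p * f⁺) ∎
      where open Reasoning

  contiguous-swap : ∀ ∂ {ρ σ u u′ u″} → Contiguity.Contiguous ∂ σ ρ u u″ u′ →
                    Contiguity.Contiguous ∂ ρ σ u u′ u″
  contiguous-swap ∂ {ρ} {σ} {u} {u′} {u″} p = trans p
    (solve 5 (λ ρ σ u u′ u″ →
        (σ :+ ρ :+ con (nat 2)) :* u :+ (σ :+ con 1ℚ) :* u″ :+ (ρ :+ con 1ℚ) :* u′ :=
        (ρ :+ σ :+ con (nat 2)) :* u :+ (ρ :+ con 1ℚ) :* u′ :+ (σ :+ con 1ℚ) :* u″)
       refl ρ σ u u′ u″)

module _ (Q : ℚ-Algebra) where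
  open ℚ-Algebra Q
  open Solver using (solve; _:=_; _:+_; _:*_; _:-_; :-_; con)

  -- To be read with `p`, `q` and `1` the constant terms of `A_r`, `A_s` and `A_0`, that is, the
  -- polar parts of the corresponding `G`.
  expand-product : ∀ a c β p q →
    (a - p) * ((c - q) * (β - ι 1ℚ)) ≈
    a * (c * β) - a * c - p * (c * β) - q * (a * β) + p * c + q * a + p * (q * β) - p * q
  expand-product = solve 5 (λ a c β p q →
      (a :- p) :* ((c :- q) :* (β :- con 1ℚ)) :=
      a :* (c :* β) :- a :* c :- p :* (c :* β) :- q :* (a :* β) :+ p :* c :+ q :* a :+ p :* (q :* β) :- p :* q) refl

  isolate-product : ∀ {a c d d′ x e s s′ u v} →
    a * c + (d * (x * c) + d′ * (x * a)) + - e + (s * u + s′ * v) ≈ 0# →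
    a * c ≈ e - (d * (x * c) + d′ * (x * a)) - (s * u + s′ * v)
  isolate-product {a} {c} {d} {d′} {x} {e} {s} {s′} {u} {v} p = combine₁ (ι 1ℚ)
    (solve 4 (λ y z e w → y :- (e :- z :- w) := con 1ℚ :* ((y :+ z :+ :- e :+ w) :- con 0ℚ)) refl
      (a * c) (d * (x * c) + d′ * (x * a)) e (s * u + s′ * v))
    (trans p (sym ι-0))

  -- Since `a c` is already linear, only products of `β` with single terms are needed. In each of
  -- them `y°` is the new linear part, with `β y = - (y° + x y)`.
  triple-product : ∀ {a c d d′ x e s s′ u v β a° c° e° u° v°} →
    a * c ≈ e - (d * (x * c) + d′ * (x * a)) - (s * u + s′ * v) →
    β * a ≈ - (a° + x * a) → β * c ≈ - (c° + x * c) → β * e ≈ - (e° + x * e) →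
    β * u ≈ - (u° + x * u) → β * v ≈ - (v° + x * v) →
    a * (c * β) ≈ d * (x * (c° + x * c)) + d′ * (x * (a° + x * a)) - (e° + x * e)
                    + (s * (u° + x * u) + s′ * (v° + x * v))
  triple-product {a} {c} {d} {d′} {x} {e} {s} {s′} {u} {v} {β} ac βa βc βe βu βv = begin
    a * (c * β)
      ≈⟨ solve 3 (λ a c β → a :* (c :* β) := β :* (a :* c)) refl a c β ⟩
    β * (a * c)
      ≈⟨ *-congˡ ac ⟩
    β * (e - (d * (x * c) + d′ * (x * a)) - (s * u + s′ * v))
      ≈⟨ solve 10 (λ β a c d d′ e s s′ u v → β :* (e :- (d :* c :+ d′ :* a) :- (s :* u :+ s′ :* v)) :=
           β :* e :- (d :* (β :* c) :+ d′ :* (β :* a)) :- (s :* (β :* u) :+ s′ :* (β :* v))) refl β (x * a) (x * c) d d′ e s s′ u v ⟩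
    β * e - (d * (β * (x * c)) + d′ * (β * (x * a))) - (s * (β * u) + s′ * (β * v))
      ≈⟨ +-cong (+-cong βe (-‿cong (+-cong (*-congˡ (through βc)) (*-congˡ (through βa)))))
           (-‿cong (+-cong (*-congˡ βu) (*-congˡ βv))) ⟩
    _ ≈⟨ solve 9 (λ d d′ s s′ a c e u v →
           :- e :- (d :* (:- c) :+ d′ :* (:- a)) :- (s :* (:- u) :+ s′ :* (:- v)) :=
           d :* c :+ d′ :* a :- e :+ (s :* u :+ s′ :* v)) refl d d′ s s′ _ _ _ _ _ ⟩
    _ ∎
    where
    open Reasoning
    through : ∀ {y y°} → β * y ≈ - y° → β * (x * y) ≈ - (x * y°)
    through {y} {y°} p = trans (solve 3 (λ β x y → β :* (x :* y) := x :* (β :* y)) refl β x y)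
      (trans (*-congˡ p) (sym (-‿distribʳ-* x y°)))

-- Power series in ε with coefficients in power series in t.

module DoubleSeries (K : ℚ-Algebra) where
  open ℚ-Algebra K
  open PowerSeries K
  open SeriesDerivations K
  module R = ℚ-Algebra seriesAlgebra
  module P₂ = PowerSeries seriesAlgebra
  module SD₂ = SeriesDerivations seriesAlgebra
  open P₂ using ()
    renaming ( Series to Series₂; _≋_ to _≋₂_; mk to mk₂; at to at₂
             ; _⊛_ to _⊛₂_; _⊕_ to _⊕₂_; ⊖_ to ⊖₂_; const to κ; X to ε ) public
  module R₂ = ℚ-Algebra P₂.seriesAlgebra

  -- c(t) ↦ c(tε)
  hat : Series → Series₂
  hat c k = shift k (const (c k))

  hat-cong : ∀ {c d} → c ≋ d → hat c ≋₂ hat d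
  hat-cong p = mk₂ λ k → shift-cong k (const-cong (at p k))

  hat-⊕ : ∀ c d → hat (c ⊕ d) ≋₂ hat c ⊕₂ hat d
  hat-⊕ c d = mk₂ λ k → R.trans (shift-cong k (const-+ (c k) (d k))) (mk (shift-⊕-at k _ _))

  hat-⊖ : ∀ c → hat (⊖ c) ≋₂ ⊖₂ hat c
  hat-⊖ c = mk₂ λ k → R.trans (shift-cong k (const-neg (c k))) (mk (shift-⊖-at k _))

  hat-suc : ∀ c k → hat c (suc k) ≋ X ⊛ hat (c ∘ suc) k
  hat-suc c k = R.trans (mk λ { zero → refl ; (suc n) → refl }) (R.sym (X-⊛ (hat (c ∘ suc) k)))

  hat-⊛ : ∀ c d → hat (c ⊛ d) ≋₂ hat c ⊛₂ hat d
  hat-⊛ c d = mk₂ (go c)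
    where
    open R.Reasoning
    go : ∀ c n → hat (c ⊛ d) n ≋ (hat c ⊛₂ hat d) n
    go c zero    = const-* (c 0) (d 0)
    go c (suc n) = begin
      shift (suc n) (const (c 0 * d (suc n) + ((c ∘ suc) ⊛ d) n))
        ≈⟨ shift-cong (suc n) (const-+ _ _) ⟩
      shift (suc n) (const (c 0 * d (suc n)) ⊕ const (((c ∘ suc) ⊛ d) n))
        ≈⟨ mk (shift-⊕-at (suc n) _ _) ⟩
      shift (suc n) (const (c 0 * d (suc n))) ⊕ shift (suc n) (const (((c ∘ suc) ⊛ d) n))
        ≈⟨ R.+-cong (mk (λ m → trans (sym (shift-const-scale (λ _ → c 0) (suc n) (d (suc n)) m))
                                     (sym (const-⊛-at (c 0) _ m))))
                    (R.trans (hat-suc (λ k → tail k) n) (R.*-congˡ (go (c ∘ suc) n))) ⟩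
      const (c 0) ⊛ hat d (suc n) ⊕ X ⊛ (hat (c ∘ suc) ⊛₂ hat d) n
        ≈⟨ R.+-congˡ (P₂.•-⊛-at X (hat (c ∘ suc)) (hat d) n) ⟨
      const (c 0) ⊛ hat d (suc n) ⊕ ((X P₂.• hat (c ∘ suc)) ⊛₂ hat d) n
        ≈⟨ R.+-congˡ (P₂.⊛-cong-at (λ k → hat-suc c k) (λ _ → R.refl) n) ⟨
      (hat c ⊛₂ hat d) (suc n) ∎
      where
      tail : Series
      tail zero    = 0#
      tail (suc k) = ((c ∘ suc) ⊛ d) k

  hat-const : ∀ a → hat (const a) ≋₂ κ (const a)
  hat-const a = mk₂ λ { zero → R.refl
                      ; (suc k) → R.trans (shift-cong (suc k) const-𝟎) (mk (shift-𝟎-at (suc k))) }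

  hat-X : hat X ≋₂ ε ⊛₂ κ X
  hat-X = R₂.trans (mk₂ λ { zero → const-𝟎 ; (suc zero) → R.refl
                          ; (suc (suc k)) → R.trans (shift-cong (2 ℕ.+ k) const-𝟎) (mk (shift-𝟎-at (2 ℕ.+ k))) })
                   (R₂.sym (SD₂.X-⊛ (κ X)))

  private
    module η = Derivation SD₂.euler
    module Θ = Derivation (SD₂.coefficientwise euler)
    module ϑ = Derivation euler

  -- Chosen so that the recursion θ A_r = (r + 1)(A_{r+1} + A_r) reads ∂ A = - ε A.
  ∂ : Derivation P₂.seriesAlgebra
  ∂ = twist P₂.seriesAlgebra SD₂.euler (SD₂.coefficientwise euler) ε

  open Derivation ∂ public

  -- On a series in `tε` the operators `ε d/dε` and `t d/dt` agree, so their difference in `twist`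
  -- disappears.
  ∂-hat : ∀ c → D (hat c) ≋₂ hat (θ c)
  ∂-hat c = R₂.trans (R₂.+-congˡ (R₂.*-congˡ (R₂.x≈y⇒x∙y⁻¹≈ε (R₂.trans ηĉ (R₂.sym Θĉ)))))
                     (R₂.trans (R₂.+-cong ηĉ (R₂.zeroʳ ε)) (R₂.+-identityʳ _))
    where
    ηĉ : η.D (hat c) ≋₂ hat (θ c)
    ηĉ = mk₂ λ k → mk λ n → trans (const-⊛-at _ (hat c k) n)
                                  (shift-const-scale (λ _ → ι (nat k)) k (c k) n)
    Θĉ : Θ.D (hat c) ≋₂ hat (θ c)
    Θĉ = mk₂ λ k → mk λ n → shift-const-scale (λ m → ι (nat m)) k (c k) n

  η-κ : ∀ f → η.D (κ f) ≋₂ P₂.𝟎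
  η-κ f = mk₂ λ { zero → R.trans (R.*-congʳ R.ι-0) (R.zeroˡ f) ; (suc k) → R.zeroʳ _ }

  -- A series free of `ε` is killed by `ε d/dε`; only `- ε t d/dt` is left.
  ∂-κ : ∀ f → D (κ f) ≋₂ ⊖₂ (ε ⊛₂ κ (θ f))
  ∂-κ f = R₂.trans (R₂.+-cong (η-κ f) (R₂.*-congˡ (R₂.+-cong (η-κ f) (R₂.-‿cong Θκ))))
            (R₂.trans (R₂.+-identityˡ _) (R₂.trans (R₂.*-congˡ (R₂.+-identityˡ _))
               (R₂.sym (R₂.-‿distribʳ-* _ _))))
    where
    Θκ : Θ.D (κ f) ≋₂ κ (θ f)
    Θκ = mk₂ λ { zero → R.refl ; (suc k) → ϑ.D-0 }

  ∂-ε : D ε ≋₂ ε ⊕₂ ε ⊛₂ ε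
  ∂-ε = R₂.+-cong ηε (R₂.*-congˡ (R₂.trans (R₂.+-cong ηε (R₂.trans (R₂.-‿cong Θε) R₂.-0#≈0#)) (R₂.+-identityʳ _)))
    where
    ηε : η.D ε ≋₂ ε
    ηε = mk₂ λ { zero → R.zeroʳ _ ; (suc zero) → R.trans (R.*-congʳ R.ι-1) (R.*-identityˡ _) ; (suc (suc k)) → R.zeroʳ _ }
    Θε : Θ.D ε ≋₂ P₂.𝟎
    Θε = mk₂ λ { zero → ϑ.D-0 ; (suc zero) → ϑ.D-1 ; (suc (suc k)) → ϑ.D-0 }

  -- The leading factor `r + 1` is invertible, so an equation for `D F` is a recursion for the
  -- coefficients of `F`.
  ∂-suc : ∀ F r → D F (suc r) ≋ R.ι (nat (suc r)) ⊛ F (suc r) ⊕ (R.ι (nat r) ⊛ F r ⊕ ⊖ θ (F r))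
  ∂-suc F r = R.+-congˡ (at₂ (SD₂.X-⊛ (η.D F ⊕₂ ⊖₂ Θ.D F)) (suc r))

  -- Products of the A_r as linear expressions.

  module ProductFormula
    (e : Series) (A : ℕ → Series)
    (A₀-e : A 0 ⊛ e ≋ R.ι 1ℚ)
    (θ-e : θ e ≋ R.ι 1ℚ ⊕ X ⊛ e ⊕ ⊖ e)
    (θ-A : ∀ r → θ (A r) ≋ R.ι (nat (suc r)) ⊛ (A (suc r) ⊕ A r))
    where

    private
      β : Series
      β = A 0

    θ-b : θ β ≋ β ⊕ ⊖ (β ⊛ β) ⊕ ⊖ (X ⊛ β)
    θ-b = inverse-ode seriesAlgebra euler A₀-e θ-e

    private
      ∂-κX : D (κ X) ≋₂ ⊖₂ (ε ⊛₂ κ X)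
      ∂-κX = R₂.trans (∂-κ X) (R₂.-‿cong (R₂.*-congˡ {ε} (P₂.const-cong θ-X)))

      κθb : κ (θ β) ≋₂ κ β ⊕₂ ⊖₂ (κ β ⊛₂ κ β) ⊕₂ ⊖₂ (κ X ⊛₂ κ β)
      κθb = R₂.trans (P₂.const-cong θ-b) (R₂.trans (P₂.const-+ _ _) (R₂.+-cong
        (R₂.trans (P₂.const-+ _ _) (R₂.+-congˡ {κ β} (R₂.trans (P₂.const-neg _) (R₂.-‿cong (P₂.const-* _ _)))))
        (R₂.trans (P₂.const-neg _) (R₂.-‿cong (P₂.const-* _ _)))))

      ∂-ê : D (hat e) ≋₂ R₂.ι 1ℚ ⊕₂ ε ⊛₂ κ X ⊛₂ hat e ⊕₂ ⊖₂ hat e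
      ∂-ê = R₂.trans (∂-hat e) (R₂.trans (hat-cong θ-e) (R₂.trans (hat-⊕ _ _) (R₂.+-cong
        (R₂.trans (hat-⊕ _ _) (R₂.+-cong (hat-const _) (R₂.trans (hat-⊛ X e) (R₂.*-congʳ {hat e} hat-X))))
        (hat-⊖ e))))

      ∂-A : D A ≋₂ ⊖₂ (ε ⊛₂ A)
      ∂-A = mk₂ λ { zero → R.trans (R.+-cong (R.trans (R.*-congʳ {A 0} R.ι-0) (R.zeroˡ _)) (R.zeroˡ _))
                           (R.trans (R.+-identityˡ _) (R.trans (R.sym R.-0#≈0#) (R.-‿cong (R.sym (R.zeroˡ _)))))
                  ; (suc r) → ∂-A-suc r }
        where
        ∂-A-suc : ∀ r → D A (suc r) ≋ ⊖ ((ε ⊛₂ A) (suc r))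
        ∂-A-suc r = begin
          D A (suc r)
            ≈⟨ ∂-suc A r ⟩
          ρ⁺ ⊛ A (suc r) ⊕ (ρ ⊛ A r ⊕ ⊖ θ (A r))
            ≈⟨ R.+-cong (R.*-congʳ (ι-nat-suc seriesAlgebra r))
                 (R.+-congˡ {ρ ⊛ A r} (R.-‿cong (R.trans (θ-A r) (R.*-congʳ (ι-nat-suc seriesAlgebra r))))) ⟩
          (R.ι 1ℚ ⊕ ρ) ⊛ A (suc r) ⊕ (ρ ⊛ A r ⊕ ⊖ ((R.ι 1ℚ ⊕ ρ) ⊛ (A (suc r) ⊕ A r)))
            ≈⟨ solve 3 (λ ρ x y → (con 1ℚ :+ ρ) :* x :+ (ρ :* y :- (con 1ℚ :+ ρ) :* (x :+ y)) := :- y)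
                 R.refl ρ (A (suc r)) (A r) ⟩
          ⊖ A r
            ≈⟨ R.-‿cong (at₂ (SD₂.X-⊛ A) (suc r)) ⟨
          ⊖ ((ε ⊛₂ A) (suc r)) ∎
          where
          open R.Reasoning
          open R.Solver
          ρ = R.ι (nat r)
          ρ⁺ = R.ι (nat (suc r))

      Y : Series₂
      Y = A ⊕₂ ⊖₂ κ β ⊕₂ ε ⊛₂ (κ X ⊕₂ κ β) ⊛₂ (hat e ⊛₂ A)

      ∂-Y : D Y ≋₂ ε ⊛₂ (κ X ⊕₂ κ β ⊕₂ ⊖₂ R₂.ι 1ℚ) ⊛₂ Y
      ∂-Y = defect-ode P₂.seriesAlgebra ∂ ∂-ε ∂-κX (∂-κ β) κθb ∂-ê ∂-A

      -- At `ε = 0` the defect is `A_0 - β = 0`. Beyond that, coefficient `r + 1` of its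
      -- differential equation expresses `(r + 1) Y_(r+1)` through `Y_r` and `θ Y_r`.
      Y≋0 : ∀ r → Y r ≋ 𝟎
      Y≋0 zero = begin
        β ⊕ ⊖ β ⊕ (ε ⊛₂ (κ X ⊕₂ κ β) ⊛₂ (hat e ⊛₂ A)) 0
          ≈⟨ R.+-cong (R.-‿inverseʳ β) (R.trans (R.*-congʳ (R.zeroˡ (X ⊕ β))) (R.zeroˡ _)) ⟩
        𝟎 ⊕ 𝟎
          ≈⟨ R.+-identityˡ _ ⟩
        𝟎 ∎
        where open R.Reasoning
      Y≋0 (suc r) = ι-nat-suc-cancel seriesAlgebra r (begin
        R.ι (nat (suc r)) ⊛ Y (suc r)
          ≈⟨ R.+-identityʳ _ ⟨
        R.ι (nat (suc r)) ⊛ Y (suc r) ⊕ 𝟎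
          ≈⟨ R.+-congˡ {R.ι (nat (suc r)) ⊛ Y (suc r)} rest ⟨
        R.ι (nat (suc r)) ⊛ Y (suc r) ⊕ (R.ι (nat r) ⊛ Y r ⊕ ⊖ θ (Y r))
          ≈⟨ ∂-suc Y r ⟨
        D Y (suc r)
          ≈⟨ at₂ ∂-Y (suc r) ⟩
        (ε ⊛₂ F ⊛₂ Y) (suc r)
          ≈⟨ at₂ (R₂.*-assoc ε F Y) (suc r) ⟩
        (ε ⊛₂ (F ⊛₂ Y)) (suc r)
          ≈⟨ at₂ (SD₂.X-⊛ (F ⊛₂ Y)) (suc r) ⟩
        (F ⊛₂ Y) r
          ≈⟨ P₂.⊛-cong-at {g = Y} (λ { zero → R.refl ; (suc k) → R.trans (R.+-cong (R.+-identityˡ _) R.-0#≈0#) (R.+-identityˡ _) }) (λ _ → R.refl) r ⟩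
        (κ (X ⊕ β ⊕ ⊖ R.ι 1ℚ) ⊛₂ Y) r
          ≈⟨ P₂.const-⊛-at _ Y r ⟩
        (X ⊕ β ⊕ ⊖ R.ι 1ℚ) ⊛ Y r
          ≈⟨ R.trans (R.*-congˡ (Y≋0 r)) (R.zeroʳ _) ⟩
        𝟎 ∎)
        where
        open R.Reasoning
        F = κ X ⊕₂ κ β ⊕₂ ⊖₂ R₂.ι 1ℚ
        rest : R.ι (nat r) ⊛ Y r ⊕ ⊖ θ (Y r) ≋ 𝟎
        rest = R.trans (R.+-cong (R.trans (R.*-congˡ (Y≋0 r)) (R.zeroʳ _))
                                 (R.trans (R.-‿cong (R.trans (Derivation.D-cong euler (Y≋0 r)) (Derivation.D-0 euler))) R.-0#≈0#))
                       (R.+-identityˡ _)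

      -- With `A = t G(t + tε)`, `β = t G(t)` and `hat β = tε G(tε)`, this is `t^2 ε` times the
      -- addition formula.
      b̂A : hat β ⊛₂ A ≋₂ hat β ⊛₂ κ β ⊕₂ ⊖₂ (ε ⊛₂ (κ X ⊕₂ κ β) ⊛₂ A)
      b̂A = defect-zero P₂.seriesAlgebra (hat β)
        (R₂.trans (R₂.sym (hat-⊛ β e)) (R₂.trans (hat-cong A₀-e) (hat-const _)))
        (mk₂ Y≋0)

    -- `S c m` is the sum of `c_k t^k A_(m-k)` over `k ≤ m`. `S′ c m` is the sum of
    -- `c_k t^k A_(m+1-k)` over the same range, hence `S c (m+1)` without its term `k = m + 1`.
    S S′ : Series → ℕ → Series
    S  c = hat c ⊛₂ A
    S′ c = hat c ⊛₂ (A ∘ suc)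

    -- Coefficient `m + 1` of the addition formula multiplied by `hat c`. The term `h (suc m) ⊛ β`
    -- occurs with both signs, and its cancellation leaves the truncated `S′`.
    β-⊛-S : ∀ c m → β ⊛ S c m ≋ ⊖ (S′ (c ⊛ β) m ⊕ X ⊛ S c m)
    β-⊛-S c m = begin
      β ⊛ S c m
        ≈⟨ P₂.const-⊛-at β (S c) m ⟨
      (κ β ⊛₂ S c) m
        ≈⟨ at₂ (SD₂.X-⊛ (κ β ⊛₂ S c)) (suc m) ⟨
      (ε ⊛₂ (κ β ⊛₂ S c)) (suc m)
        ≈⟨ at₂ (multiply-defect P₂.seriesAlgebra (hat c) b̂A) (suc m) ⟩
      (hat c ⊛₂ hat β ⊛₂ κ β) (suc m) ⊕ ⊖ ((hat c ⊛₂ hat β ⊛₂ A) (suc m)) ⊕ ⊖ ((ε ⊛₂ (κ X ⊛₂ S c)) (suc m))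
        ≈⟨ R.+-cong (R.+-cong
             (R.trans (at₂ (R₂.*-congʳ {κ β} ĉb̂) (suc m)) (R.trans (at₂ (R₂.*-comm _ (κ β)) (suc m)) (P₂.const-⊛-at β h (suc m))))
             (R.-‿cong (R.trans (at₂ (R₂.*-congʳ {A} ĉb̂) (suc m)) (P₂.⊛-suc h A m))))
             (R.-‿cong (R.trans (at₂ (SD₂.X-⊛ (κ X ⊛₂ S c)) (suc m)) (P₂.const-⊛-at X (S c) m))) ⟩
      β ⊛ h (suc m) ⊕ ⊖ (S′ (c ⊛ β) m ⊕ h (suc m) ⊛ β) ⊕ ⊖ (X ⊛ S c m)
        ≈⟨ solve 4 (λ β h s x → β :* h :- (s :+ h :* β) :- x := :- (s :+ x)) R.refl
             β (h (suc m)) (S′ (c ⊛ β) m) (X ⊛ S c m) ⟩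
      ⊖ (S′ (c ⊛ β) m ⊕ X ⊛ S c m) ∎
      where
      open R.Reasoning
      open R.Solver
      h = hat (c ⊛ β)
      ĉb̂ : hat c ⊛₂ hat β ≋₂ h
      ĉb̂ = R₂.sym (hat-⊛ c β)

    S-cong : ∀ {c d} → c ≋ d → ∀ m → S c m ≋ S d m
    S-cong p m = at₂ (R₂.*-congʳ {A} (hat-cong p)) m

    S-⊕ : ∀ c d m → S (c ⊕ d) m ≋ S c m ⊕ S d m
    S-⊕ c d m = at₂ (R₂.trans (R₂.*-congʳ {A} (hat-⊕ c d)) (R₂.distribʳ A (hat c) (hat d))) m

    S-ι : ∀ p c m → S (R.ι p ⊛ c) m ≋ R.ι p ⊛ S c m
    S-ι p c m = begin
      S (R.ι p ⊛ c) m               ≈⟨ at₂ (R₂.*-congʳ {A} (R₂.trans (hat-⊛ (R.ι p) c) (R₂.*-congʳ {hat c} (hat-const (ι p))))) m ⟩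
      (κ (R.ι p) ⊛₂ hat c ⊛₂ A) m   ≈⟨ at₂ (R₂.*-assoc (κ (R.ι p)) (hat c) A) m ⟩
      (κ (R.ι p) ⊛₂ S c) m          ≈⟨ P₂.const-⊛-at (R.ι p) (S c) m ⟩
      R.ι p ⊛ S c m                 ∎
      where open R.Reasoning

    -- Coefficient `m + 1` of the Leibniz rule for `D` on `hat c ⊛₂ A`, where `D (hat c)` is
    -- `hat (θ c)` and `D A` is `- ε A`, solved for the `θ` term.
    θ-S : ∀ c m → θ (S c m) ≋ R.ι (nat (suc m)) ⊛ (S c (suc m) ⊕ S c m) ⊕ ⊖ S (θ c) (suc m)
    θ-S c m = R.combine₂ (⊖ R.ι 1ℚ) (S c m) (solve 6 (λ t μ μ⁺ s⁺ s v →
          t :- (μ⁺ :* (s⁺ :+ s) :- v) :=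
          (:- con 1ℚ) :* ((μ⁺ :* s⁺ :+ (μ :* s :- t)) :- (v :- s)) :+ s :* ((con 1ℚ :+ μ) :- μ⁺))
        R.refl (θ (S c m)) (R.ι (nat m)) (R.ι (nat (suc m))) (S c (suc m)) (S c m) (S (θ c) (suc m)))
      (begin
        R.ι (nat (suc m)) ⊛ S c (suc m) ⊕ (R.ι (nat m) ⊛ S c m ⊕ ⊖ θ (S c m))
          ≈⟨ ∂-suc (S c) m ⟨
        D (hat c ⊛₂ A) (suc m)
          ≈⟨ at₂ (D-* (hat c) A) (suc m) ⟩
        (D (hat c) ⊛₂ A) (suc m) ⊕ (hat c ⊛₂ D A) (suc m)
          ≈⟨ R.+-cong (at₂ (R₂.*-congʳ {A} (∂-hat c)) (suc m))
               (R.trans (at₂ (R₂.trans (R₂.*-congˡ {hat c} ∂-A) ĉεA) (suc m))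
                        (R.-‿cong (at₂ (SD₂.X-⊛ (S c)) (suc m)))) ⟩
        S (θ c) (suc m) ⊕ ⊖ S c m ∎)
      (R.sym (ι-nat-suc seriesAlgebra m))
      where
      open R.Reasoning
      open R.Solver
      ĉεA : hat c ⊛₂ (⊖₂ (ε ⊛₂ A)) ≋₂ ⊖₂ (ε ⊛₂ S c)
      ĉεA = swap (hat c) ε A
        where
        swap : ∀ x y z → x ⊛₂ (⊖₂ (y ⊛₂ z)) ≋₂ ⊖₂ (y ⊛₂ (x ⊛₂ z))
        swap = R₂.Solver.solve 3 (λ x y z → x R₂.Solver.:* (R₂.Solver.:- (y R₂.Solver.:* z)) R₂.Solver.:=
                                    R₂.Solver.:- (y R₂.Solver.:* (x R₂.Solver.:* z))) R₂.refl

    S-θA : ∀ r m → S (θ (A r)) m ≋ R.ι (nat (suc r)) ⊛ (S (A (suc r)) m ⊕ S (A r) m)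
    S-θA r m = R.trans (S-cong (θ-A r) m) (R.trans (S-ι (nat (suc r)) _ m) (R.*-congˡ (S-⊕ _ _ m)))

    -- For `m = r + s + 1` this is `t^(r+s+2)` times the difference between `G_r G_s` and its linear
    -- expression. For `r = s = 0` its vanishing amounts to `G' = - G - G^2`.
    Φ : ℕ → ℕ → ℕ → Series
    Φ r s m = A r ⊛ A s ⊕ (R.ι (δ0 r) ⊛ (X ⊛ A s) ⊕ R.ι (δ0 s) ⊛ (X ⊛ A r))
            ⊕ ⊖ A m ⊕ (R.ι (sgn r) ⊛ S (A r) m ⊕ R.ι (sgn s) ⊛ S (A s) m)

    private
      ι-suc : ∀ r → R.ι (nat (suc r)) ≋ R.ι (nat r) ⊕ R.ι 1ℚ
      ι-suc r = R.trans (ι-nat-suc seriesAlgebra r) (R.+-comm _ _)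

      ι-suc² : ∀ r s → R.ι (nat (2 ℕ.+ (r ℕ.+ s))) ≋ R.ι (nat r) ⊕ R.ι (nat s) ⊕ R.ι (nat 2)
      ι-suc² r s = R.trans (R.reflexive (≡.cong R.ι (≡.trans (nat-+ 2 (r ℕ.+ s)) (≡.trans (ℚ.+-comm (nat 2) (nat (r ℕ.+ s))) (≡.cong (ℚ._+ nat 2) (nat-+ r s))))))
        (R.trans (R.ι-+ _ _) (R.+-congʳ {R.ι (nat 2)} (R.ι-+ _ _)))

      ι-δ : ∀ r → R.ι (nat r) ⊛ R.ι (δ0 r) ≋ 𝟎
      ι-δ r = R.trans (R.sym (R.ι-* _ _)) (R.trans (R.reflexive (≡.cong R.ι (nat-*-δ0 r))) R.ι-0)

    -- The relation is linear in the family and holds for each summand of `Φ` separately; the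
    -- summands attached to `s` follow by exchanging `r` and `s`.
    Φ-contiguous : ∀ r s → let m = suc (r ℕ.+ s) in
      Contiguity.Contiguous seriesAlgebra euler (R.ι (nat r)) (R.ι (nat s))
        (Φ r s m) (Φ (suc r) s (suc m)) (Φ r (suc s) (suc m))
    Φ-contiguous r s = C.contiguous-+ (C.contiguous-+ (C.contiguous-+
        (C.contiguous-product θAr θAs)
        (C.contiguous-+ (C.contiguous-leftδ (θ-ι (δ0 r)) (ι-δ r) θ-X θAs)
                        (contiguous-swap seriesAlgebra euler (C′.contiguous-leftδ (θ-ι (δ0 s)) (ι-δ s) θ-X θAr))))
        (C.contiguous-neg (C.contiguous-diagonal (R.trans (θ-A m) (R.*-congʳ (ι-suc² r s))))))
        (C.contiguous-+
          (C.contiguous-left (R.ι-neg (sgn r)) (θ-ι (sgn r)) (θS r (ι-suc r)))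
          (contiguous-swap seriesAlgebra euler (C′.contiguous-left (R.ι-neg (sgn s)) (θ-ι (sgn s)) (θS′ s (ι-suc s)))))
      where
      module C = Contiguity seriesAlgebra euler (R.ι (nat r)) (R.ι (nat s))
      module C′ = Contiguity seriesAlgebra euler (R.ι (nat s)) (R.ι (nat r))
      m = suc (r ℕ.+ s)
      θAr : θ (A r) ≋ (R.ι (nat r) ⊕ R.ι 1ℚ) ⊛ (A (suc r) ⊕ A r)
      θAr = R.trans (θ-A r) (R.*-congʳ (ι-suc r))
      θAs : θ (A s) ≋ (R.ι (nat s) ⊕ R.ι 1ℚ) ⊛ (A (suc s) ⊕ A s)
      θAs = R.trans (θ-A s) (R.*-congʳ (ι-suc s))
      θS : ∀ q {k} → R.ι (nat (suc q)) ≋ k → θ (S (A q) m) ≋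
           (R.ι (nat r) ⊕ R.ι (nat s) ⊕ R.ι (nat 2)) ⊛ (S (A q) (suc m) ⊕ S (A q) m)
           ⊕ ⊖ (k ⊛ (S (A (suc q)) (suc m) ⊕ S (A q) (suc m)))
      θS q e = R.trans (θ-S (A q) m) (R.+-cong (R.*-congʳ (ι-suc² r s))
                 (R.-‿cong (R.trans (S-θA q (suc m)) (R.*-congʳ e))))
      θS′ : ∀ q {k} → R.ι (nat (suc q)) ≋ k → θ (S (A q) m) ≋
           (R.ι (nat s) ⊕ R.ι (nat r) ⊕ R.ι (nat 2)) ⊛ (S (A q) (suc m) ⊕ S (A q) m)
           ⊕ ⊖ (k ⊛ (S (A (suc q)) (suc m) ⊕ S (A q) (suc m)))
      θS′ q e = R.trans (θS q e) (R.+-congʳ (R.*-congʳ (R.+-congʳ {R.ι (nat 2)} (R.+-comm _ _))))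

    β-⊛-A : ∀ r → β ⊛ A r ≋ ⊖ (S′ β r ⊕ X ⊛ A r)
    β-⊛-A r = begin
      β ⊛ A r                                    ≈⟨ R.*-congˡ (S-one r) ⟨
      β ⊛ S (R.ι 1ℚ) r                           ≈⟨ β-⊛-S (R.ι 1ℚ) r ⟩
      ⊖ (S′ (R.ι 1ℚ ⊛ β) r ⊕ X ⊛ S (R.ι 1ℚ) r)   ≈⟨ R.-‿cong (R.+-cong (at₂ (R₂.*-congʳ {A ∘ suc} (hat-cong ι1-⊛b)) r) (R.*-congˡ (S-one r))) ⟩
      ⊖ (S′ β r ⊕ X ⊛ A r)                       ∎
      where
      open R.Reasoning
      ι1-⊛b : R.ι 1ℚ ⊛ β ≋ β
      ι1-⊛b = R.trans (R.*-congʳ {β} R.ι-1) (R.*-identityˡ β)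
      S-one : ∀ r → S (R.ι 1ℚ) r ≋ A r
      S-one r = R.trans (at₂ (R₂.*-congʳ {A} (R₂.trans (hat-const (ι 1ℚ)) R₂.ι-1)) r) (at₂ (R₂.*-identityˡ A) r)

    -- The first three hypotheses say `A_r = (-1)^r + b_(r+1) t^(r+1) + ...`: the polar part of
    -- `G_r` is a single power. The fourth is `F(-t) = F(t) + t` in coefficients.
    module _
      (A-zero   : ∀ r → A r 0 ≈ ι (sgn r))
      (A-low    : ∀ r k → k < r → A r (suc k) ≈ 0#)
      (A-diag   : ∀ r → A r (suc r) ≈ β (suc r))
      (b-parity : ∀ r → ι (sgn r) * β (suc r) + β (suc r) + ι (δ0 r) ≈ 0#)
      where

      private
        module _ (r : ℕ) where
          h : Series
          h = hat β (suc r)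

          ⊛-last : ∀ f (g : Series₂) n → (∀ k → k < n → f k ≋ 𝟎) → (f ⊛₂ g) n ≋ f n ⊛ g 0
          ⊛-last f g zero    z = R.refl
          ⊛-last f g (suc n) z = R.trans
            (R.+-cong (R.trans (R.*-congʳ {g (suc n)} (z 0 (s≤s z≤n))) (R.zeroˡ _)) (⊛-last (f ∘ suc) g n (λ k k<n → z (suc k) (s≤s k<n))))
            (R.+-identityˡ _)

          -- The coefficients of `A_r` in degrees `1` to `r` vanish, so only the two end terms of
          -- the sum survive.
          S-A : S (A r) (suc r) ≋ R.ι (sgn r) ⊛ A (suc r) ⊕ h ⊛ β
          S-A = R.+-cong (R.*-congʳ {A (suc r)} (const-cong (A-zero r)))
            (R.trans (⊛-last (hat (A r) ∘ suc) A r low) (R.*-congʳ {β} (shift-cong (suc r) (const-cong (A-diag r)))))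
            where
            low : ∀ k → k < r → hat (A r) (suc k) ≋ 𝟎
            low k k<r = R.trans (shift-cong (suc k) (R.trans (const-cong (A-low r k k<r)) const-𝟎))
                                (mk (shift-𝟎-at (suc k)))

          h-parity : R.ι (sgn r) ⊛ h ⊕ h ⊕ R.ι (δ0 r) ⊛ X ≋ R.ι 0ℚ
          h-parity = R.trans (R.+-cong (R.+-congʳ {h} (ι-h (sgn r))) (δX r)) (R.trans
              (R.sym (R.trans (shift-cong (suc r) (R.trans (const-+ _ _) (R.+-congʳ {const (ι (δ0 r))} (const-+ _ _))))
                (R.trans (mk (shift-⊕-at (suc r) _ _)) (R.+-congʳ {shift (suc r) (const (ι (δ0 r)))} (mk (shift-⊕-at (suc r) _ _))))))
              (R.trans (shift-cong (suc r) (R.trans (const-cong (b-parity r)) const-𝟎))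
                (R.trans (mk (shift-𝟎-at (suc r))) (R.sym R.ι-0))))
            where
            ι-h : ∀ p → R.ι p ⊛ h ≋ shift (suc r) (const (ι p * β (suc r)))
            ι-h p = mk λ n → trans (const-⊛-at (ι p) h n) (shift-const-scale (λ _ → ι p) (suc r) (β (suc r)) n)
            δX : ∀ r → R.ι (δ0 r) ⊛ X ≋ shift (suc r) (const (ι (δ0 r)))
            δX zero    = mk λ n → trans (const-⊛-at (ι 1ℚ) X n) (trans (shift-const-scale (λ _ → ι 1ℚ) 1 1# n)
                                     (at (shift-cong 1 (const-cong (*-identityʳ _))) n))
            δX (suc r) = R.trans (R.*-congʳ {X} R.ι-0) (R.trans (R.zeroˡ X) (R.sym (R.trans
                           (shift-cong (2 ℕ.+ r) (R.trans (const-cong ι-0) const-𝟎))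
                           (mk (shift-𝟎-at (2 ℕ.+ r))))))

          -- For `s = 0` the product `A_r β` is known from `β-⊛-A`. What remains is a multiple of
          -- `σ σ - 1` and `β` times the parity relation for `h`, the two corrections in the
          -- certificate.
          Φ-base : Φ r 0 (suc r) ≋ 𝟎
          Φ-base = begin
            Φ r 0 (suc r)
              ≈⟨ R.+-congˡ {A r ⊛ β ⊕ (δ ⊛ (X ⊛ β) ⊕ R.ι 1ℚ ⊛ (X ⊛ A r)) ⊕ ⊖ A (suc r)}
                   (R.+-cong (R.*-congˡ {σ} S-A) (R.*-congˡ {R.ι 1ℚ} (P₂.⊛-suc (hat β) A r))) ⟩
            A r ⊛ β ⊕ (δ ⊛ (X ⊛ β) ⊕ R.ι 1ℚ ⊛ (X ⊛ A r)) ⊕ ⊖ A (suc r)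
              ⊕ (σ ⊛ (σ ⊛ A (suc r) ⊕ h ⊛ β) ⊕ R.ι 1ℚ ⊛ (S′ β r ⊕ h ⊛ β))
              ≈⟨ R.combine₂ (A (suc r)) β (solve 8 (λ a a⁺ β δ x σ h s →
                   a :* β :+ (δ :* (x :* β) :+ con 1ℚ :* (x :* a)) :- a⁺
                     :+ (σ :* (σ :* a⁺ :+ h :* β) :+ con 1ℚ :* (s :+ h :* β))
                   :- (β :* a :+ (s :+ x :* a))
                   := a⁺ :* (σ :* σ :- con 1ℚ) :+ β :* ((σ :* h :+ h :+ δ :* x) :- con 0ℚ))
                   R.refl (A r) (A (suc r)) β δ X σ h (S′ β r)) σσ h-parity ⟩
            β ⊛ A r ⊕ (S′ β r ⊕ X ⊛ A r)
              ≈⟨ R.trans (R.+-congʳ {S′ β r ⊕ X ⊛ A r} (β-⊛-A r)) (R.-‿inverseˡ _) ⟩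
            𝟎 ∎
            where
            open R.Reasoning
            open R.Solver
            σ = R.ι (sgn r)
            δ = R.ι (δ0 r)
            σσ : σ ⊛ σ ≋ R.ι 1ℚ
            σσ = R.trans (R.sym (R.ι-* _ _)) (R.reflexive (≡.cong R.ι (sgn-square r)))

      -- The induction runs over `s` with `r` arbitrary, since the step to `(r, s + 1)` also uses
      -- `(r + 1, s)`.
      Φ-zero : ∀ s r m → m ≡ suc (r ℕ.+ s) → Φ r s m ≋ 𝟎
      Φ-zero zero    r m ≡.refl rewrite ℕ.+-identityʳ r = Φ-base r
      Φ-zero (suc s) r m ≡.refl rewrite ℕ.+-suc r s =
        ι-nat-suc-cancel seriesAlgebra s (R.trans (R.*-congʳ (ι-suc s))
          (Contiguity.contiguous-zero seriesAlgebra euler (R.ι (nat r)) (R.ι (nat s)) (Φ-contiguous r s)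
            (Φ-zero s r _ ≡.refl) (Φ-zero s (suc r) _ ≡.refl)))

-- Finite sums, binomial coefficients and the Bernoulli recurrence.

module BernoulliConvolutions where
  open import Data.Rational using (_+_; _*_; -_; _-_)
  open ≡ using (refl; sym; trans; cong; cong₂)
  open +-*-Solver using (solve; _:=_; _:+_; _:*_; _:-_; :-_; con)

  sum-cong : ∀ a l {f g} → (∀ k → a ≤ k → k < a ℕ.+ l → f k ≡ g k) → sumFrom a l f ≡ sumFrom a l g
  sum-cong a zero    p = refl
  sum-cong a (suc l) p = cong₂ _+_ (p a ℕ.≤-refl (ℕ.m<m+n a (s≤s z≤n)))
    (sum-cong (suc a) l λ k a<k k< → p k (ℕ.<⇒≤ a<k) (≡.subst (k <_) (sym (ℕ.+-suc a l)) k<))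

  sum-suc : ∀ a l f → sumFrom (suc a) l f ≡ sumFrom a l (f ∘ suc)
  sum-suc a zero    f = refl
  sum-suc a (suc l) f = cong (f (suc a) +_) (sum-suc (suc a) l f)

  sum-zero : ∀ a l {f} → (∀ k → a ≤ k → k < a ℕ.+ l → f k ≡ 0ℚ) → sumFrom a l f ≡ 0ℚ
  sum-zero a l p = trans (sum-cong a l p) (go a l)
    where
    go : ∀ a l → sumFrom a l (λ _ → 0ℚ) ≡ 0ℚ
    go a zero    = refl
    go a (suc l) = trans (ℚ.+-identityˡ _) (go (suc a) l)

  sum-+ : ∀ a l f g → sumFrom a l (λ k → f k + g k) ≡ sumFrom a l f + sumFrom a l g
  sum-+ a zero    f g = refl
  sum-+ a (suc l) f g = trans (cong (f a + g a +_) (sum-+ (suc a) l f g))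
    (solve 4 (λ x y u v → (x :+ y) :+ (u :+ v) := (x :+ u) :+ (y :+ v)) refl (f a) (g a) _ _)

  sum-*ˡ : ∀ a l c f → sumFrom a l (λ k → c * f k) ≡ c * sumFrom a l f
  sum-*ˡ a zero    c f = sym (ℚ.*-zeroʳ c)
  sum-*ˡ a (suc l) c f = trans (cong (c * f a +_) (sum-*ˡ (suc a) l c f)) (sym (ℚ.*-distribˡ-+ c _ _))

  sum-split : ∀ a l m f → sumFrom a (l ℕ.+ m) f ≡ sumFrom a l f + sumFrom (a ℕ.+ l) m f
  sum-split a zero    m f = trans (cong (λ x → sumFrom x m f) (sym (ℕ.+-identityʳ a))) (sym (ℚ.+-identityˡ _))
  sum-split a (suc l) m f = trans (cong (f a +_) (sum-split (suc a) l m f))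
    (trans (sym (ℚ.+-assoc (f a) _ _)) (cong (λ x → f a + sumFrom (suc a) l f + sumFrom x m f) (sym (ℕ.+-suc a l))))

  sum-last : ∀ a l f → sumFrom a (suc l) f ≡ sumFrom a l f + f (a ℕ.+ l)
  sum-last a l f = trans (cong (λ x → sumFrom a x f) (sym (ℕ.+-comm l 1)))
    (trans (sum-split a l 1 f) (cong (λ x → sumFrom a l f + x) (ℚ.+-identityʳ (f (a ℕ.+ l)))))

  sum-swap : ∀ a l c m (f : ℕ → ℕ → ℚ) →
             sumFrom a l (λ i → sumFrom c m (f i)) ≡ sumFrom c m (λ j → sumFrom a l (λ i → f i j))
  sum-swap a zero    c m f = sym (sum-zero c m (λ _ _ _ → refl))
  sum-swap a (suc l) c m f = trans (cong (sumFrom c m (f a) +_) (sum-swap (suc a) l c m f))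
    (sym (sum-+ c m (f a) _))

  binom-pascal : ∀ n k → binom (suc n) (suc k) ≡ binom n k + binom n (suc k)
  binom-pascal n k = trans (cong nat (sym (nCk+nC[k+1]≡[n+1]C[k+1] n k))) (nat-+ (n C k) (n C suc k))

  binom-zero : ∀ n → binom n 0 ≡ 1ℚ
  binom-zero n = cong nat (trans (nCk≡nC[n∸k] {0} {n} z≤n) (nCn≡1 n))

  binom-diag : ∀ n → binom n n ≡ 1ℚ
  binom-diag n = cong nat (nCn≡1 n)

  binom-vanish : ∀ {n k} → n < k → binom n k ≡ 0ℚ
  binom-vanish n<k = cong nat (k>n⇒nCk≡0 n<k)

  binom-absorb : ∀ n r → nat (suc n) * binom n r ≡ nat (suc r) * binom (suc n) (suc r)
  binom-absorb zero    zero    = refl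
  binom-absorb zero    (suc r) = trans (cong (nat 1 *_) (binom-vanish {0} {suc r} (s≤s z≤n)))
    (sym (trans (cong (nat (2 ℕ.+ r) *_) (binom-vanish {1} {2 ℕ.+ r} (s≤s (s≤s z≤n)))) (ℚ.*-zeroʳ (nat (2 ℕ.+ r)))))
  binom-absorb (suc n) zero    = begin
    nat (2 ℕ.+ n) * binom (suc n) 0
      ≡⟨ cong₂ _*_ (nat-suc (suc n)) (binom-zero (suc n)) ⟩
    (1ℚ + nat (suc n)) * 1ℚ
      ≡⟨ solve 1 (λ s → (con 1ℚ :+ s) :* con 1ℚ := con 1ℚ :* (con 1ℚ :+ s :* con 1ℚ)) refl (nat (suc n)) ⟩
    nat 1 * (1ℚ + nat (suc n) * 1ℚ)
      ≡⟨ cong₂ (λ x y → nat 1 * (x + nat (suc n) * y)) (binom-zero (suc n)) (binom-zero n) ⟨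
    nat 1 * (binom (suc n) 0 + nat (suc n) * binom n 0)
      ≡⟨ cong (λ x → nat 1 * (binom (suc n) 0 + x)) (trans (binom-absorb n 0) (ℚ.*-identityˡ (binom (suc n) 1))) ⟩
    nat 1 * (binom (suc n) 0 + binom (suc n) 1)
      ≡⟨ cong (nat 1 *_) (binom-pascal (suc n) 0) ⟨
    nat 1 * binom (2 ℕ.+ n) 1 ∎
    where open ≡.≡-Reasoning
  binom-absorb (suc n) (suc r) = begin
    nat (2 ℕ.+ n) * binom (suc n) (suc r)
      ≡⟨ cong₂ _*_ (nat-suc (suc n)) (binom-pascal n r) ⟩
    (1ℚ + nat (suc n)) * (binom n r + binom n (suc r))
      ≡⟨ solve 3 (λ s x y → (con 1ℚ :+ s) :* (x :+ y) := x :+ y :+ (s :* x :+ s :* y)) refl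
           (nat (suc n)) (binom n r) (binom n (suc r)) ⟩
    binom n r + binom n (suc r) + (nat (suc n) * binom n r + nat (suc n) * binom n (suc r))
      ≡⟨ cong₂ _+_ (sym (binom-pascal n r)) (cong₂ _+_ (binom-absorb n r) (trans (binom-absorb n (suc r)) (cong (_* binom (suc n) (2 ℕ.+ r)) (nat-suc (suc r))))) ⟩
    binom (suc n) (suc r) + (nat (suc r) * binom (suc n) (suc r) + (1ℚ + nat (suc r)) * binom (suc n) (2 ℕ.+ r))
      ≡⟨ solve 3 (λ s x y → x :+ (s :* x :+ (con 1ℚ :+ s) :* y) := (con 1ℚ :+ s) :* (x :+ y)) refl
           (nat (suc r)) (binom (suc n) (suc r)) (binom (suc n) (2 ℕ.+ r)) ⟩
    (1ℚ + nat (suc r)) * (binom (suc n) (suc r) + binom (suc n) (2 ℕ.+ r))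
      ≡⟨ cong₂ _*_ (nat-suc (suc r)) (binom-pascal (suc n) (suc r)) ⟨
    nat (2 ℕ.+ r) * binom (2 ℕ.+ n) (2 ℕ.+ r) ∎
    where open ≡.≡-Reasoning

  binom-invFact : ∀ k j → binom (k ℕ.+ j) k * invFact (k ℕ.+ j) ≡ invFact k * invFact j
  binom-invFact zero    j = cong (_* invFact j) (binom-zero j)
  binom-invFact (suc k) j = nat-suc-cancel k (begin
    nat (suc k) * (binom (suc n) (suc k) * invFact (suc n))
      ≡⟨ ℚ.*-assoc (nat (suc k)) _ _ ⟨
    nat (suc k) * binom (suc n) (suc k) * invFact (suc n)
      ≡⟨ cong (_* invFact (suc n)) (binom-absorb n k) ⟨
    nat (suc n) * binom n k * invFact (suc n)
      ≡⟨ solve 3 (λ s x i → s :* x :* i := x :* (s :* i)) refl (nat (suc n)) (binom n k) (invFact (suc n)) ⟩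
    binom n k * (nat (suc n) * invFact (suc n))
      ≡⟨ cong (binom n k *_) (invFact-suc n) ⟩
    binom n k * invFact n
      ≡⟨ binom-invFact k j ⟩
    invFact k * invFact j
      ≡⟨ cong (_* invFact j) (invFact-suc k) ⟨
    nat (suc k) * invFact (suc k) * invFact j
      ≡⟨ ℚ.*-assoc (nat (suc k)) _ _ ⟩
    nat (suc k) * (invFact (suc k) * invFact j) ∎)
    where
    open ≡.≡-Reasoning
    n = k ℕ.+ j

  prod-suc : ∀ a l {f g : ℕ → ℚ} → (∀ k → f (suc k) ≡ g k) → prodFrom (suc a) l f ≡ prodFrom a l g
  prod-suc a zero    p = refl
  prod-suc a (suc l) p = cong₂ _*_ (p a) (prod-suc (suc a) l p)

  fallProd-suc : ∀ i r → fallProd (suc i) (suc r) ≡ nat i * fallProd i r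
  fallProd-suc i r = cong₂ _*_ first (prod-suc 1 r step)
    where
    step : ∀ k → nat (suc i) - nat (suc k) ≡ nat i - nat k
    step k = trans (cong₂ _-_ (nat-suc i) (nat-suc k))
      (solve 2 (λ x y → (con 1ℚ :+ x) :- (con 1ℚ :+ y) := x :- y) refl (nat i) (nat k))
    first : nat (suc i) - nat 1 ≡ nat i
    first = trans (cong (_- nat 1) (nat-suc i)) (solve 1 (λ x → (con 1ℚ :+ x) :- con 1ℚ := x) refl (nat i))

  -- With argument `i + 1` the product is the falling factorial `i (i - 1) ...` of length `r`; for
  -- `r > i` it contains the factor zero, in agreement with the vanishing binomial.
  fallProd-binom : ∀ i r → invFact r * fallProd (suc i) r ≡ binom i r
  fallProd-binom i       zero    = sym (binom-zero i)
  fallProd-binom zero    (suc r) = trans (cong (invFact (suc r) *_) (trans (fallProd-suc 0 r) (ℚ.*-zeroˡ (fallProd 0 r))))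
    (trans (ℚ.*-zeroʳ (invFact (suc r))) (sym (binom-vanish {0} {suc r} (s≤s z≤n))))
  fallProd-binom (suc i) (suc r) = nat-suc-cancel r (begin
    nat (suc r) * (invFact (suc r) * fallProd (2 ℕ.+ i) (suc r))
      ≡⟨ cong (λ x → nat (suc r) * (invFact (suc r) * x)) (fallProd-suc (suc i) r) ⟩
    nat (suc r) * (invFact (suc r) * (nat (suc i) * fallProd (suc i) r))
      ≡⟨ solve 4 (λ s j n f → s :* (j :* (n :* f)) := n :* (s :* j :* f)) refl
           (nat (suc r)) (invFact (suc r)) (nat (suc i)) (fallProd (suc i) r) ⟩
    nat (suc i) * (nat (suc r) * invFact (suc r) * fallProd (suc i) r)
      ≡⟨ cong (λ x → nat (suc i) * (x * fallProd (suc i) r)) (invFact-suc r) ⟩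
    nat (suc i) * (invFact r * fallProd (suc i) r)
      ≡⟨ cong (nat (suc i) *_) (fallProd-binom i r) ⟩
    nat (suc i) * binom i r
      ≡⟨ binom-absorb i r ⟩
    nat (suc r) * binom (suc i) (suc r) ∎)
    where open ≡.≡-Reasoning

  nth-++ˡ : ∀ xs {ys k} → k < length xs → nth (xs ++ ys) k ≡ nth xs k
  nth-++ˡ (x ∷ xs) {k = zero}  _         = refl
  nth-++ˡ (x ∷ xs) {k = suc k} (s≤s k<n) = nth-++ˡ xs k<n

  nth-++-length : ∀ xs {y} → nth (xs ++ y ∷ []) (length xs) ≡ y
  nth-++-length []       = refl
  nth-++-length (x ∷ xs) = nth-++-length xs

  length-bernoulliList : ∀ m → length (bernoulliList m) ≡ suc m
  length-bernoulliList zero    = refl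
  length-bernoulliList (suc m) = trans (length-++ (bernoulliList m))
    (trans (ℕ.+-comm _ 1) (cong suc (length-bernoulliList m)))

  nth-bernoulliList : ∀ {m k} → k ≤ m → nth (bernoulliList m) k ≡ B k
  nth-bernoulliList {zero}  {zero} z≤n = refl
  nth-bernoulliList {suc m} {k} k≤ with ℕ.m≤n⇒m<n∨m≡n k≤
  ... | inj₁ (s≤s k≤m) = trans
          (nth-++ˡ (bernoulliList m) (≡.subst (k <_) (sym (length-bernoulliList m)) (s≤s k≤m)))
          (nth-bernoulliList k≤m)
  ... | inj₂ refl = refl

  weighted-sum : ∀ N s xs {g : ℕ → ℚ} → (∀ i → i < length xs → g (s ℕ.+ i) ≡ nth xs i) →
                 weighted N s xs ≡ sumFrom s (length xs) (λ k → binom N k * g k)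
  weighted-sum N s []       p = refl
  weighted-sum N s (x ∷ xs) {g} p = cong₂ _+_
    (cong (binom N s *_) (trans (sym (p 0 (s≤s z≤n))) (cong g (ℕ.+-identityʳ s))))
    (weighted-sum N (suc s) xs λ i i< → trans (cong g (sym (ℕ.+-suc s i))) (p (suc i) (s≤s i<)))

  -- The last summand has binomial factor `m + 2`, and the new list entry is defined so as to cancel
  -- the earlier ones.
  bernoulli-recurrence : ∀ m → sumFrom 0 (2 ℕ.+ m) (λ k → binom (2 ℕ.+ m) k * B k) ≡ 0ℚ
  bernoulli-recurrence m = begin
    sumFrom 0 (2 ℕ.+ m) (λ k → binom (2 ℕ.+ m) k * B k)
      ≡⟨ sum-last 0 (suc m) (λ k → binom (2 ℕ.+ m) k * B k) ⟩
    W + binom (2 ℕ.+ m) (suc m) * B (suc m)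
      ≡⟨ cong₂ (λ x y → W + x * y) top B-suc ⟩
    W + nat (2 ℕ.+ m) * ((- (ℤ.+ 1 / (2 ℕ.+ m))) * W)
      ≡⟨ solve 3 (λ w n i → w :+ n :* ((:- i) :* w) := (con 1ℚ :- n :* i) :* w) refl W (nat (2 ℕ.+ m)) (ℤ.+ 1 / (2 ℕ.+ m)) ⟩
    (1ℚ - nat (2 ℕ.+ m) * (ℤ.+ 1 / (2 ℕ.+ m))) * W
      ≡⟨ cong (λ x → (1ℚ - x) * W) (nat-*-1/ (2 ℕ.+ m)) ⟩
    (1ℚ - 1ℚ) * W
      ≡⟨ ℚ.*-zeroˡ W ⟩
    0ℚ ∎
    where
    open ≡.≡-Reasoning
    W = sumFrom 0 (suc m) (λ k → binom (2 ℕ.+ m) k * B k)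
    top : binom (2 ℕ.+ m) (suc m) ≡ nat (2 ℕ.+ m)
    top = nat-suc-cancel m (trans (sym (binom-absorb (suc m) m)) (trans (ℚ.*-comm (nat (2 ℕ.+ m)) (binom (suc m) m))
            (cong (_* nat (2 ℕ.+ m)) (binom-co m))))
      where
      binom-co : ∀ m → binom (suc m) m ≡ nat (suc m)
      binom-co zero    = refl
      binom-co (suc m) = trans (binom-pascal (suc m) m) (trans (cong₂ _+_ (binom-co m) (binom-diag (suc m)))
        (trans (ℚ.+-comm (nat (suc m)) 1ℚ) (sym (nat-suc (suc m)))))
    weighted-W : weighted (2 ℕ.+ m) 0 (bernoulliList m) ≡ W
    weighted-W = trans (weighted-sum (2 ℕ.+ m) 0 (bernoulliList m) {B}
        λ i i< → sym (nth-bernoulliList (ℕ.≤-pred (≡.subst (i <_) (length-bernoulliList m) i<))))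
      (cong (λ l → sumFrom 0 l (λ k → binom (2 ℕ.+ m) k * B k)) (length-bernoulliList m))
    B-suc : B (suc m) ≡ (- (ℤ.+ 1 / (2 ℕ.+ m))) * W
    B-suc = trans (cong (nth (bernoulliList (suc m))) (sym (length-bernoulliList m)))
      (trans (nth-++-length (bernoulliList m)) (cong ((- (ℤ.+ 1 / (2 ℕ.+ m))) *_) weighted-W))

  -- F (e^t - 1) / t = 1
  b-expansion : ∀ n → sumFrom 0 (suc n) (λ k → b k * invFact (suc (n ∸ k))) ≡ δ0 n
  b-expansion zero    = refl
  b-expansion (suc m) = begin
    sumFrom 0 (2 ℕ.+ m) (λ k → b k * invFact (suc (suc m ∸ k)))
      ≡⟨ sum-cong 0 (2 ℕ.+ m) (λ k _ k< → term k (ℕ.≤-pred k<)) ⟩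
    sumFrom 0 (2 ℕ.+ m) (λ k → invFact (2 ℕ.+ m) * (binom (2 ℕ.+ m) k * B k))
      ≡⟨ sum-*ˡ 0 (2 ℕ.+ m) (invFact (2 ℕ.+ m)) _ ⟩
    invFact (2 ℕ.+ m) * sumFrom 0 (2 ℕ.+ m) (λ k → binom (2 ℕ.+ m) k * B k)
      ≡⟨ trans (cong (invFact (2 ℕ.+ m) *_) (bernoulli-recurrence m)) (ℚ.*-zeroʳ (invFact (2 ℕ.+ m))) ⟩
    0ℚ ∎
    where
    open ≡.≡-Reasoning
    term : ∀ k → k ≤ suc m → b k * invFact (suc (suc m ∸ k)) ≡ invFact (2 ℕ.+ m) * (binom (2 ℕ.+ m) k * B k)
    term k k≤ = begin
      B k * invFact k * invFact (suc (suc m ∸ k))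
        ≡⟨ ℚ.*-assoc (B k) _ _ ⟩
      B k * (invFact k * invFact (suc (suc m ∸ k)))
        ≡⟨ cong (B k *_) (binom-invFact k (suc (suc m ∸ k))) ⟨
      B k * (binom (k ℕ.+ suc (suc m ∸ k)) k * invFact (k ℕ.+ suc (suc m ∸ k)))
        ≡⟨ cong (λ x → B k * (binom x k * invFact x)) (trans (ℕ.+-suc k _) (cong suc (ℕ.m+[n∸m]≡n k≤))) ⟩
      B k * (binom (2 ℕ.+ m) k * invFact (2 ℕ.+ m))
        ≡⟨ solve 3 (λ x y z → x :* (y :* z) := z :* (y :* x)) refl (B k) (binom (2 ℕ.+ m) k) (invFact (2 ℕ.+ m)) ⟩
      invFact (2 ℕ.+ m) * (binom (2 ℕ.+ m) k * B k) ∎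

  -- The product formula for the actual Bernoulli series.

  open PowerSeries ℚ-algebra
  open SeriesDerivations ℚ-algebra
  open DoubleSeries ℚ-algebra using (module R; Series₂; _⊛₂_; hat; module ProductFormula)
  open Reflection ℚ-algebra using (reflect; reflect-inverse)

  -- The coefficients of t^(r+1) G^(r) / r!, where G = 1 / (e^t - 1).
  A : ℕ → Series
  A r zero    = sgn r
  A r (suc k) = binom k r * b (suc k)

  -- The series of `(e^t - 1) / t`.
  expm1 : Series
  expm1 n = invFact (suc n)

  A-0 : ∀ n → A 0 n ≡ b n
  A-0 zero    = refl
  A-0 (suc n) = trans (cong (_* b (suc n)) (binom-zero n)) (ℚ.*-identityˡ (b (suc n)))

  ⊛-sum : ∀ f g n → (f ⊛ g) n ≡ sumFrom 0 (suc n) (λ k → f k * g (n ∸ k))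
  ⊛-sum f g zero    = sym (ℚ.+-identityʳ (f 0 * g 0))
  ⊛-sum f g (suc n) = cong (f 0 * g (suc n) +_)
    (trans (⊛-sum (f ∘ suc) g n) (sym (sum-suc 0 (suc n) (λ k → f k * g (suc n ∸ k)))))

  δ0≡const : ∀ n → δ0 n ≡ const 1ℚ n
  δ0≡const zero    = refl
  δ0≡const (suc n) = refl

  A₀-expm1 : A 0 ⊛ expm1 ≋ R.ι 1ℚ
  A₀-expm1 = mk λ n → trans (⊛-sum (A 0) expm1 n) (trans
    (sum-cong 0 (suc n) (λ k _ _ → cong (_* invFact (suc (n ∸ k))) (A-0 k)))
    (trans (b-expansion n) (δ0≡const n)))

  θ-expm1 : θ expm1 ≋ R.ι 1ℚ ⊕ X ⊛ expm1 ⊕ ⊖ expm1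
  θ-expm1 = mk λ
    { zero → refl
    ; (suc n) → begin
        nat (suc n) * invFact (2 ℕ.+ n)
          ≡⟨ solve 2 (λ s i → s :* i := con 0ℚ :+ (con 1ℚ :+ s) :* i :- i) refl (nat (suc n)) (invFact (2 ℕ.+ n)) ⟩
        0ℚ + (1ℚ + nat (suc n)) * invFact (2 ℕ.+ n) - invFact (2 ℕ.+ n)
          ≡⟨ cong (λ x → 0ℚ + x * invFact (2 ℕ.+ n) - invFact (2 ℕ.+ n)) (nat-suc (suc n)) ⟨
        0ℚ + nat (2 ℕ.+ n) * invFact (2 ℕ.+ n) - invFact (2 ℕ.+ n)
          ≡⟨ cong (λ x → 0ℚ + x - invFact (2 ℕ.+ n)) (trans (invFact-suc (suc n)) (sym (at (X-⊛ expm1) (suc n)))) ⟩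
        0ℚ + (X ⊛ expm1) (suc n) - invFact (2 ℕ.+ n) ∎ }
    where open ≡.≡-Reasoning

  θ-A : ∀ r → θ (A r) ≋ R.ι (nat (suc r)) ⊛ (A (suc r) ⊕ A r)
  θ-A r = mk λ n → trans (go n) (sym (const-⊛-at (nat (suc r)) (A (suc r) ⊕ A r) n))
    where
    open ≡.≡-Reasoning
    go : ∀ n → nat n * A r n ≡ nat (suc r) * (A (suc r) n + A r n)
    go zero    = solve 2 (λ x s → con 0ℚ :* x := s :* (:- x :+ x)) refl (sgn r) (nat (suc r))
    go (suc k) = begin
      nat (suc k) * (binom k r * b (suc k))
        ≡⟨ ℚ.*-assoc (nat (suc k)) (binom k r) (b (suc k)) ⟨
      nat (suc k) * binom k r * b (suc k)
        ≡⟨ cong (_* b (suc k)) (trans (binom-absorb k r) (cong (nat (suc r) *_) (binom-pascal k r))) ⟩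
      nat (suc r) * (binom k r + binom k (suc r)) * b (suc k)
        ≡⟨ solve 4 (λ s x y z → s :* (x :+ y) :* z := s :* (y :* z :+ x :* z)) refl
             (nat (suc r)) (binom k r) (binom k (suc r)) (b (suc k)) ⟩
      nat (suc r) * (binom k (suc r) * b (suc k) + binom k r * b (suc k)) ∎

  open ProductFormula expm1 A A₀-expm1 θ-expm1 θ-A using (S; S′; Φ; Φ-zero; β-⊛-S; β-⊛-A)

  sgn-b : ∀ n → sgn n * b n ≡ b n + X n
  sgn-b n = trans (cong (sgn n *_) (sym (A-0 n)))
    (trans (at (reflect-inverse A₀-expm1 θ-expm1) n) (cong (_+ X n) (A-0 n)))

  X-suc : ∀ r → X (suc r) ≡ δ0 r
  X-suc r = sym (δ0≡const r)

  b-parity : ∀ r → sgn r * b (suc r) + b (suc r) + δ0 r ≡ 0ℚ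
  b-parity r = begin
    sgn r * b (suc r) + b (suc r) + δ0 r
      ≡⟨ solve 3 (λ s x d → s :* x :+ x :+ d := (x :+ d) :- (:- s) :* x) refl (sgn r) (b (suc r)) (δ0 r) ⟩
    b (suc r) + δ0 r - sgn (suc r) * b (suc r)
      ≡⟨ cong (λ x → b (suc r) + δ0 r - x) (trans (sgn-b (suc r)) (cong (b (suc r) +_) (X-suc r))) ⟩
    b (suc r) + δ0 r - (b (suc r) + δ0 r)
      ≡⟨ ℚ.+-inverseʳ (b (suc r) + δ0 r) ⟩
    0ℚ ∎
    where open ≡.≡-Reasoning

  A-product : ∀ r s → Φ r s (suc (r ℕ.+ s)) ≋ 𝟎
  A-product r s = Φ-zero (λ _ → refl)
    (λ r k k<r → trans (cong (_* b (suc k)) (binom-vanish k<r)) (ℚ.*-zeroˡ (b (suc k))))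
    (λ r → trans (cong (_* b (suc r)) (binom-diag r)) (trans (ℚ.*-identityˡ (b (suc r))) (sym (A-0 (suc r)))))
    (λ r → trans (cong (λ x → sgn r * x + x + δ0 r) (A-0 (suc r))) (b-parity r))
    s r _ refl

  ⊛₂-sum : ∀ (F G : Series₂) m n → (F ⊛₂ G) m n ≡ sumFrom 0 (suc m) (λ k → (F k ⊛ G (m ∸ k)) n)
  ⊛₂-sum F G zero    n = sym (ℚ.+-identityʳ ((F 0 ⊛ G 0) n))
  ⊛₂-sum F G (suc m) n = cong ((F 0 ⊛ G (suc m)) n +_)
    (trans (⊛₂-sum (F ∘ suc) G m n) (sym (sum-suc 0 (suc m) (λ k → (F k ⊛ G (suc m ∸ k)) n))))

  hat-⊛₂-sum : ∀ c (G : Series₂) m n →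
               (hat c ⊛₂ G) m n ≡ sumFrom 0 (suc m) (λ k → c k * shift k (G (m ∸ k)) n)
  hat-⊛₂-sum c G m n = trans (⊛₂-sum (hat c) G m n)
    (sum-cong 0 (suc m) (λ k _ _ → monomial-⊛-at k (c k) (G (m ∸ k)) n))

  shift-A : ∀ r k n → k ≤ n → shift k (A r) (suc n) ≡ binom (n ∸ k) r * b (suc n ∸ k)
  shift-A r zero    n       _         = refl
  shift-A r (suc k) (suc n) (s≤s k≤n) = shift-A r k n k≤n

  shift-below : ∀ k f n → n < k → shift k f n ≡ 0ℚ
  shift-below (suc k) f zero    _         = refl
  shift-below (suc k) f (suc n) (s≤s n<k) = shift-below k f n n<k

  shift-above : ∀ k f n → k ≤ n → shift k f n ≡ f (n ∸ k)
  shift-above zero    f n       _         = refl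
  shift-above (suc k) f (suc n) (s≤s k≤n) = shift-above k f n k≤n

  -- Padding the convolution with zero terms gives it a length independent of `j`, as needed to
  -- exchange two summations.
  ⊛-shift : ∀ f g {j m} → j ≤ m → (f ⊛ g) j ≡ sumFrom 0 (suc m) (λ k → f k * shift k g j)
  ⊛-shift f g {j} {m} j≤m = begin
    (f ⊛ g) j
      ≡⟨ ⊛-sum f g j ⟩
    sumFrom 0 (suc j) (λ k → f k * g (j ∸ k))
      ≡⟨ sum-cong 0 (suc j) (λ k _ k<sj → cong (f k *_) (sym (shift-above k g j (ℕ.≤-pred k<sj)))) ⟩
    sumFrom 0 (suc j) h
      ≡⟨ ℚ.+-identityʳ _ ⟨
    sumFrom 0 (suc j) h + 0ℚ
      ≡⟨ cong (sumFrom 0 (suc j) h +_) (sum-zero (suc j) (m ∸ j) (λ k j<k _ → trans (cong (f k *_) (shift-below k g j j<k)) (ℚ.*-zeroʳ (f k)))) ⟨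
    sumFrom 0 (suc j) h + sumFrom (suc j) (m ∸ j) h
      ≡⟨ sum-split 0 (suc j) (m ∸ j) h ⟨
    sumFrom 0 (suc j ℕ.+ (m ∸ j)) h
      ≡⟨ cong (λ l → sumFrom 0 (suc l) h) (ℕ.m+[n∸m]≡n j≤m) ⟩
    sumFrom 0 (suc m) h ∎
    where
    open ≡.≡-Reasoning
    h = λ k → f k * shift k g j

  sgn-+ : ∀ m n → sgn (m ℕ.+ n) ≡ sgn m * sgn n
  sgn-+ zero    n = sym (ℚ.*-identityˡ (sgn n))
  sgn-+ (suc m) n = trans (cong -_ (sgn-+ m n)) (ℚ.neg-distribˡ-* (sgn m) (sgn n))

  x≡-x⇒x≡0 : ∀ {x} → x ≡ - x → x ≡ 0ℚ
  x≡-x⇒x≡0 {x} e = nat-suc-cancel 1 (trans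
    (solve 1 (λ x → con (nat 2) :* x := x :+ x) refl x)
    (trans (cong (x +_) e) (trans (ℚ.+-inverseʳ x) (sym (ℚ.*-zeroʳ (nat 2))))))

  X-≢1 : ∀ {k} → k ≢ 1 → X k ≡ 0ℚ
  X-≢1 {zero}        _   = refl
  X-≢1 {suc zero}    k≢1 = contradiction refl k≢1
  X-≢1 {suc (suc k)} _   = refl

  -- Away from index `1`, `b` is unchanged by the sign `(-1)^k`; an odd index sum therefore makes
  -- the product its own negative.
  b-b-odd : ∀ {k l} → k ≢ 1 → l ≢ 1 → sgn (k ℕ.+ l) ≡ - 1ℚ → b k * b l ≡ 0ℚ
  b-b-odd {k} {l} k≢1 l≢1 odd = x≡-x⇒x≡0 (begin
    b k * b l                       ≡⟨ cong₂ _*_ (even k≢1) (even l≢1) ⟨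
    sgn k * b k * (sgn l * b l)     ≡⟨ solve 4 (λ s t x y → s :* x :* (t :* y) := s :* t :* (x :* y)) refl (sgn k) (sgn l) (b k) (b l) ⟩
    sgn k * sgn l * (b k * b l)     ≡⟨ cong (_* (b k * b l)) (trans (sym (sgn-+ k l)) odd) ⟩
    - 1ℚ * (b k * b l)              ≡⟨ solve 1 (λ x → (:- con 1ℚ) :* x := :- x) refl (b k * b l) ⟩
    - (b k * b l)                   ∎)
    where
    open ≡.≡-Reasoning
    even : ∀ {k} → k ≢ 1 → sgn k * b k ≡ b k
    even {k} k≢1 = trans (sgn-b k) (trans (cong (b k +_) (X-≢1 k≢1)) (ℚ.+-identityʳ (b k)))

  -- The left-hand side as one coefficient of a triple product.

  A⁺ : ℕ → Series
  A⁺ r = A r ⊕ ⊖ const (sgn r)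

  A⁺-zero : ∀ r → A⁺ r 0 ≡ 0ℚ
  A⁺-zero r = ℚ.+-inverseʳ (sgn r)

  A⁺-suc : ∀ r k → A⁺ r (suc k) ≡ A r (suc k)
  A⁺-suc r k = ℚ.+-identityʳ (A r (suc k))

  -- Without its constant term, `A_r` has exactly the factors of the left-hand side as coefficients.
  A⁺-fallProd : ∀ r {i} → 1 ≤ i → A⁺ r i ≡ invFact r * fallProd i r * b i
  A⁺-fallProd r {suc i} _ = trans (A⁺-suc r i) (cong (_* b (suc i)) (sym (fallProd-binom i r)))

  A⁺₀-b : ∀ {k} → 1 ≤ k → A⁺ 0 k ≡ b k
  A⁺₀-b {suc k} _ = trans (A⁺-suc 0 k) (A-0 (suc k))

  ⊛-interior : ∀ f g M → f 0 ≡ 0ℚ → g 0 ≡ 0ℚ → (f ⊛ g) M ≡ sumFrom 1 (M ∸ 1) (λ j → f j * g (M ∸ j))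
  ⊛-interior f g zero    f0 g0 = trans (cong (_* g 0) f0) (ℚ.*-zeroˡ (g 0))
  ⊛-interior f g (suc m) f0 g0 = begin
    (f ⊛ g) (suc m)
      ≡⟨ ⊛-sum f g (suc m) ⟩
    f 0 * g (suc m) + sumFrom 1 (suc m) h
      ≡⟨ cong₂ _+_ (trans (cong (_* g (suc m)) f0) (ℚ.*-zeroˡ (g (suc m)))) (sum-last 1 m h) ⟩
    0ℚ + (sumFrom 1 m h + f (suc m) * g (m ∸ m))
      ≡⟨ cong (λ x → 0ℚ + (sumFrom 1 m h + x)) (trans (cong (λ x → f (suc m) * g x) (ℕ.n∸n≡0 m)) (trans (cong (f (suc m) *_) g0) (ℚ.*-zeroʳ (f (suc m))))) ⟩
    0ℚ + (sumFrom 1 m h + 0ℚ)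
      ≡⟨ solve 1 (λ x → con 0ℚ :+ (x :+ con 0ℚ) := x) refl (sumFrom 1 m h) ⟩
    sumFrom 1 m h ∎
    where
    open ≡.≡-Reasoning
    h = λ j → f j * g (suc m ∸ j)

  ∸-swap : ∀ n i j → n ∸ i ∸ j ≡ n ∸ j ∸ i
  ∸-swap n i j = trans (ℕ.∸-+-assoc n i j) (trans (cong (n ∸_) (ℕ.+-comm i j)) (sym (ℕ.∸-+-assoc n j i)))

  lhs-⊛ : ∀ r₁ r₂ n {M} → 2 ℕ.* n ≡ 2 ℕ.+ M → lhs r₁ r₂ n ≡ (A⁺ r₁ ⊛ (A⁺ r₂ ⊛ A⁺ 0)) (2 ℕ.* n)
  lhs-⊛ r₁ r₂ n {M} eq = trans (inner (2 ℕ.* n)) (trans (cong outer eq) (trans (outer-⊛ M) (cong (A⁺ r₁ ⊛ H) (sym eq))))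
    where
    open ≡.≡-Reasoning
    c = invFact r₁ * invFact r₂
    H = A⁺ r₂ ⊛ A⁺ 0

    H-zero : H 0 ≡ 0ℚ
    H-zero = trans (cong (_* A⁺ 0 0) (A⁺-zero r₂)) (ℚ.*-zeroˡ (A⁺ 0 0))

    -- `H` starts in degree 2, so `i = 2n - 1` contributes nothing; this reconciles the upper bound
    -- `2n - 2` with the full interior sum.
    H-one : H 1 ≡ 0ℚ
    H-one = ⊛-interior (A⁺ r₂) (A⁺ 0) 1 (A⁺-zero r₂) (A⁺-zero 0)

    outer : ℕ → ℚ
    outer N = sumFrom 1 (N ∸ 2) (λ i → A⁺ r₁ i * H (N ∸ i))

    outer-⊛ : ∀ M → outer (2 ℕ.+ M) ≡ (A⁺ r₁ ⊛ H) (2 ℕ.+ M)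
    outer-⊛ M = sym (begin
      (A⁺ r₁ ⊛ H) (2 ℕ.+ M)
        ≡⟨ ⊛-interior (A⁺ r₁) H (2 ℕ.+ M) (A⁺-zero r₁) H-zero ⟩
      sumFrom 1 (suc M) h
        ≡⟨ sum-last 1 M h ⟩
      sumFrom 1 M h + A⁺ r₁ (suc M) * H (suc M ∸ M)
        ≡⟨ cong (λ x → sumFrom 1 M h + A⁺ r₁ (suc M) * x) (trans (cong H (ℕ.m+n∸n≡m 1 M)) H-one) ⟩
      sumFrom 1 M h + A⁺ r₁ (suc M) * 0ℚ
        ≡⟨ solve 2 (λ x y → x :+ y :* con 0ℚ := x) refl (sumFrom 1 M h) (A⁺ r₁ (suc M)) ⟩
      sumFrom 1 M h ∎)
      where h = λ i → A⁺ r₁ i * H (2 ℕ.+ M ∸ i)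

    body : ℕ → ℕ → ℕ → ℚ
    body N i j = B i * B j * B (N ∸ i ∸ j) * invFact i * invFact j * invFact (N ∸ i ∸ j)
               * fallProd i r₁ * fallProd j r₂

    term : ∀ N i j → 1 ≤ i → 1 ≤ j → 1 ≤ N ∸ i ∸ j →
           c * body N i j ≡ A⁺ r₁ i * (A⁺ r₂ j * A⁺ 0 (N ∸ i ∸ j))
    term N i j 1≤i 1≤j 1≤k = begin
      c * body N i j
        ≡⟨ solve 10 (λ p q x y z u v w f g →
             p :* q :* (x :* y :* z :* u :* v :* w :* f :* g) :=
             p :* f :* (x :* u) :* (q :* g :* (y :* v) :* (z :* w))) refl
             (invFact r₁) (invFact r₂) (B i) (B j) (B (N ∸ i ∸ j))
             (invFact i) (invFact j) (invFact (N ∸ i ∸ j)) (fallProd i r₁) (fallProd j r₂) ⟩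
      invFact r₁ * fallProd i r₁ * b i * (invFact r₂ * fallProd j r₂ * b j * b (N ∸ i ∸ j))
        ≡⟨ cong₂ _*_ (A⁺-fallProd r₁ 1≤i) (cong₂ _*_ (A⁺-fallProd r₂ 1≤j) (A⁺₀-b 1≤k)) ⟨
      A⁺ r₁ i * (A⁺ r₂ j * A⁺ 0 (N ∸ i ∸ j)) ∎

    row : ∀ N i → 1 ≤ i → c * sumFrom 1 (N ∸ 1 ∸ i) (body N i) ≡ A⁺ r₁ i * H (N ∸ i)
    row N i 1≤i = begin
      c * sumFrom 1 (N ∸ 1 ∸ i) (body N i)
        ≡⟨ cong (λ l → c * sumFrom 1 l (body N i)) (∸-swap N 1 i) ⟩
      c * sumFrom 1 (N ∸ i ∸ 1) (body N i)
        ≡⟨ sum-*ˡ 1 (N ∸ i ∸ 1) c (body N i) ⟨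
      sumFrom 1 (N ∸ i ∸ 1) (λ j → c * body N i j)
        ≡⟨ sum-cong 1 (N ∸ i ∸ 1) (λ j 1≤j j< → term N i j 1≤i 1≤j (ℕ.m<n⇒0<n∸m (bound (N ∸ i) j 1≤j j<))) ⟩
      sumFrom 1 (N ∸ i ∸ 1) (λ j → A⁺ r₁ i * (A⁺ r₂ j * A⁺ 0 (N ∸ i ∸ j)))
        ≡⟨ sum-*ˡ 1 (N ∸ i ∸ 1) (A⁺ r₁ i) (λ j → A⁺ r₂ j * A⁺ 0 (N ∸ i ∸ j)) ⟩
      A⁺ r₁ i * sumFrom 1 (N ∸ i ∸ 1) (λ j → A⁺ r₂ j * A⁺ 0 (N ∸ i ∸ j))
        ≡⟨ cong (A⁺ r₁ i *_) (⊛-interior (A⁺ r₂) (A⁺ 0) (N ∸ i) (A⁺-zero r₂) (A⁺-zero 0)) ⟨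
      A⁺ r₁ i * H (N ∸ i) ∎
      where
      bound : ∀ K j → 1 ≤ j → j < 1 ℕ.+ (K ∸ 1) → j < K
      bound zero    (suc j) _ (s≤s ())
      bound (suc K) j       _ j<K = j<K

    inner : ∀ N → c * sumFrom 1 (N ∸ 2) (λ i → sumFrom 1 (N ∸ 1 ∸ i) (body N i)) ≡ outer N
    inner N = trans (sym (sum-*ˡ 1 (N ∸ 2) c (λ i → sumFrom 1 (N ∸ 1 ∸ i) (body N i))))
      (sum-cong 1 (N ∸ 2) (λ i 1≤i _ → row N i 1≤i))

  -- Coefficients of S and S′ and the single sums on the right.

  β : Series
  β = A 0

  S-at : ∀ c m n → S c m n ≡ sumFrom 0 (suc m) (λ k → c k * shift k (A (m ∸ k)) n)
  S-at c m n = hat-⊛₂-sum c A m n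

  S′-at : ∀ c m n → S′ c m n ≡ sumFrom 0 (suc m) (λ k → c k * shift k (A (suc m ∸ k)) n)
  S′-at c m n = trans (hat-⊛₂-sum c (A ∘ suc) m n)
    (sum-cong 0 (suc m) (λ k _ k< → cong (λ l → c k * shift k (A l) n) (sym (ℕ.+-∸-assoc 1 (ℕ.≤-pred k<)))))

  sum-single : ∀ l f {j} → j < l → (∀ k → k ≢ j → k < l → f k ≡ 0ℚ) → sumFrom 0 l f ≡ f j
  sum-single (suc l) f {zero}  _         z = trans
    (cong (f 0 +_) (sum-zero 1 l (λ { (suc k) _ k< → z (suc k) (λ ()) k< })))
    (ℚ.+-identityʳ (f 0))
  sum-single (suc l) f {suc j} (s≤s j<l) z = trans
    (cong₂ _+_ (z 0 (λ ()) (s≤s z≤n)) (trans (sum-suc 0 l f)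
      (sum-single l (f ∘ suc) j<l (λ k k≢j k<l → z (suc k) (k≢j ∘ ℕ.suc-injective) (s≤s k<l)))))
    (ℚ.+-identityˡ (f (suc j)))

  Σ-from-one : ∀ a c f → a ≤ c → (∀ k → 1 ≤ k → k ≤ a → f k ≡ 0ℚ) → Σ[ suc a ⋯ c ] f ≡ sumFrom 1 c f
  Σ-from-one a c f a≤c z = sym (begin
    sumFrom 1 c f                                ≡⟨ cong (λ l → sumFrom 1 l f) (ℕ.m+[n∸m]≡n a≤c) ⟨
    sumFrom 1 (a ℕ.+ (c ∸ a)) f                  ≡⟨ sum-split 1 a (c ∸ a) f ⟩
    sumFrom 1 a f + sumFrom (suc a) (c ∸ a) f    ≡⟨ cong (_+ sumFrom (suc a) (c ∸ a) f) (sum-zero 1 a (λ k 1≤k k< → z k 1≤k (ℕ.≤-pred k<))) ⟩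
    0ℚ + sumFrom (suc a) (c ∸ a) f               ≡⟨ ℚ.+-identityˡ _ ⟩
    sumFrom (suc a) (c ∸ a) f                    ∎)
    where open ≡.≡-Reasoning

  -- In degree `j`, the term `t^k A_(r+1-k)` vanishes for `k > j`, and also for `k < j` because
  -- `A_p` has no coefficients in degrees `1` to `p`. The term `k = j` contributes the constant
  -- `(-1)^(r+1-j)`.
  S′-β-low : ∀ r j → j ≤ r → S′ β r j ≡ - (sgn r * (sgn j * b j))
  S′-β-low r j j≤r = trans (S′-at β r j) (trans (sum-single (suc r) (λ k → β k * shift k (A (suc r ∸ k)) j) (s≤s j≤r) off) diag)
    where
    open ≡.≡-Reasoning
    off : ∀ k → k ≢ j → k < suc r → β k * shift k (A (suc r ∸ k)) j ≡ 0ℚ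
    off k k≢j (s≤s k≤r) = trans (cong (β k *_) (vanish (ℕ.<-cmp k j))) (ℚ.*-zeroʳ (β k))
      where
      vanish : Tri (k < j) (k ≡ j) (j < k) → shift k (A (suc r ∸ k)) j ≡ 0ℚ
      vanish (tri< k<j _ _) = low j k<j j≤r
        where
        low : ∀ j → k < j → j ≤ r → shift k (A (suc r ∸ k)) j ≡ 0ℚ
        low (suc j) (s≤s k≤j) j<r = trans (shift-A (suc r ∸ k) k j k≤j)
          (trans (cong (_* b (suc j ∸ k)) (binom-vanish (ℕ.∸-monoˡ-< (ℕ.m<n⇒m<1+n j<r) k≤j))) (ℚ.*-zeroˡ (b (suc j ∸ k))))
      vanish (tri≈ _ k≡j _) = contradiction k≡j k≢j
      vanish (tri> _ _ j<k) = shift-below k (A (suc r ∸ k)) j j<k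
    diag : β j * shift j (A (suc r ∸ j)) j ≡ - (sgn r * (sgn j * b j))
    diag = begin
      β j * shift j (A (suc r ∸ j)) j
        ≡⟨ cong₂ _*_ (A-0 j) (trans (shift-above j (A (suc r ∸ j)) j ℕ.≤-refl) (trans (cong (A (suc r ∸ j)) (ℕ.n∸n≡0 j)) (cong sgn (ℕ.+-∸-assoc 1 j≤r)))) ⟩
      b j * - sgn (r ∸ j)
        ≡⟨ solve 2 (λ x y → x :* (:- y) := :- (con 1ℚ :* (y :* x))) refl (b j) (sgn (r ∸ j)) ⟩
      - (1ℚ * (sgn (r ∸ j) * b j))
        ≡⟨ cong (λ x → - (x * (sgn (r ∸ j) * b j))) (sgn-square j) ⟨
      - (sgn j * sgn j * (sgn (r ∸ j) * b j))
        ≡⟨ solve 3 (λ x y z → :- (x :* x :* (y :* z)) := :- (x :* y :* (x :* z))) refl (sgn j) (sgn (r ∸ j)) (b j) ⟩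
      - (sgn j * sgn (r ∸ j) * (sgn j * b j))
        ≡⟨ cong (λ x → - (x * (sgn j * b j))) (trans (sym (sgn-+ j (r ∸ j))) (cong sgn (ℕ.m+[n∸m]≡n j≤r))) ⟩
      - (sgn r * (sgn j * b j)) ∎

  -- For `k ≤ r` the degree `r + 1 - k` still falls in the gap of `A_(r+1-k)`; the term `k = r + 1`,
  -- which would reach the constant, is cut off in `S′`.
  S′-β-next : ∀ r → S′ β r (suc r) ≡ 0ℚ
  S′-β-next r = trans (S′-at β r (suc r)) (sum-zero 0 (suc r) (λ k _ k< → vanish k (ℕ.≤-pred k<)))
    where
    vanish : ∀ k → k ≤ r → β k * shift k (A (suc r ∸ k)) (suc r) ≡ 0ℚ
    vanish k k≤r = trans (cong (β k *_) (trans (shift-A (suc r ∸ k) k r k≤r)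
        (trans (cong (_* b (suc r ∸ k)) (binom-vanish (ℕ.∸-monoˡ-< ℕ.≤-refl k≤r))) (ℚ.*-zeroˡ (b (suc r ∸ k))))))
      (ℚ.*-zeroʳ (β k))

  module Evaluation (N′ : ℕ) where
    private
      N : ℕ
      N = suc N′

    binom-b : ∀ p {k} → k ≤ N′ → binom (N′ ∸ k) p * b (N ∸ k) ≡ shift k (A p) N
    binom-b p k≤ = sym (shift-A p _ N′ k≤)

    -- The subtracted product is the term `k = 0` of `S`. The terms `1 ≤ k ≤ s₁` vanish, which
    -- accounts for the lower limit.
    diagonal-term : ∀ s₁ s₂ → suc (s₁ ℕ.+ s₂) ≤ N′ →
      Σ[ s₁ ℕ.+ 1 ⋯ s₁ ℕ.+ s₂ ℕ.+ 1 ] (λ k →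
        binom (k ∸ 1) s₁ * binom (N ∸ k ∸ 1) (s₂ ℕ.+ s₁ ℕ.+ 1 ∸ k) * b k * b (N ∸ k))
      ≡ S (A s₁) (suc (s₁ ℕ.+ s₂)) N - sgn s₁ * A (suc (s₁ ℕ.+ s₂)) N
    diagonal-term s₁ s₂ m≤N′ = diagonal-term′ (ℕ.+-comm s₁ 1) (ℕ.+-comm (s₁ ℕ.+ s₂) 1)
        (trans (ℕ.+-comm (s₂ ℕ.+ s₁) 1) (cong suc (ℕ.+-comm s₂ s₁)))
      where
      open ≡.≡-Reasoning
      m = suc (s₁ ℕ.+ s₂)
      f g : ℕ → ℚ
      f k = binom (k ∸ 1) s₁ * binom (N ∸ k ∸ 1) (m ∸ k) * b k * b (N ∸ k)
      g k = A s₁ k * shift k (A (m ∸ k)) N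
      low : ∀ k → 1 ≤ k → k ≤ s₁ → f k ≡ 0ℚ
      low (suc k) _ k<s = trans (cong (λ x → x * binom (N ∸ suc k ∸ 1) (m ∸ suc k) * b (suc k) * b (N ∸ suc k)) (binom-vanish k<s))
        (solve 3 (λ x y z → con 0ℚ :* x :* y :* z := con 0ℚ) refl (binom (N ∸ suc k ∸ 1) (m ∸ suc k)) (b (suc k)) (b (N ∸ suc k)))
      term : ∀ k → suc k ≤ m → f (suc k) ≡ g (suc k)
      term k k<m = begin
        binom k s₁ * binom (N ∸ suc k ∸ 1) (m ∸ suc k) * b (suc k) * b (N ∸ suc k)
          ≡⟨ cong (λ l → binom k s₁ * binom l (m ∸ suc k) * b (suc k) * b (N ∸ suc k)) (∸-swap N (suc k) 1) ⟩
        binom k s₁ * binom (N′ ∸ suc k) (m ∸ suc k) * b (suc k) * b (N ∸ suc k)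
          ≡⟨ solve 4 (λ x y z w → x :* y :* z :* w := x :* z :* (y :* w)) refl (binom k s₁) (binom (N′ ∸ suc k) (m ∸ suc k)) (b (suc k)) (b (N ∸ suc k)) ⟩
        A s₁ (suc k) * (binom (N′ ∸ suc k) (m ∸ suc k) * b (N ∸ suc k))
          ≡⟨ cong (A s₁ (suc k) *_) (binom-b (m ∸ suc k) (ℕ.≤-trans k<m m≤N′)) ⟩
        g (suc k) ∎
      diagonal-term′ : ∀ {a c d} → a ≡ suc s₁ → c ≡ m → d ≡ m →
        Σ[ a ⋯ c ] (λ k → binom (k ∸ 1) s₁ * binom (N ∸ k ∸ 1) (d ∸ k) * b k * b (N ∸ k))
        ≡ S (A s₁) m N - sgn s₁ * A m N
      diagonal-term′ refl refl refl = begin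
        Σ[ suc s₁ ⋯ m ] f
          ≡⟨ Σ-from-one s₁ m f (ℕ.m≤n⇒m≤1+n (ℕ.m≤m+n s₁ s₂)) low ⟩
        sumFrom 1 m f
          ≡⟨ sum-cong 1 m {f} {g} (λ { (suc k) _ k< → term k (ℕ.≤-pred k<) }) ⟩
        sumFrom 1 m g
          ≡⟨ solve 2 (λ x y → y := (x :+ y) :- x) refl (sgn s₁ * A m N) (sumFrom 1 m g) ⟩
        sgn s₁ * A m N + sumFrom 1 m g - sgn s₁ * A m N
          ≡⟨ cong (_- sgn s₁ * A m N) (S-at (A s₁) m N) ⟨
        S (A s₁) m N - sgn s₁ * A m N ∎

    -- `S′` contains a term `k = 0`, namely `A (suc s)`, that the sum lacks; it lacks the term
    -- `k = s + 1`, whose binomial is `1`.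
    edge-term : ∀ s → suc s ≤ N′ →
      Σ[ 1 ⋯ s ℕ.+ 1 ] (λ k → binom (N ∸ 1 ∸ k) (s ℕ.+ 1 ∸ k) * b k * b (N ∸ k))
      ≡ S′ β s N - A (suc s) N + b (suc s) * b (N ∸ suc s)
    edge-term s s<N′ = edge-term′ (ℕ.+-comm s 1)
      where
      open ≡.≡-Reasoning
      bb = b (suc s) * b (N ∸ suc s)
      f g : ℕ → ℚ
      f k = binom (N′ ∸ k) (suc s ∸ k) * b k * b (N ∸ k)
      g k = β k * shift k (A (suc s ∸ k)) N
      term : ∀ k → k ≤ s → f k ≡ g k
      term k k≤s = trans
        (solve 3 (λ x y z → x :* y :* z := y :* (x :* z)) refl (binom (N′ ∸ k) (suc s ∸ k)) (b k) (b (N ∸ k)))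
        (cong₂ _*_ (sym (A-0 k)) (binom-b (suc s ∸ k) (ℕ.≤-trans (ℕ.m≤n⇒m≤1+n k≤s) s<N′)))
      last : f (suc s) ≡ bb
      last = trans (cong (λ x → x * b (suc s) * b (N ∸ suc s)) (trans (cong (binom (N′ ∸ suc s)) (ℕ.n∸n≡0 s)) (binom-zero (N′ ∸ suc s))))
        (cong (_* b (N ∸ suc s)) (ℚ.*-identityˡ (b (suc s))))
      edge-term′ : ∀ {c} → c ≡ suc s →
        Σ[ 1 ⋯ c ] (λ k → binom (N ∸ 1 ∸ k) (c ∸ k) * b k * b (N ∸ k)) ≡ S′ β s N - A (suc s) N + bb
      edge-term′ refl = begin
        sumFrom 1 (suc s) f
          ≡⟨ sum-last 1 s f ⟩
        sumFrom 1 s f + f (suc s)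
          ≡⟨ cong₂ _+_ (sum-cong 1 s {f} {g} (λ k _ k< → term k (ℕ.≤-pred k<))) last ⟩
        sumFrom 1 s g + bb
          ≡⟨ solve 3 (λ x y z → x :+ z := con 1ℚ :* y :+ x :- y :+ z) refl (sumFrom 1 s g) (A (suc s) N) bb ⟩
        1ℚ * A (suc s) N + sumFrom 1 s g - A (suc s) N + bb
          ≡⟨ cong (λ x → x - A (suc s) N + bb) (S′-at β s N) ⟨
        S′ β s N - A (suc s) N + bb ∎

  A⁺-low : ∀ r {i} → i ≤ r → A⁺ r i ≡ 0ℚ
  A⁺-low r {zero}  _   = A⁺-zero r
  A⁺-low r {suc i} i<r = trans (A⁺-suc r i) (trans (cong (_* b (suc i)) (binom-vanish i<r)) (ℚ.*-zeroˡ (b (suc i))))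

  shift-A⁺-low : ∀ r k j → j < r ℕ.+ 1 ℕ.+ k → shift k (A⁺ r) j ≡ 0ℚ
  shift-A⁺-low r k j j< with ℕ.<-≤-connex j k
  ... | inj₁ j<k = shift-below k (A⁺ r) j j<k
  ... | inj₂ k≤j = trans (shift-above k (A⁺ r) j k≤j) (A⁺-low r (ℕ.≤-pred (ℕ.m<n+o⇒m∸n<o j k (≡.subst (j <_) eq j<))))
    where
    eq : r ℕ.+ 1 ℕ.+ k ≡ k ℕ.+ suc r
    eq = trans (ℕ.+-comm (r ℕ.+ 1) k) (cong (k ℕ.+_) (ℕ.+-comm r 1))

  shift-A⁺ : ∀ r k j → k < j → shift k (A⁺ r) j ≡ binom (j ∸ 1 ∸ k) r * b (j ∸ k)
  shift-A⁺ r k (suc j) (s≤s k≤j) = trans (shift-above k (A⁺ r) (suc j) (ℕ.m≤n⇒m≤1+n k≤j))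
    (trans (cong (A⁺ r) (ℕ.+-∸-assoc 1 k≤j)) (trans (A⁺-suc r (j ∸ k))
      (cong (λ i → binom (j ∸ k) r * b i) (sym (ℕ.+-∸-assoc 1 k≤j)))))

  -- Weighted sums and the double sums.

  module Weights (r₁ r₂ N′ : ℕ) (small : 3 ℕ.+ (r₁ ℕ.+ r₂) ≤ N′) where
    private
      N m : ℕ
      N = suc N′
      m = suc (r₁ ℕ.+ r₂)

    -- For `k ≤ m + 1` this is `binom (N - 1 - k) (r₁ + r₂ + 2 - k)` times `b (N - k)`, the factor
    -- common to the last three sums of the right-hand side.
    W : ℕ → ℚ
    W k = shift k (A (suc m ∸ k)) N

    L : Series → ℚ
    L c = sumFrom 0 (suc m) (λ k → c k * W k)

    S′-L : ∀ c → S′ c m N ≡ L c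
    S′-L c = S′-at c m N

    -- Degree `N - 1` shifts the weights by one: `t^k A_(m-k)` there equals
    -- `t^(k+1) A_((m+1)-(k+1))` in degree `N`.
    S-W : ∀ c → S c m N′ ≡ sumFrom 0 (suc m) (λ k → c k * W (suc k))
    S-W c = S-at c m N′

    L-cong : ∀ {c d} → (∀ k → c k ≡ d k) → L c ≡ L d
    L-cong {c} {d} p = sum-cong 0 (suc m) {λ k → c k * W k} {λ k → d k * W k} (λ k _ _ → cong (_* W k) (p k))

    L-+ : ∀ c d → L (c ⊕ d) ≡ L c + L d
    L-+ c d = trans (sum-cong 0 (suc m) {λ k → (c k + d k) * W k} {λ k → c k * W k + d k * W k} (λ k _ _ → ℚ.*-distribʳ-+ (W k) (c k) (d k)))
      (sum-+ 0 (suc m) (λ k → c k * W k) (λ k → d k * W k))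

    L-• : ∀ p c → L (p • c) ≡ p * L c
    L-• p c = trans (sum-cong 0 (suc m) {λ k → p * c k * W k} {λ k → p * (c k * W k)} (λ k _ _ → ℚ.*-assoc p (c k) (W k)))
      (sum-*ˡ 0 (suc m) p (λ k → c k * W k))

    binom-W : ∀ {k} → k ≤ suc m → binom (N′ ∸ k) (suc m ∸ k) * b (N ∸ k) ≡ W k
    binom-W {k} k≤ = sym (shift-A (suc m ∸ k) k N′ (ℕ.≤-trans k≤ (ℕ.<⇒≤ small)))

    private
      suc-m : r₁ ℕ.+ r₂ ℕ.+ 2 ≡ suc m
      suc-m = ℕ.+-comm (r₁ ℕ.+ r₂) 2

    single-sum :
      Σ[ 1 ⋯ r₂ ] (λ k → sgn k * binom (N ∸ 1 ∸ k) (r₁ ℕ.+ r₂ ℕ.+ 2 ∸ k) * b k * b (N ∸ k))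
      ≡ sumFrom 1 r₂ (λ k → sgn k * b k * W k)
    single-sum = aux suc-m
      where
      aux : ∀ {d} → d ≡ suc m →
        sumFrom 1 r₂ (λ k → sgn k * binom (N ∸ 1 ∸ k) (d ∸ k) * b k * b (N ∸ k)) ≡ sumFrom 1 r₂ (λ k → sgn k * b k * W k)
      aux refl = sum-cong 1 r₂ {λ k → sgn k * binom (N ∸ 1 ∸ k) (suc m ∸ k) * b k * b (N ∸ k)} {λ k → sgn k * b k * W k}
        (λ k _ k< → trans
          (solve 4 (λ s x y z → s :* x :* y :* z := s :* y :* (x :* z)) refl (sgn k) (binom (N′ ∸ k) (suc m ∸ k)) (b k) (b (N ∸ k)))
          (cong (sgn k * b k *_) (binom-W (ℕ.≤-trans (ℕ.<⇒≤ k<) (s≤s (ℕ.m≤n⇒m≤1+n (ℕ.m≤n+m r₂ r₁)))))))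

    -- With `j` outermost, the inner sum over `k` is the coefficient of `t^j` in `S′ β r₂`.
    double-sum₁ :
      Σ[ 0 ⋯ r₂ ] (λ k → Σ[ r₂ ℕ.+ 2 ⋯ r₁ ℕ.+ r₂ ℕ.+ 1 ] (λ j →
        sgn r₂ * binom (j ∸ 1 ∸ k) (r₂ ℕ.+ 1 ∸ k) * binom (N ∸ 1 ∸ j) (r₁ ℕ.+ r₂ ℕ.+ 2 ∸ j)
          * b k * b (j ∸ k) * b (N ∸ j)))
      ≡ sgn r₂ * sumFrom (2 ℕ.+ r₂) r₁ (λ j → S′ β r₂ j * W j)
    double-sum₁ = aux (ℕ.+-comm r₂ 2) (ℕ.+-comm (r₁ ℕ.+ r₂) 1) (ℕ.+-comm r₂ 1) suc-m
      where
      open ≡.≡-Reasoning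
      f : ℕ → ℕ → ℚ
      f k j = sgn r₂ * binom (j ∸ 1 ∸ k) (suc r₂ ∸ k) * binom (N ∸ 1 ∸ j) (suc m ∸ j) * b k * b (j ∸ k) * b (N ∸ j)
      g : ℕ → ℕ → ℚ
      g j k = sgn r₂ * W j * (β k * shift k (A (suc r₂ ∸ k)) j)
      term : ∀ j k → k ≤ r₂ → 2 ℕ.+ r₂ ≤ j → j ≤ suc m → f k j ≡ g j k
      term (suc j) k k≤r₂ (s≤s r₂<j) j≤ = trans
        (solve 6 (λ s x y u v w → s :* x :* y :* u :* v :* w := s :* (y :* w) :* (u :* (x :* v))) refl
          (sgn r₂) (binom (j ∸ k) (suc r₂ ∸ k)) (binom (N′ ∸ suc j) (suc m ∸ suc j)) (b k) (b (suc j ∸ k)) (b (N ∸ suc j)))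
        (cong₂ (λ x y → sgn r₂ * x * y) (binom-W j≤)
          (cong₂ _*_ (sym (A-0 k)) (sym (shift-A (suc r₂ ∸ k) k j (ℕ.≤-trans k≤r₂ (ℕ.<⇒≤ r₂<j))))))
      column : ∀ j → 2 ℕ.+ r₂ ≤ j → j ≤ suc m →
               sumFrom 0 (suc r₂) (λ k → f k j) ≡ sgn r₂ * (S′ β r₂ j * W j)
      column j lo hi = begin
        sumFrom 0 (suc r₂) (λ k → f k j)
          ≡⟨ sum-cong 0 (suc r₂) {λ k → f k j} {g j} (λ k _ k< → term j k (ℕ.≤-pred k<) lo hi) ⟩
        sumFrom 0 (suc r₂) (g j)
          ≡⟨ sum-*ˡ 0 (suc r₂) (sgn r₂ * W j) (λ k → β k * shift k (A (suc r₂ ∸ k)) j) ⟩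
        sgn r₂ * W j * sumFrom 0 (suc r₂) (λ k → β k * shift k (A (suc r₂ ∸ k)) j)
          ≡⟨ cong (sgn r₂ * W j *_) (S′-at β r₂ j) ⟨
        sgn r₂ * W j * S′ β r₂ j
          ≡⟨ solve 3 (λ s w x → s :* w :* x := s :* (x :* w)) refl (sgn r₂) (W j) (S′ β r₂ j) ⟩
        sgn r₂ * (S′ β r₂ j * W j) ∎
      aux : ∀ {a c d e} → a ≡ 2 ℕ.+ r₂ → c ≡ m → d ≡ suc r₂ → e ≡ suc m →
        Σ[ 0 ⋯ r₂ ] (λ k → Σ[ a ⋯ c ] (λ j →
          sgn r₂ * binom (j ∸ 1 ∸ k) (d ∸ k) * binom (N ∸ 1 ∸ j) (e ∸ j) * b k * b (j ∸ k) * b (N ∸ j)))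
        ≡ sgn r₂ * sumFrom (2 ℕ.+ r₂) r₁ (λ j → S′ β r₂ j * W j)
      aux refl refl refl refl = begin
        sumFrom 0 (suc r₂) (λ k → sumFrom (2 ℕ.+ r₂) (r₁ ℕ.+ r₂ ∸ r₂) (f k))
          ≡⟨ sum-swap 0 (suc r₂) (2 ℕ.+ r₂) (r₁ ℕ.+ r₂ ∸ r₂) f ⟩
        sumFrom (2 ℕ.+ r₂) (r₁ ℕ.+ r₂ ∸ r₂) (λ j → sumFrom 0 (suc r₂) (λ k → f k j))
          ≡⟨ cong (λ l → sumFrom (2 ℕ.+ r₂) l (λ j → sumFrom 0 (suc r₂) (λ k → f k j))) (ℕ.m+n∸n≡m r₁ r₂) ⟩
        sumFrom (2 ℕ.+ r₂) r₁ (λ j → sumFrom 0 (suc r₂) (λ k → f k j))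
          ≡⟨ sum-cong (2 ℕ.+ r₂) r₁ {λ j → sumFrom 0 (suc r₂) (λ k → f k j)} {λ j → sgn r₂ * (S′ β r₂ j * W j)}
               (λ j lo hi → column j lo (ℕ.<⇒≤ (≡.subst (λ x → j < suc (suc x)) (ℕ.+-comm r₂ r₁) hi))) ⟩
        sumFrom (2 ℕ.+ r₂) r₁ (λ j → sgn r₂ * (S′ β r₂ j * W j))
          ≡⟨ sum-*ˡ (2 ℕ.+ r₂) r₁ (sgn r₂) (λ j → S′ β r₂ j * W j) ⟩
        sgn r₂ * sumFrom (2 ℕ.+ r₂) r₁ (λ j → S′ β r₂ j * W j) ∎

    -- The rows j ≤ r₂ + 1 missing from the double sum add up to the single sum.
    L-S′β : sumFrom 1 r₂ (λ k → sgn k * b k * W k) - sgn r₂ * sumFrom (2 ℕ.+ r₂) r₁ (λ j → S′ β r₂ j * W j)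
            ≡ - (sgn r₂ * L (S′ β r₂)) - W 0
    L-S′β = begin
      Q - σ * H
        ≡⟨ solve 4 (λ q s h w → q :- s :* h := :- (s :* ((:- (s :* (w :+ q))) :+ h)) :- w :+ (con 1ℚ :- s :* s) :* (w :+ q)) refl
             Q σ H (W 0) ⟩
      - (σ * (- (σ * (W 0 + Q)) + H)) - W 0 + (1ℚ - σ * σ) * (W 0 + Q)
        ≡⟨ cong (λ x → - (σ * (- (σ * (W 0 + Q)) + H)) - W 0 + (1ℚ - x) * (W 0 + Q)) (sgn-square r₂) ⟩
      - (σ * (- (σ * (W 0 + Q)) + H)) - W 0 + (1ℚ - 1ℚ) * (W 0 + Q)
        ≡⟨ solve 2 (λ x y → x :+ (con 1ℚ :- con 1ℚ) :* y := x) refl (- (σ * (- (σ * (W 0 + Q)) + H)) - W 0) (W 0 + Q) ⟩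
      - (σ * (- (σ * (W 0 + Q)) + H)) - W 0
        ≡⟨ cong (λ x → - (σ * (x + H)) - W 0) low ⟨
      - (σ * (sumFrom 0 (2 ℕ.+ r₂) h + H)) - W 0
        ≡⟨ cong (λ x → - (σ * x) - W 0) (sum-split 0 (2 ℕ.+ r₂) r₁ h) ⟨
      - (σ * sumFrom 0 (2 ℕ.+ r₂ ℕ.+ r₁) h) - W 0
        ≡⟨ cong (λ l → - (σ * sumFrom 0 (2 ℕ.+ l) h) - W 0) (ℕ.+-comm r₂ r₁) ⟩
      - (σ * L (S′ β r₂)) - W 0 ∎
      where
      open ≡.≡-Reasoning
      σ = sgn r₂
      q h : ℕ → ℚ
      q k = sgn k * b k * W k
      h j = S′ β r₂ j * W j
      Q = sumFrom 1 r₂ q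
      H = sumFrom (2 ℕ.+ r₂) r₁ h
      low : sumFrom 0 (2 ℕ.+ r₂) h ≡ - (σ * (W 0 + Q))
      low = begin
        sumFrom 0 (2 ℕ.+ r₂) h
          ≡⟨ sum-last 0 (suc r₂) h ⟩
        sumFrom 0 (suc r₂) h + S′ β r₂ (suc r₂) * W (suc r₂)
          ≡⟨ cong₂ _+_ (sum-cong 0 (suc r₂) {h} {λ k → - σ * q k} (λ k _ k< →
               trans (cong (_* W k) (S′-β-low r₂ k (ℕ.≤-pred k<)))
                 (solve 4 (λ s t x w → (:- (s :* (t :* x))) :* w := (:- s) :* (t :* x :* w)) refl σ (sgn k) (b k) (W k))))
               (trans (cong (_* W (suc r₂)) (S′-β-next r₂)) (ℚ.*-zeroˡ (W (suc r₂)))) ⟩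
        sumFrom 0 (suc r₂) (λ k → - σ * q k) + 0ℚ
          ≡⟨ cong (_+ 0ℚ) (sum-*ˡ 0 (suc r₂) (- σ) q) ⟩
        - σ * (1ℚ * 1ℚ * W 0 + Q) + 0ℚ
          ≡⟨ solve 3 (λ s w q → (:- s) :* (con 1ℚ :* con 1ℚ :* w :+ q) :+ con 0ℚ := :- (s :* (w :+ q))) refl σ (W 0) Q ⟩
        - (σ * (W 0 + Q)) ∎

    -- The limits are those of nonvanishing terms: `A⁺ r₁` starts in degree `r₁ + 1`, so
    -- `j < r₁ + 1 + k` gives zero, and `k > r₂` leaves no `j ≤ m`. The sum thus extends to a full
    -- square, where exchanging `k` and `j` produces a convolution.
    double-sum₂ :
      Σ[ 0 ⋯ r₂ ] (λ k → Σ[ r₁ ℕ.+ 1 ℕ.+ k ⋯ r₁ ℕ.+ r₂ ℕ.+ 1 ] (λ j →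
        sgn (r₁ ℕ.+ k) * binom (j ∸ 1 ∸ k) r₁ * binom (N ∸ 1 ∸ j) (r₁ ℕ.+ r₂ ℕ.+ 2 ∸ j)
          * b k * b (j ∸ k) * b (N ∸ j)))
      ≡ sgn r₁ * L (reflect b ⊛ A⁺ r₁)
    double-sum₂ = aux (ℕ.+-comm (r₁ ℕ.+ r₂) 1) suc-m
      where
      open ≡.≡-Reasoning
      f T : ℕ → ℕ → ℚ
      f k j = sgn (r₁ ℕ.+ k) * binom (j ∸ 1 ∸ k) r₁ * binom (N ∸ 1 ∸ j) (suc m ∸ j) * b k * b (j ∸ k) * b (N ∸ j)
      T k j = sgn r₁ * W j * (sgn k * b k * shift k (A⁺ r₁) j)
      T-low : ∀ k j → j < r₁ ℕ.+ 1 ℕ.+ k → T k j ≡ 0ℚ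
      T-low k j j< = trans (cong (λ x → sgn r₁ * W j * (sgn k * b k * x)) (shift-A⁺-low r₁ k j j<))
        (solve 2 (λ x y → x :* (y :* con 0ℚ) := con 0ℚ) refl (sgn r₁ * W j) (sgn k * b k))
      k<start : ∀ k → k < r₁ ℕ.+ 1 ℕ.+ k
      k<start k = ℕ.m<n+m k (≡.subst (0 <_) (ℕ.+-comm 1 r₁) (s≤s z≤n))
      term : ∀ k j → r₁ ℕ.+ 1 ℕ.+ k ≤ j → j ≤ suc m → f k j ≡ T k j
      term k j lo hi = begin
        f k j
          ≡⟨ cong (λ x → x * binom (j ∸ 1 ∸ k) r₁ * binom (N ∸ 1 ∸ j) (suc m ∸ j) * b k * b (j ∸ k) * b (N ∸ j)) (sgn-+ r₁ k) ⟩
        sgn r₁ * sgn k * binom (j ∸ 1 ∸ k) r₁ * binom (N′ ∸ j) (suc m ∸ j) * b k * b (j ∸ k) * b (N ∸ j)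
          ≡⟨ solve 7 (λ s t x y u v w → s :* t :* x :* y :* u :* v :* w := s :* (y :* w) :* (t :* u :* (x :* v))) refl
               (sgn r₁) (sgn k) (binom (j ∸ 1 ∸ k) r₁) (binom (N′ ∸ j) (suc m ∸ j)) (b k) (b (j ∸ k)) (b (N ∸ j)) ⟩
        sgn r₁ * (binom (N′ ∸ j) (suc m ∸ j) * b (N ∸ j)) * (sgn k * b k * (binom (j ∸ 1 ∸ k) r₁ * b (j ∸ k)))
          ≡⟨ cong₂ (λ x y → sgn r₁ * x * (sgn k * b k * y)) (binom-W hi) (sym (shift-A⁺ r₁ k j (ℕ.<-≤-trans (k<start k) lo))) ⟩
        T k j ∎
      row : ∀ k → k ≤ r₂ → sumFrom (r₁ ℕ.+ 1 ℕ.+ k) (suc m ∸ (r₁ ℕ.+ 1 ℕ.+ k)) (f k) ≡ sumFrom 0 (suc m) (T k)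
      row k k≤r₂ = begin
        sumFrom a (suc m ∸ a) (f k)
          ≡⟨ sum-cong a (suc m ∸ a) {f k} {T k} (λ j lo hi → term k j lo (ℕ.<⇒≤ (≡.subst (j <_) (ℕ.m+[n∸m]≡n a≤) hi))) ⟩
        sumFrom a (suc m ∸ a) (T k)
          ≡⟨ ℚ.+-identityˡ _ ⟨
        0ℚ + sumFrom a (suc m ∸ a) (T k)
          ≡⟨ cong (_+ sumFrom a (suc m ∸ a) (T k)) (sum-zero 0 a (λ j _ j< → T-low k j j<)) ⟨
        sumFrom 0 a (T k) + sumFrom a (suc m ∸ a) (T k)
          ≡⟨ sum-split 0 a (suc m ∸ a) (T k) ⟨
        sumFrom 0 (a ℕ.+ (suc m ∸ a)) (T k)
          ≡⟨ cong (λ l → sumFrom 0 l (T k)) (ℕ.m+[n∸m]≡n a≤) ⟩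
        sumFrom 0 (suc m) (T k) ∎
        where
        a = r₁ ℕ.+ 1 ℕ.+ k
        a≤ : a ≤ suc m
        a≤ = ℕ.m≤n⇒m≤1+n (≡.subst (λ x → x ℕ.+ k ≤ m) (ℕ.+-comm 1 r₁) (s≤s (ℕ.+-monoʳ-≤ r₁ k≤r₂)))
      extra : ∀ k → suc r₂ ≤ k → sumFrom 0 (suc m) (T k) ≡ 0ℚ
      extra k r₂<k = sum-zero 0 (suc m) (λ j _ j≤m → T-low k j
        (ℕ.<-≤-trans j≤m (≡.subst (λ x → suc m ≤ x ℕ.+ k) (ℕ.+-comm 1 r₁) (s≤s (≡.subst (_≤ r₁ ℕ.+ k) (ℕ.+-suc r₁ r₂) (ℕ.+-monoʳ-≤ r₁ r₂<k))))))
      column : ∀ j → j ≤ m → sumFrom 0 (suc m) (λ k → T k j) ≡ sgn r₁ * ((reflect b ⊛ A⁺ r₁) j * W j)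
      column j j≤m = begin
        sumFrom 0 (suc m) (λ k → T k j)
          ≡⟨ sum-*ˡ 0 (suc m) (sgn r₁ * W j) (λ k → reflect b k * shift k (A⁺ r₁) j) ⟩
        sgn r₁ * W j * sumFrom 0 (suc m) (λ k → reflect b k * shift k (A⁺ r₁) j)
          ≡⟨ cong (sgn r₁ * W j *_) (⊛-shift (reflect b) (A⁺ r₁) j≤m) ⟨
        sgn r₁ * W j * (reflect b ⊛ A⁺ r₁) j
          ≡⟨ solve 3 (λ s w x → s :* w :* x := s :* (x :* w)) refl (sgn r₁) (W j) ((reflect b ⊛ A⁺ r₁) j) ⟩
        sgn r₁ * ((reflect b ⊛ A⁺ r₁) j * W j) ∎
      aux : ∀ {c d} → c ≡ m → d ≡ suc m →
        Σ[ 0 ⋯ r₂ ] (λ k → Σ[ r₁ ℕ.+ 1 ℕ.+ k ⋯ c ] (λ j →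
          sgn (r₁ ℕ.+ k) * binom (j ∸ 1 ∸ k) r₁ * binom (N ∸ 1 ∸ j) (d ∸ j) * b k * b (j ∸ k) * b (N ∸ j)))
        ≡ sgn r₁ * L (reflect b ⊛ A⁺ r₁)
      aux refl refl = begin
        sumFrom 0 (suc r₂) (λ k → sumFrom (r₁ ℕ.+ 1 ℕ.+ k) (suc m ∸ (r₁ ℕ.+ 1 ℕ.+ k)) (f k))
          ≡⟨ sum-cong 0 (suc r₂) {λ k → sumFrom (r₁ ℕ.+ 1 ℕ.+ k) (suc m ∸ (r₁ ℕ.+ 1 ℕ.+ k)) (f k)} {R}
               (λ k _ k< → row k (ℕ.≤-pred k<)) ⟩
        sumFrom 0 (suc r₂) R
          ≡⟨ ℚ.+-identityʳ _ ⟨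
        sumFrom 0 (suc r₂) R + 0ℚ
          ≡⟨ cong (sumFrom 0 (suc r₂) R +_) (sum-zero (suc r₂) (suc r₁) {R} (λ k lo _ → extra k lo)) ⟨
        sumFrom 0 (suc r₂) R + sumFrom (suc r₂) (suc r₁) R
          ≡⟨ sum-split 0 (suc r₂) (suc r₁) R ⟨
        sumFrom 0 (suc r₂ ℕ.+ suc r₁) R
          ≡⟨ cong (λ l → sumFrom 0 (suc l) R) (trans (ℕ.+-suc r₂ r₁) (cong suc (ℕ.+-comm r₂ r₁))) ⟩
        sumFrom 0 (suc m) R
          ≡⟨ sum-swap 0 (suc m) 0 (suc m) T ⟩
        sumFrom 0 (suc m) (λ j → sumFrom 0 (suc m) (λ k → T k j))
          ≡⟨ sum-cong 0 (suc m) {λ j → sumFrom 0 (suc m) (λ k → T k j)} {λ j → sgn r₁ * ((reflect b ⊛ A⁺ r₁) j * W j)}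
               (λ j _ j< → column j (ℕ.≤-pred j<)) ⟩
        sumFrom 0 (suc m) (λ j → sgn r₁ * ((reflect b ⊛ A⁺ r₁) j * W j))
          ≡⟨ sum-*ˡ 0 (suc m) (sgn r₁) (λ j → (reflect b ⊛ A⁺ r₁) j * W j) ⟩
        sgn r₁ * L (reflect b ⊛ A⁺ r₁) ∎
        where
        R : ℕ → ℚ
        R k = sumFrom 0 (suc m) (T k)

    L-X : L X ≡ W 1
    L-X = trans (sum-single (suc m) (λ k → X k * W k) {1} (s≤s (s≤s z≤n))
        (λ k k≢1 _ → trans (cong (_* W k) (X-≢1 k≢1)) (ℚ.*-zeroˡ (W k))))
      (ℚ.*-identityˡ (W 1))

    L-X⊛ : ∀ c → L (X ⊛ c) ≡ sumFrom 0 m (λ k → c k * W (suc k))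
    L-X⊛ c = begin
      (X ⊛ c) 0 * W 0 + sumFrom 1 m (λ k → (X ⊛ c) k * W k)
        ≡⟨ cong₂ _+_ (trans (cong (_* W 0) (at (X-⊛ c) 0)) (ℚ.*-zeroˡ (W 0))) (sum-suc 0 m (λ k → (X ⊛ c) k * W k)) ⟩
      0ℚ + sumFrom 0 m (λ k → (X ⊛ c) (suc k) * W (suc k))
        ≡⟨ ℚ.+-identityˡ _ ⟩
      sumFrom 0 m (λ k → (X ⊛ c) (suc k) * W (suc k))
        ≡⟨ sum-cong 0 m {λ k → (X ⊛ c) (suc k) * W (suc k)} {λ k → c k * W (suc k)} (λ k _ _ → cong (_* W (suc k)) (at (X-⊛ c) (suc k))) ⟩
      sumFrom 0 m (λ k → c k * W (suc k)) ∎
      where open ≡.≡-Reasoning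

    -- Insert `F(-t) = F(t) + t` in the first factor and split off the constant `(-1)^r₁` of the
    -- second; its sign meets the outer one and squares to `1`.
    L-reflect : sgn r₁ * L (reflect b ⊛ A⁺ r₁) ≡ sgn r₁ * (L (β ⊛ A r₁) + L (X ⊛ A r₁)) - (L β + L X)
    L-reflect = begin
      σ * L (reflect b ⊛ A⁺ r₁)
        ≡⟨ cong (σ *_) (L-cong (at expand)) ⟩
      σ * L (β ⊛ A r₁ ⊕ X ⊛ A r₁ ⊕ (- σ) • (β ⊕ X))
        ≡⟨ cong (σ *_) (trans (L-+ (β ⊛ A r₁ ⊕ X ⊛ A r₁) ((- σ) • (β ⊕ X)))
             (cong₂ _+_ (L-+ (β ⊛ A r₁) (X ⊛ A r₁)) (trans (L-• (- σ) (β ⊕ X)) (cong (- σ *_) (L-+ β X))))) ⟩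
      σ * (L (β ⊛ A r₁) + L (X ⊛ A r₁) + - σ * (L β + L X))
        ≡⟨ solve 3 (λ s x y → s :* (x :+ (:- s) :* y) := s :* x :- s :* s :* y) refl σ (L (β ⊛ A r₁) + L (X ⊛ A r₁)) (L β + L X) ⟩
      σ * (L (β ⊛ A r₁) + L (X ⊛ A r₁)) - σ * σ * (L β + L X)
        ≡⟨ cong (λ x → σ * (L (β ⊛ A r₁) + L (X ⊛ A r₁)) - x * (L β + L X)) (sgn-square r₁) ⟩
      σ * (L (β ⊛ A r₁) + L (X ⊛ A r₁)) - 1ℚ * (L β + L X)
        ≡⟨ cong (λ x → σ * (L (β ⊛ A r₁) + L (X ⊛ A r₁)) - x) (ℚ.*-identityˡ (L β + L X)) ⟩
      σ * (L (β ⊛ A r₁) + L (X ⊛ A r₁)) - (L β + L X) ∎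
      where
      open ≡.≡-Reasoning
      σ = sgn r₁
      expand : reflect b ⊛ A⁺ r₁ ≋ β ⊛ A r₁ ⊕ X ⊛ A r₁ ⊕ (- σ) • (β ⊕ X)
      expand = R.trans (R.*-congʳ {A⁺ r₁} (mk λ n → trans (sgn-b n) (cong (_+ X n) (sym (A-0 n)))))
        (R.trans (R.distribˡ (β ⊕ X) (A r₁) (⊖ const σ)) (R.+-cong (R.distribʳ (A r₁) β X)
          (mk λ n → trans (at (R.*-congˡ {β ⊕ X} (R.sym (const-neg σ))) n)
                    (trans (⊛-comm-at (β ⊕ X) (const (- σ)) n) (const-⊛-at (- σ) (β ⊕ X) n)))))

    -- Vanishing by parity.

    module Parity (even : sgn N ≡ 1ℚ) where
      private
        sgn-N′ : sgn N′ ≡ - 1ℚ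
        sgn-N′ = trans (solve 1 (λ x → x := :- (:- x)) refl (sgn N′)) (cong -_ even)

      -- The indices add up to the odd number `N - 1`, and `small` gives `N - 1 - k ≥ 2`, so the
      -- second index is not the exceptional `1`.
      b-b-zero : ∀ {k} → k ≤ m → k ≢ 1 → b k * b (N′ ∸ k) ≡ 0ℚ
      b-b-zero {k} k≤m k≢1 = b-b-odd k≢1 ne (trans (cong sgn (ℕ.m+[n∸m]≡n (ℕ.≤-trans k≤m (ℕ.<⇒≤ (ℕ.<⇒≤ small))))) sgn-N′)
        where
        ne : N′ ∸ k ≢ 1
        ne e = ℕ.<-irrefl (sym e) (ℕ.m+n≤o⇒m≤o∸n 2 (ℕ.≤-trans (s≤s (s≤s k≤m)) small))

      b-W-zero : ∀ {k} → k ≤ m → k ≢ 1 → b k * W (suc k) ≡ 0ℚ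
      b-W-zero {k} k≤m k≢1 = begin
        b k * W (suc k)
          ≡⟨ cong (b k *_) (binom-W (s≤s k≤m)) ⟨
        b k * (binom (N′ ∸ suc k) (suc m ∸ suc k) * b (N′ ∸ k))
          ≡⟨ solve 3 (λ x y z → x :* (y :* z) := y :* (x :* z)) refl (b k) (binom (N′ ∸ suc k) (suc m ∸ suc k)) (b (N′ ∸ k)) ⟩
        binom (N′ ∸ suc k) (suc m ∸ suc k) * (b k * b (N′ ∸ k))
          ≡⟨ cong (binom (N′ ∸ suc k) (suc m ∸ suc k) *_) (b-b-zero k≤m k≢1) ⟩
        binom (N′ ∸ suc k) (suc m ∸ suc k) * 0ℚ
          ≡⟨ ℚ.*-zeroʳ (binom (N′ ∸ suc k) (suc m ∸ suc k)) ⟩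
        0ℚ ∎
        where open ≡.≡-Reasoning

      b-N′ : b N′ ≡ 0ℚ
      b-N′ = trans (sym (ℚ.*-identityˡ (b N′))) (b-b-zero {0} z≤n (λ ()))

      W-one : W 1 ≡ 0ℚ
      W-one = trans (sym (ℚ.*-identityˡ (W 1))) (b-W-zero {0} z≤n (λ ()))

      A-W-zero : ∀ r {k} → k ≤ m → k ≢ 1 → A r k * W (suc k) ≡ 0ℚ
      A-W-zero r {zero}  _   _   = trans (cong (sgn r *_) W-one) (ℚ.*-zeroʳ (sgn r))
      A-W-zero r {suc k} k≤m k≢1 = trans (ℚ.*-assoc (binom k r) (b (suc k)) (W (2 ℕ.+ k)))
        (trans (cong (binom k r *_) (b-W-zero k≤m k≢1)) (ℚ.*-zeroʳ (binom k r)))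

      -- `W (k + 1)` is a multiple of `b (N - 1 - k)`, so only `k = 1` survives; there `A_r` has the
      -- coefficient `binom 0 r` times `b 1 = -1/2`.
      A-W-sum : ∀ r l → 2 ℕ.+ l ≤ suc m →
        sumFrom 0 (2 ℕ.+ l) (λ k → A r k * W (suc k)) ≡ - (δ0 r * (ℤ.+ 1 / 2) * W 2)
      A-W-sum r l l≤m = trans (sum-single (2 ℕ.+ l) (λ k → A r k * W (suc k)) {1} (s≤s (s≤s z≤n))
          (λ k k≢1 k< → A-W-zero r (ℕ.≤-pred (ℕ.≤-trans k< l≤m)) k≢1))
        (trans (cong (λ x → x * b 1 * W 2) (binom-δ r))
          (solve 2 (λ d w → d :* con (b 1) :* w := :- (d :* con (ℤ.+ 1 / 2) :* w)) refl (δ0 r) (W 2)))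
        where
        binom-δ : ∀ r → binom 0 r ≡ δ0 r
        binom-δ zero    = refl
        binom-δ (suc r) = binom-vanish {0} {suc r} (s≤s z≤n)

      A-W-sum₁ : ∀ r → sumFrom 0 1 (λ k → A r k * W (suc k)) ≡ 0ℚ
      A-W-sum₁ r = trans (ℚ.+-identityʳ (A r 0 * W 1)) (A-W-zero r {0} z≤n (λ ()))

  δ0-cong : ∀ r {x y} → (r ≡ 0 → x ≡ y) → δ0 r * x ≡ δ0 r * y
  δ0-cong zero    p = cong (1ℚ *_) (p refl)
  δ0-cong (suc r) {x} {y} p = trans (ℚ.*-zeroˡ x) (sym (ℚ.*-zeroˡ y))

  -- Comparison of the two sides.

  module Comparison (r₁ r₂ N′ : ℕ) (small : 3 ℕ.+ (r₁ ℕ.+ r₂) ≤ N′) (even : sgn (suc N′) ≡ 1ℚ) where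
    open Weights r₁ r₂ N′ small
    open Parity even
    open Evaluation N′
    private
      N m : ℕ
      N = suc N′
      m = suc (r₁ ℕ.+ r₂)
      σ₁ σ₂ δ₁ δ₂ ½ : ℚ
      σ₁ = sgn r₁
      σ₂ = sgn r₂
      δ₁ = δ0 r₁
      δ₂ = δ0 r₂
      ½ = ℤ.+ 1 / 2

    -- The length is explicit because the left-hand side yields these sums with length `m + 1` and
    -- the right-hand side with length `m`.
    G : ℕ → ℕ → ℚ
    G l r = sumFrom 0 l (λ k → A r k * W (suc k))

    X-A-N : ∀ r → (X ⊛ A r) N ≡ 0ℚ
    X-A-N r = trans (at (X-⊛ (A r)) N) (trans (shift-A r 1 N′ (ℕ.≤-trans (s≤s z≤n) small))
      (trans (cong (binom (N′ ∸ 1) r *_) b-N′) (ℚ.*-zeroʳ (binom (N′ ∸ 1) r))))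

    X-at : ∀ f → (X ⊛ f) N ≡ f N′
    X-at f = at (X-⊛ f) N

    -- Both parts are already sums of weights, by mere reindexing. It is applied only under a
    -- Kronecker delta, where one index is zero and the other equals `r₁ + r₂`.
    boundary : S′ β (r₁ ℕ.+ r₂) N′ + (X ⊛ A (r₁ ℕ.+ r₂)) N′ ≡ G m 0 + W 2
    boundary = cong₂ _+_ (S′-at β (r₁ ℕ.+ r₂) N′) (at (X-⊛ (A (r₁ ℕ.+ r₂))) N′)

    boundary₁ : δ₁ * (S′ β r₂ N′ + (X ⊛ A r₂) N′) ≡ δ₁ * (G m 0 + W 2)
    boundary₁ = δ0-cong r₁ λ r₁≡0 → trans
      (cong (λ r → S′ β r N′ + (X ⊛ A r) N′) (cong (ℕ._+ r₂) (sym r₁≡0))) boundary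

    boundary₂ : δ₂ * (S′ β r₁ N′ + (X ⊛ A r₁) N′) ≡ δ₂ * (G m 0 + W 2)
    boundary₂ = δ0-cong r₂ λ r₂≡0 → trans
      (cong (λ r → S′ β r N′ + (X ⊛ A r) N′) (trans (sym (ℕ.+-identityʳ r₁)) (cong (r₁ ℕ.+_) (sym r₂≡0)))) boundary

    -- The polar parts are expanded and every product is replaced by its linear form; the terms
    -- `X ⊛ A r` drop out in degree `N`, because `b (N - 1) = 0`.
    lhs-value : (A⁺ r₁ ⊛ (A⁺ r₂ ⊛ A⁺ 0)) N ≡
      δ₁ * (G m 0 + W 2) + δ₂ * (G m 0 + W 2) - L β
        + (σ₁ * (L (β ⊛ A r₁) + G (suc m) r₁) + σ₂ * (L (β ⊛ A r₂) + G (suc m) r₂))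
      - (A m N - (σ₁ * S (A r₁) m N + σ₂ * S (A r₂) m N))
      + σ₁ * S′ β r₂ N + σ₂ * S′ β r₁ N + σ₁ * A r₂ N + σ₂ * A r₁ N + σ₁ * (σ₂ * b N)
    lhs-value = begin
      (A⁺ r₁ ⊛ (A⁺ r₂ ⊛ A⁺ 0)) N
        ≡⟨ at (expand-product seriesAlgebra (A r₁) (A r₂) β (const σ₁) (const σ₂)) N ⟩
      (A r₁ ⊛ (A r₂ ⊛ β)) N - (A r₁ ⊛ A r₂) N - (const σ₁ ⊛ (A r₂ ⊛ β)) N - (const σ₂ ⊛ (A r₁ ⊛ β)) N
        + (const σ₁ ⊛ A r₂) N + (const σ₂ ⊛ A r₁) N + (const σ₁ ⊛ (const σ₂ ⊛ β)) N - (const σ₁ ⊛ const σ₂) N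
        ≡⟨ cong₂ _-_ (cong₂ _+_ (cong₂ _+_ (cong₂ _+_ (cong₂ _-_ (cong₂ _-_ (cong₂ _-_ T-value P-value)
               (trans (const-⊛-at σ₁ (A r₂ ⊛ β) N) (cong (σ₁ *_) (A-β r₂))))
               (trans (const-⊛-at σ₂ (A r₁ ⊛ β) N) (cong (σ₂ *_) (A-β r₁))))
               (const-⊛-at σ₁ (A r₂) N)) (const-⊛-at σ₂ (A r₁) N))
               (trans (const-⊛-at σ₁ (const σ₂ ⊛ β) N) (cong (σ₁ *_) (trans (const-⊛-at σ₂ β N) (cong (σ₂ *_) (A-0 N))))))
               (trans (const-⊛-at σ₁ (const σ₂) N) (ℚ.*-zeroʳ σ₁)) ⟩
      T - P - σ₁ * - S′ β r₂ N - σ₂ * - S′ β r₁ N + σ₁ * A r₂ N + σ₂ * A r₁ N + σ₁ * (σ₂ * b N) - 0ℚ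
        ≡⟨ solve 9 (λ t p s s′ x y a a′ z →
             t :- p :- s :* (:- x) :- s′ :* (:- y) :+ s :* a :+ s′ :* a′ :+ z :- con 0ℚ :=
             t :- p :+ s :* x :+ s′ :* y :+ s :* a :+ s′ :* a′ :+ z) refl
             T P σ₁ σ₂ (S′ β r₂ N) (S′ β r₁ N) (A r₂ N) (A r₁ N) (σ₁ * (σ₂ * b N)) ⟩
      T - P + σ₁ * S′ β r₂ N + σ₂ * S′ β r₁ N + σ₁ * A r₂ N + σ₂ * A r₁ N + σ₁ * (σ₂ * b N) ∎
      where
      open ≡.≡-Reasoning
      P = A m N - (σ₁ * S (A r₁) m N + σ₂ * S (A r₂) m N)
      T = δ₁ * (G m 0 + W 2) + δ₂ * (G m 0 + W 2) - L β
        + (σ₁ * (L (β ⊛ A r₁) + G (suc m) r₁) + σ₂ * (L (β ⊛ A r₂) + G (suc m) r₂))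

      A-β : ∀ r → (A r ⊛ β) N ≡ - S′ β r N
      A-β r = trans (⊛-comm-at (A r) β N) (trans (at (β-⊛-A r) N)
        (cong -_ (trans (cong (S′ β r N +_) (X-A-N r)) (ℚ.+-identityʳ (S′ β r N)))))

      product : A r₁ ⊛ A r₂ ≋ A m ⊕ ⊖ (const δ₁ ⊛ (X ⊛ A r₂) ⊕ const δ₂ ⊛ (X ⊛ A r₁))
                              ⊕ ⊖ (const σ₁ ⊛ S (A r₁) m ⊕ const σ₂ ⊛ S (A r₂) m)
      product = isolate-product seriesAlgebra {A r₁} {A r₂} {const δ₁} {const δ₂} {X} {A m} {const σ₁} {const σ₂}
                  {S (A r₁) m} {S (A r₂) m} (A-product r₁ r₂)

      P-value : (A r₁ ⊛ A r₂) N ≡ P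
      P-value = trans (at product N) (trans
        (cong₂ _-_ (cong (λ x → A m N - x) (cong₂ _+_ (zero-term δ₁ r₂) (zero-term δ₂ r₁)))
          (cong₂ _+_ (const-⊛-at σ₁ (S (A r₁) m) N) (const-⊛-at σ₂ (S (A r₂) m) N)))
        (solve 2 (λ x y → x :- (con 0ℚ :+ con 0ℚ) :- y := x :- y) refl (A m N) (σ₁ * S (A r₁) m N + σ₂ * S (A r₂) m N)))
        where
        zero-term : ∀ d r → (const d ⊛ (X ⊛ A r)) N ≡ 0ℚ
        zero-term d r = trans (const-⊛-at d (X ⊛ A r) N) (trans (cong (d *_) (X-A-N r)) (ℚ.*-zeroʳ d))

      T-value : (A r₁ ⊛ (A r₂ ⊛ β)) N ≡ T
      T-value = trans
        (at (triple-product seriesAlgebra {A r₁} {A r₂} {const δ₁} {const δ₂} {X} {A m} {const σ₁} {const σ₂}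
               {S (A r₁) m} {S (A r₂) m} {β} {S′ β r₁} {S′ β r₂} {S′ β m} {S′ (A r₁ ⊛ β) m} {S′ (A r₂ ⊛ β) m} product (β-⊛-A r₁) (β-⊛-A r₂) (β-⊛-A m) (β-⊛-S (A r₁) m) (β-⊛-S (A r₂) m)) N)
        (cong₂ _+_ (cong₂ _-_ (cong₂ _+_ (side δ₁ r₂ boundary₁) (side δ₂ r₁ boundary₂))
            (trans (cong₂ _+_ (S′-L β) (X-A-N m)) (ℚ.+-identityʳ (L β))))
          (cong₂ _+_ (main σ₁ r₁) (main σ₂ r₂)))
        where
        side : ∀ d r {v} → d * (S′ β r N′ + (X ⊛ A r) N′) ≡ v →
               (const d ⊛ (X ⊛ (S′ β r ⊕ X ⊛ A r))) N ≡ v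
        side d r e = trans (const-⊛-at d (X ⊛ (S′ β r ⊕ X ⊛ A r)) N) (trans (cong (d *_) (X-at (S′ β r ⊕ X ⊛ A r))) e)
        main : ∀ s r → (const s ⊛ (S′ (A r ⊛ β) m ⊕ X ⊛ S (A r) m)) N ≡ s * (L (β ⊛ A r) + G (suc m) r)
        main s r = trans (const-⊛-at s (S′ (A r ⊛ β) m ⊕ X ⊛ S (A r) m) N)
          (cong (s *_) (cong₂ _+_ (trans (S′-L (A r ⊛ β)) (L-cong (⊛-comm-at (A r) β)))
                                  (trans (X-at (S (A r) m)) (S-W (A r)))))

    sgn-δ0 : ∀ r → sgn r * δ0 r ≡ δ0 r
    sgn-δ0 zero    = refl
    sgn-δ0 (suc r) = ℚ.*-zeroʳ (sgn (suc r))

    -- If `r₁ + r₂ > 0`, both lengths reach the only surviving index `1`, and `G m 0 = - W 2 / 2`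
    -- halves the delta terms. If `r₁ = r₂ = 0`, then `m = 1` is too short to reach it, and the
    -- halving comes from the longer sums instead.
    W₂-terms :
      δ₁ * (G m 0 + W 2) + δ₂ * (G m 0 + W 2) + (σ₁ * G (suc m) r₁ + σ₂ * G (suc m) r₂) ≡
      δ₁ * ½ * W 2 + δ₂ * ½ * W 2 + (σ₁ * G m r₁ + σ₂ * G m r₂)
    W₂-terms = go (r₁ ℕ.+ r₂) refl
      where
      open ≡.≡-Reasoning
      top : ∀ r → G (suc m) r ≡ - (δ0 r * ½ * W 2)
      top r = A-W-sum r (r₁ ℕ.+ r₂) ℕ.≤-refl
      signed : ∀ r → sgn r * - (δ0 r * ½ * W 2) ≡ - (δ0 r * ½ * W 2)
      signed r = trans (solve 4 (λ s d h w → s :* (:- (d :* h :* w)) := :- (s :* d :* h :* w)) refl (sgn r) (δ0 r) ½ (W 2))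
        (cong (λ x → - (x * ½ * W 2)) (sgn-δ0 r))
      Goal : (ℕ → ℚ) → ℚ → ℚ → Set
      Goal g d d′ = d * (g 0 + W 2) + d′ * (g 0 + W 2) + (σ₁ * G (suc m) r₁ + σ₂ * G (suc m) r₂) ≡
        d * ½ * W 2 + d′ * ½ * W 2 + (σ₁ * g r₁ + σ₂ * g r₂)
      go : ∀ R → r₁ ℕ.+ r₂ ≡ R → Goal (G m) δ₁ δ₂
      go zero eq = begin
        δ₁ * (G m 0 + W 2) + δ₂ * (G m 0 + W 2) + (σ₁ * G (suc m) r₁ + σ₂ * G (suc m) r₂)
          ≡⟨ cong₂ _+_ (cong (λ g → δ₁ * (g + W 2) + δ₂ * (g + W 2)) (bottom 0))
               (cong₂ _+_ (trans (cong (σ₁ *_) (top r₁)) (signed r₁)) (trans (cong (σ₂ *_) (top r₂)) (signed r₂))) ⟩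
        δ₁ * (0ℚ + W 2) + δ₂ * (0ℚ + W 2) + (- (δ₁ * ½ * W 2) + - (δ₂ * ½ * W 2))
          ≡⟨ solve 5 (λ d d′ w s s′ → d :* (con 0ℚ :+ w) :+ d′ :* (con 0ℚ :+ w) :+ (:- (d :* con ½ :* w) :+ :- (d′ :* con ½ :* w)) :=
               d :* con ½ :* w :+ d′ :* con ½ :* w :+ (s :* con 0ℚ :+ s′ :* con 0ℚ)) refl δ₁ δ₂ (W 2) σ₁ σ₂ ⟩
        δ₁ * ½ * W 2 + δ₂ * ½ * W 2 + (σ₁ * 0ℚ + σ₂ * 0ℚ)
          ≡⟨ cong₂ (λ x y → δ₁ * ½ * W 2 + δ₂ * ½ * W 2 + (σ₁ * x + σ₂ * y)) (bottom r₁) (bottom r₂) ⟨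
        δ₁ * ½ * W 2 + δ₂ * ½ * W 2 + (σ₁ * G m r₁ + σ₂ * G m r₂) ∎
        where
        bottom : ∀ r → G m r ≡ 0ℚ
        bottom r = trans (cong (λ l → G (suc l) r) eq) (A-W-sum₁ r)
      go (suc R) eq = begin
        δ₁ * (G m 0 + W 2) + δ₂ * (G m 0 + W 2) + (σ₁ * G (suc m) r₁ + σ₂ * G (suc m) r₂)
          ≡⟨ cong₂ _+_ (cong (λ g → δ₁ * (g + W 2) + δ₂ * (g + W 2)) (bottom 0))
               (cong₂ (λ x y → σ₁ * x + σ₂ * y) (trans (top r₁) (sym (bottom r₁))) (trans (top r₂) (sym (bottom r₂)))) ⟩
        δ₁ * (- (1ℚ * ½ * W 2) + W 2) + δ₂ * (- (1ℚ * ½ * W 2) + W 2) + (σ₁ * G m r₁ + σ₂ * G m r₂)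
          ≡⟨ solve 4 (λ d d′ w z → d :* (:- (con 1ℚ :* con ½ :* w) :+ w) :+ d′ :* (:- (con 1ℚ :* con ½ :* w) :+ w) :+ z :=
               d :* con ½ :* w :+ d′ :* con ½ :* w :+ z) refl δ₁ δ₂ (W 2) (σ₁ * G m r₁ + σ₂ * G m r₂) ⟩
        δ₁ * ½ * W 2 + δ₂ * ½ * W 2 + (σ₁ * G m r₁ + σ₂ * G m r₂) ∎
        where
        bottom : ∀ r → G m r ≡ - (δ0 r * ½ * W 2)
        bottom r = trans (cong (λ l → G (suc l) r) eq)
          (A-W-sum r R (s≤s (≡.subst (_≤ suc (r₁ ℕ.+ r₂)) eq (ℕ.n≤1+n (r₁ ℕ.+ r₂)))))

    -- The parity of `b (suc s₁)` trades the sign `(-1)^s₁` for `-1`, so that the product cancels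
    -- the one in `edge-term`. The delta correction occurs for `s₁ = 0` and is multiplied by
    -- `b (N - 1) = 0`.
    first-term : ∀ s₁ s₂ →
      sgn (s₁ ℕ.+ s₂) * B (s₁ ℕ.+ 1) * B (N ∸ s₁ ∸ 1) * invFact (s₁ ℕ.+ 1) * invFact (N ∸ s₁ ∸ 1)
        + (δ0 s₁ * (ℤ.+ 1 / 2)) * binom (N ∸ 3) s₂ * (B (N ∸ 2) * invFact (N ∸ 2))
      ≡ - (sgn s₂ * (b (suc s₁) * b (N ∸ suc s₁))) + δ0 s₁ * (½ * shift 2 (A s₂) N)
    first-term s₁ s₂ = cong₂ _+_ (aux (ℕ.+-comm s₁ 1) (trans (ℕ.∸-+-assoc N s₁ 1) (cong (N ∸_) (ℕ.+-comm s₁ 1))))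
      (trans (solve 4 (λ d h x y → d :* h :* x :* y := d :* (h :* (x :* y))) refl (δ0 s₁) ½ (binom (N ∸ 3) s₂) (b (N ∸ 2)))
        (cong (λ x → δ0 s₁ * (½ * x)) (sym (shift-A s₂ 2 N′ (ℕ.≤-trans (s≤s (s≤s z≤n)) small)))))
      where
      open ≡.≡-Reasoning
      δ-b : δ0 s₁ * b (N ∸ suc s₁) ≡ 0ℚ
      δ-b = trans (δ0-cong s₁ (λ s₁≡0 → trans (cong (λ s → b (N ∸ suc s)) s₁≡0) b-N′)) (ℚ.*-zeroʳ (δ0 s₁))
      aux : ∀ {p q} → p ≡ suc s₁ → q ≡ N ∸ suc s₁ →
        sgn (s₁ ℕ.+ s₂) * B p * B q * invFact p * invFact q ≡ - (sgn s₂ * (b (suc s₁) * b (N ∸ suc s₁)))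
      aux refl refl = begin
        sgn (s₁ ℕ.+ s₂) * B p * B q * invFact p * invFact q
          ≡⟨ solve 5 (λ s x y u v → s :* x :* y :* u :* v := s :* (x :* u) :* (y :* v)) refl (sgn (s₁ ℕ.+ s₂)) (B p) (B q) (invFact p) (invFact q) ⟩
        sgn (s₁ ℕ.+ s₂) * b p * b q
          ≡⟨ cong (λ x → x * b p * b q) (sgn-+ s₁ s₂) ⟩
        sgn s₁ * sgn s₂ * b p * b q
          ≡⟨ solve 5 (λ s t x y d → s :* t :* x :* y :=
               t :* (s :* x :+ x :+ d) :* y :- t :* (x :* y) :- t :* (d :* y)) refl (sgn s₁) (sgn s₂) (b p) (b q) (δ0 s₁) ⟩
        sgn s₂ * (sgn s₁ * b p + b p + δ0 s₁) * b q - sgn s₂ * (b p * b q) - sgn s₂ * (δ0 s₁ * b q)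
          ≡⟨ cong₂ (λ x y → sgn s₂ * x * b q - sgn s₂ * (b p * b q) - sgn s₂ * y) (b-parity s₁) δ-b ⟩
        sgn s₂ * 0ℚ * b q - sgn s₂ * (b p * b q) - sgn s₂ * 0ℚ
          ≡⟨ solve 3 (λ t y z → t :* con 0ℚ :* y :- z :- t :* con 0ℚ := :- z) refl (sgn s₂) (b q) (sgn s₂ * (b p * b q)) ⟩
        - (sgn s₂ * (b p * b q)) ∎
        where
        p = suc s₁
        q = N ∸ suc s₁

    first-term-W₁ : δ0 r₁ * (½ * shift 2 (A r₂) N) ≡ δ₁ * ½ * W 2
    first-term-W₁ = trans (δ0-cong r₁ λ r₁≡0 → cong (λ r → ½ * shift 2 (A r) N) (cong (ℕ._+ r₂) (sym r₁≡0)))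
      (sym (ℚ.*-assoc δ₁ ½ (W 2)))

    first-term-W₂ : δ0 r₂ * (½ * shift 2 (A r₁) N) ≡ δ₂ * ½ * W 2
    first-term-W₂ = trans (δ0-cong r₂ λ r₂≡0 → cong (λ r → ½ * shift 2 (A r) N) (trans (sym (ℕ.+-identityʳ r₁)) (cong (r₁ ℕ.+_) (sym r₂≡0))))
      (sym (ℚ.*-assoc δ₂ ½ (W 2)))

    -- Pascal's rule passes from row `N` to row `N - 1`, whose binomials times `b N` are
    -- coefficients of the `A_r` in degree `N`; one of them is `W 0`.
    top-coefficient :
      (binom N (r₁ ℕ.+ r₂ ℕ.+ 2) + Cyc (λ s₁ s₂ → sgn s₂ * binom N (s₁ ℕ.+ 1)) r₁ r₂ + sgn (r₁ ℕ.+ r₂)) * (B N * invFact N)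
      ≡ A m N + W 0 + (σ₂ * (A r₁ N + A (suc r₁) N) + σ₁ * (A r₂ N + A (suc r₂) N)) + σ₁ * (σ₂ * b N)
    top-coefficient = trans
      (cong₂ (λ x y → (x + y + sgn (r₁ ℕ.+ r₂)) * b N)
        (trans (cong (binom N) (ℕ.+-comm (r₁ ℕ.+ r₂) 2)) (binom-pascal N′ m))
        (cong₂ (λ x y → σ₂ * x + σ₁ * y) (pascal r₁) (pascal r₂)))
      (trans (cong (λ s → (binom N′ m + binom N′ (suc m) + (σ₂ * (binom N′ r₁ + binom N′ (suc r₁)) + σ₁ * (binom N′ r₂ + binom N′ (suc r₂))) + s) * b N) (sgn-+ r₁ r₂))
        (solve 9 (λ x y s s′ p q u v z →
          (x :+ y :+ (s′ :* (p :+ q) :+ s :* (u :+ v)) :+ s :* s′) :* z :=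
          x :* z :+ y :* z :+ (s′ :* (p :* z :+ q :* z) :+ s :* (u :* z :+ v :* z)) :+ s :* (s′ :* z)) refl
          (binom N′ m) (binom N′ (suc m)) σ₁ σ₂ (binom N′ r₁) (binom N′ (suc r₁)) (binom N′ r₂) (binom N′ (suc r₂)) (b N)))
      where
      pascal : ∀ r → binom N (r ℕ.+ 1) ≡ binom N′ r + binom N′ (suc r)
      pascal r = trans (cong (binom N) (ℕ.+-comm r 1)) (binom-pascal N′ r)

    diagonal-terms :
      Cyc (λ s₁ s₂ → sgn s₁ * Σ[ s₁ ℕ.+ 1 ⋯ s₁ ℕ.+ s₂ ℕ.+ 1 ] (λ k →
            binom (k ∸ 1) s₁ * binom (N ∸ k ∸ 1) (s₂ ℕ.+ s₁ ℕ.+ 1 ∸ k) * b k * b (N ∸ k))) r₁ r₂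
      ≡ σ₁ * S (A r₁) m N + σ₂ * S (A r₂) m N - (A m N + A m N)
    diagonal-terms = begin
      _ ≡⟨ cong₂ (λ x y → σ₁ * x + σ₂ * y)
             (diagonal-term r₁ r₂ (ℕ.≤-trans (ℕ.m≤n+m m 2) small))
             (trans (diagonal-term r₂ r₁ (ℕ.≤-trans (ℕ.m≤n+m (suc (r₂ ℕ.+ r₁)) 2) (≡.subst (λ x → 3 ℕ.+ x ≤ N′) (ℕ.+-comm r₁ r₂) small)))
               (cong (λ x → S (A r₂) (suc x) N - σ₂ * A (suc x) N) (ℕ.+-comm r₂ r₁))) ⟩
      σ₁ * (S (A r₁) m N - σ₁ * A m N) + σ₂ * (S (A r₂) m N - σ₂ * A m N)
        ≡⟨ solve 5 (λ s s′ x y a → s :* (x :- s :* a) :+ s′ :* (y :- s′ :* a) := s :* x :+ s′ :* y :- (s :* s :* a :+ s′ :* s′ :* a)) refl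
             σ₁ σ₂ (S (A r₁) m N) (S (A r₂) m N) (A m N) ⟩
      σ₁ * S (A r₁) m N + σ₂ * S (A r₂) m N - (σ₁ * σ₁ * A m N + σ₂ * σ₂ * A m N)
        ≡⟨ cong₂ (λ x y → σ₁ * S (A r₁) m N + σ₂ * S (A r₂) m N - (x * A m N + y * A m N)) (sgn-square r₁) (sgn-square r₂) ⟩
      σ₁ * S (A r₁) m N + σ₂ * S (A r₂) m N - (1ℚ * A m N + 1ℚ * A m N)
        ≡⟨ cong (λ x → σ₁ * S (A r₁) m N + σ₂ * S (A r₂) m N - (x + x)) (ℚ.*-identityˡ (A m N)) ⟩
      σ₁ * S (A r₁) m N + σ₂ * S (A r₂) m N - (A m N + A m N) ∎
      where open ≡.≡-Reasoning

    -- The formula for `β ⊛ A r₂`, solved for `S′ β r₂`, is put under the linear functional `L`.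
    L-S′β-value : - (σ₂ * L (S′ β r₂)) - W 0 ≡ σ₂ * (L (β ⊛ A r₂) + G m r₂) - W 0
    L-S′β-value = cong (_- W 0) (begin
      - (σ₂ * L (S′ β r₂))
        ≡⟨ solve 2 (λ s x → :- (s :* x) := s :* ((:- con 1ℚ) :* x)) refl σ₂ (L (S′ β r₂)) ⟩
      σ₂ * (- 1ℚ * L (S′ β r₂))
        ≡⟨ cong (σ₂ *_) (L-• (- 1ℚ) (S′ β r₂)) ⟨
      σ₂ * L ((- 1ℚ) • S′ β r₂)
        ≡⟨ cong (σ₂ *_) (L-cong (λ k → trans
             (solve 2 (λ x y → (:- con 1ℚ) :* x := :- (x :+ y) :+ y) refl (S′ β r₂ k) ((X ⊛ A r₂) k))
             (cong (_+ (X ⊛ A r₂) k) (sym (at (β-⊛-A r₂) k))))) ⟩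
      σ₂ * L (β ⊛ A r₂ ⊕ X ⊛ A r₂)
        ≡⟨ cong (σ₂ *_) (trans (L-+ (β ⊛ A r₂) (X ⊛ A r₂)) (cong (L (β ⊛ A r₂) +_) (L-X⊛ (A r₂)))) ⟩
      σ₂ * (L (β ⊛ A r₂) + G m r₂) ∎)
      where open ≡.≡-Reasoning

    reflect-value : σ₁ * L (reflect b ⊛ A⁺ r₁) ≡ σ₁ * (L (β ⊛ A r₁) + G m r₁) - L β
    reflect-value = trans L-reflect (cong₂ (λ x y → σ₁ * (L (β ⊛ A r₁) + x) - y) (L-X⊛ (A r₁))
      (trans (cong (L β +_) (trans L-X W-one)) (ℚ.+-identityʳ (L β))))

    private
      b₁ b₂ Q H : ℚ
      b₁ = b (suc r₁) * b (N ∸ suc r₁)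
      b₂ = b (suc r₂) * b (N ∸ suc r₂)
      Q = sumFrom 1 r₂ (λ k → sgn k * b k * W k)
      H = sumFrom (2 ℕ.+ r₂) r₁ (λ j → S′ β r₂ j * W j)

    lhs≡rhs-values : (A⁺ r₁ ⊛ (A⁺ r₂ ⊛ A⁺ 0)) N ≡
      (- (σ₂ * b₁) + δ₁ * ½ * W 2) + (- (σ₁ * b₂) + δ₂ * ½ * W 2)
      + (A m N + W 0 + (σ₂ * (A r₁ N + A (suc r₁) N) + σ₁ * (A r₂ N + A (suc r₂) N)) + σ₁ * (σ₂ * b N))
      + (σ₁ * S (A r₁) m N + σ₂ * S (A r₂) m N - (A m N + A m N))
      + (σ₂ * (S′ β r₁ N - A (suc r₁) N + b₁) + σ₁ * (S′ β r₂ N - A (suc r₂) N + b₂))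
      + Q - σ₂ * H + (σ₁ * (L (β ⊛ A r₁) + G m r₁) - L β)
    lhs≡rhs-values = begin
      (A⁺ r₁ ⊛ (A⁺ r₂ ⊛ A⁺ 0)) N
        ≡⟨ lhs-value ⟩
      d₁ + d₂ - L β + (σ₁ * (l₁ + G (suc m) r₁) + σ₂ * (l₂ + G (suc m) r₂))
        - (A m N - v) + σ₁ * S′ β r₂ N + σ₂ * S′ β r₁ N + σ₁ * A r₂ N + σ₂ * A r₁ N + z
        ≡⟨ solve 15 (λ d lb s s′ l l′ g g′ a v p p′ c c′ z →
             d :- lb :+ (s :* (l :+ g) :+ s′ :* (l′ :+ g′)) :- (a :- v) :+ p :+ p′ :+ c :+ c′ :+ z :=
             (d :+ (s :* g :+ s′ :* g′)) :+ (s :* l :+ s′ :* l′ :- lb :- (a :- v) :+ p :+ p′ :+ c :+ c′) :+ z) refl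
             (d₁ + d₂) (L β) σ₁ σ₂ l₁ l₂ (G (suc m) r₁) (G (suc m) r₂) (A m N) v
             (σ₁ * S′ β r₂ N) (σ₂ * S′ β r₁ N) (σ₁ * A r₂ N) (σ₂ * A r₁ N) z ⟩
      d₁ + d₂ + (σ₁ * G (suc m) r₁ + σ₂ * G (suc m) r₂) + rest + z
        ≡⟨ cong (λ x → x + rest + z) W₂-terms ⟩
      δ₁ * ½ * W 2 + δ₂ * ½ * W 2 + (σ₁ * G m r₁ + σ₂ * G m r₂) + rest + z
        ≡⟨ regroup (δ₁ * ½ * W 2) (δ₂ * ½ * W 2) b₁ b₂ ⟩
      known + (σ₂ * (l₂ + G m r₂) - W 0) + (σ₁ * (l₁ + G m r₁) - L β)
        ≡⟨ cong (λ x → known + x + (σ₁ * (l₁ + G m r₁) - L β)) (trans L-S′β L-S′β-value) ⟨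
      known + (Q - σ₂ * H) + (σ₁ * (l₁ + G m r₁) - L β)
        ≡⟨ cong (_+ (σ₁ * (l₁ + G m r₁) - L β)) (ℚ.+-assoc known Q (- (σ₂ * H))) ⟨
      known + Q - σ₂ * H + (σ₁ * (l₁ + G m r₁) - L β) ∎
      where
      open ≡.≡-Reasoning
      d₁ = δ₁ * (G m 0 + W 2)
      d₂ = δ₂ * (G m 0 + W 2)
      l₁ = L (β ⊛ A r₁)
      l₂ = L (β ⊛ A r₂)
      v = σ₁ * S (A r₁) m N + σ₂ * S (A r₂) m N
      z = σ₁ * (σ₂ * b N)
      rest = σ₁ * l₁ + σ₂ * l₂ - L β - (A m N - v) + σ₁ * S′ β r₂ N + σ₂ * S′ β r₁ N + σ₁ * A r₂ N + σ₂ * A r₁ N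
      known = (- (σ₂ * b₁) + δ₁ * ½ * W 2) + (- (σ₁ * b₂) + δ₂ * ½ * W 2)
        + (A m N + W 0 + (σ₂ * (A r₁ N + A (suc r₁) N) + σ₁ * (A r₂ N + A (suc r₂) N)) + z)
        + (v - (A m N + A m N))
        + (σ₂ * (S′ β r₁ N - A (suc r₁) N + b₁) + σ₁ * (S′ β r₂ N - A (suc r₂) N + b₂))
      -- Only a polynomial identity is left: `b₁`, `b₂`, `W 0` and the values `A (suc r) N` cancel
      -- among themselves on the right.
      regroup : ∀ e₁ e₂ b₁ b₂ →
        e₁ + e₂ + (σ₁ * G m r₁ + σ₂ * G m r₂) + rest + z ≡
        (- (σ₂ * b₁) + e₁) + (- (σ₁ * b₂) + e₂)
        + (A m N + W 0 + (σ₂ * (A r₁ N + A (suc r₁) N) + σ₁ * (A r₂ N + A (suc r₂) N)) + z)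
        + (v - (A m N + A m N))
        + (σ₂ * (S′ β r₁ N - A (suc r₁) N + b₁) + σ₁ * (S′ β r₂ N - A (suc r₂) N + b₂))
        + (σ₂ * (l₂ + G m r₂) - W 0) + (σ₁ * (l₁ + G m r₁) - L β)
      regroup e₁ e₂ b₁ b₂ = solve 21 (λ e e′ b b′ s s′ g g′ l l′ lb a v p p′ c c′ u u′ w z →
        e :+ e′ :+ (s :* g :+ s′ :* g′) :+ (s :* l :+ s′ :* l′ :- lb :- (a :- v) :+ s :* p′ :+ s′ :* p :+ s :* c′ :+ s′ :* c) :+ z :=
        (:- (s′ :* b) :+ e) :+ (:- (s :* b′) :+ e′)
        :+ (a :+ w :+ (s′ :* (c :+ u) :+ s :* (c′ :+ u′)) :+ z)
        :+ (v :- (a :+ a))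
        :+ (s′ :* (p :- u :+ b) :+ s :* (p′ :- u′ :+ b′))
        :+ (s′ :* (l′ :+ g′) :- w) :+ (s :* (l :+ g) :- lb)) refl
        e₁ e₂ b₁ b₂ σ₁ σ₂ (G m r₁) (G m r₂) l₁ l₂ (L β) (A m N) v (S′ β r₁ N) (S′ β r₂ N) (A r₁ N) (A r₂ N)
        (A (suc r₁) N) (A (suc r₂) N) (W 0) z

  sgn-2* : ∀ n → sgn (n ℕ.+ n) ≡ 1ℚ
  sgn-2* n = trans (sgn-+ n n) (sgn-square n)

  lhs≡rhs : (r₁ r₂ n : ℕ) → r₁ ℕ.+ r₂ ℕ.+ 2 ≤ n → lhs r₁ r₂ n ≡ rhs r₁ r₂ n
  lhs≡rhs r₁ r₂ zero    p = contradiction (≡.subst (_≤ 0) (ℕ.+-comm (r₁ ℕ.+ r₂) 2) p) λ ()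
  lhs≡rhs r₁ r₂ (suc n) p = trans (lhs-⊛ r₁ r₂ (suc n) {n ℕ.+ (n ℕ.+ 0)} (cong suc (ℕ.+-suc n (n ℕ.+ 0))))
    (trans lhs≡rhs-values (sym
      (cong₂ _+_ (cong₂ _-_ (cong₂ _+_ (cong₂ _+_ (cong₂ _+_ (cong₂ _+_
        (cong₂ _+_ (trans (first-term r₁ r₂) (cong (- (sgn r₂ * (b (suc r₁) * b (suc N′ ∸ suc r₁))) +_) first-term-W₁))
                   (trans (first-term r₂ r₁) (cong (- (sgn r₁ * (b (suc r₂) * b (suc N′ ∸ suc r₂))) +_) first-term-W₂)))
        top-coefficient)
        diagonal-terms)
        (cong₂ (λ x y → sgn r₂ * x + sgn r₁ * y)
          (edge-term r₁ (ℕ.≤-trans (s≤s (ℕ.≤-trans (ℕ.m≤m+n r₁ r₂) (ℕ.m≤n+m (r₁ ℕ.+ r₂) 2))) small))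
          (edge-term r₂ (ℕ.≤-trans (s≤s (ℕ.≤-trans (ℕ.m≤n+m r₂ r₁) (ℕ.m≤n+m (r₁ ℕ.+ r₂) 2))) small))))
        single-sum)
        double-sum₁)
        (trans double-sum₂ reflect-value))))
    where
    N′ : ℕ
    N′ = n ℕ.+ (suc n ℕ.+ 0)
    -- `N′` is the sum of `n ≥ 1` and `suc n ≥ r₁ + r₂ + 2`.
    small : 3 ℕ.+ (r₁ ℕ.+ r₂) ≤ N′
    small = ℕ.≤-trans (ℕ.+-mono-≤ (ℕ.≤-trans (s≤s z≤n) r≤n) (s≤s r≤n)) (ℕ.+-monoʳ-≤ n (s≤s (ℕ.≤-reflexive (sym (ℕ.+-identityʳ n)))))
      where
      r≤n : suc (r₁ ℕ.+ r₂) ≤ n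
      r≤n = ℕ.≤-pred (≡.subst (_≤ suc n) (ℕ.+-comm (r₁ ℕ.+ r₂) 2) p)
    even : sgn (suc N′) ≡ 1ℚ
    even = trans (cong (λ k → sgn (suc n ℕ.+ k)) (ℕ.+-identityʳ (suc n))) (sgn-2* (suc n))
    open Weights r₁ r₂ N′ small
    open Evaluation N′
    open Comparison r₁ r₂ N′ small even

open BernoulliConvolutions

open import Data.Nat using (_+_)

theorem4p1 : (r₁ r₂ n : ℕ) → r₁ + r₂ + 2 ≤ n → lhs r₁ r₂ n ≡ rhs r₁ r₂ n
theorem4p1 = lhs≡rhs
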